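{- Let $(G,H)$ be a separable face instance of multicommodity flow that satisfies the cut condition. Then $(3G,H)$ is feasible; i.e., the flow-cut gap of $(G,H)$ is at most $3$.
   Context: $G=(V,E)$ is a planar graph with fixed embedding and capacities $c:E\to\mathbb{Z}_{\ge0}$; $H$ is a demand multigraph on $V$ with each edge of demand $1$. $(G,H)$ is feasible if there is an assignment of nonnegative reals to paths in $G$ so that each demand edge $uv$ receives total value $1$ on $u$–$v$ paths and each supply edge $e$ is used by total value at most $c(e)$. $\delta_G(S)$ is total capacity of edges leaving $S$, $\delta_H(S)$ the number of demand edges leaving $S$; the cut condition is $\delta_G(S)\ge\delta_H(S)$ for all $S\subseteq V$. $kG$ denotes $G$ with capacities multiplied by $k$. A face instance is one where for every demand edge $uv$ there is a face containing both $u$ and $v$; each demand is associated with such a face $F$, giving the demand set $H_F$. Faces are identified with their bounding cycles. The demands on $F$ are separable if there is a contiguous segment $S$ of the cycle $F$ such that every $uv\in H_F$ has exactly one endpoint in $S$. A separable face instance is a face instance in which the demands associated with every face are separable. -}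

module Defs where

open import Data.Nat using (ℕ; zero; suc; _+_; _<_)
open import Data.Fin using (Fin)
open import Data.Fin.Properties using (_≟_)
open import Data.Bool using (Bool; true; false; not; _xor_; if_then_else_)
open import Data.Product using (Σ; ∃; ∃-syntax; _×_; _,_; proj₁; proj₂)
open import Data.Sum using (_⊎_)
open import Data.Nat.ListAction using (sum)
open import Data.List using (List; []; _∷_; map; foldr; filter; length; allFin)
open import Data.List.Relation.Unary.Unique.Propositional using (Unique)
open import Data.Integer using (+_)
open import Data.Rational using (ℚ; 0ℚ; 1ℚ; _/_) renaming (_+_ to _+ℚ_; _*_ to _*ℚ_; _≤_ to _≤ℚ_)
open import Relation.Binary.PropositionalEquality using (_≡_)
open import Relation.Nullary using (¬_; yes; no)

-- Supply graphs with a fixed planar (combinatorial) embedding.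
-- Vertices Fin n, edges Fin m (parallel edges allowed).  Each edge e has
-- two darts (e , false) : u → v and (e , true) : v → u, where ends e = (u , v).

Dart : ℕ → Set
Dart m = Fin m × Bool

iter : {A : Set} → ℕ → (A → A) → A → A
iter zero    f x = x
iter (suc k) f x = f (iter k f x)

module Embedding {n m : ℕ} (ends : Fin m → Fin n × Fin n) (σ : Dart m → Dart m) where
  tail : Dart m → Fin n
  tail (e , false) = proj₁ (ends e)
  tail (e , true)  = proj₂ (ends e)
  head : Dart m → Fin n
  head (e , b) = tail (e , not b)
  rev : Dart m → Dart m
  rev (e , b) = (e , not b)
  -- face permutation: the faces are the orbits of φ, and the boundary walk
  -- of the face of d is d , φ d , φ (φ d) , …
  φ : Dart m → Dart m
  φ d = σ (rev d)
  SameFace : Dart m → Dart m → Set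
  SameFace d d' = ∃[ k ] iter k φ d ≡ d'
  OnFace : Fin n → Dart m → Set
  OnFace v d = ∃[ k ] tail (iter k φ d) ≡ v
  data Walk : Fin n → List (Dart m) → Fin n → Set where
    nil  : ∀ {u} → Walk u [] u
    cons : ∀ {u v d ds} → tail d ≡ u → Walk (head d) ds v → Walk u (d ∷ ds) v
  IsPath : Fin n → List (Dart m) → Fin n → Set
  IsPath u ds v = Walk u ds v × Unique (u ∷ map head ds)

record PlaneGraph (n m : ℕ) : Set where
  field
    ends : Fin m → Fin n × Fin n
    cap  : Fin m → ℕ
    -- rotation system: σ is a permutation of the darts, cyclically ordering
    -- the darts leaving each vertex (one cycle per vertex)
    σ        : Dart m → Dart m
  open Embedding ends σ public
  field
    σ⁻¹      : Dart m → Dart m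
    σ-inv₁   : ∀ d → σ (σ⁻¹ d) ≡ d
    σ-inv₂   : ∀ d → σ⁻¹ (σ d) ≡ d
    σ-tail   : ∀ d → tail (σ d) ≡ tail d
    σ-cyclic : ∀ d d' → tail d ≡ tail d' → ∃[ k ] iter k σ d ≡ d'
  field
    connected : ∀ u v → ∃[ ds ] Walk u ds v
    -- planarity of the embedding (Euler's formula, genus 0): f is the number
    -- of faces, witnessed by representatives rep, one per φ-orbit
    numFaces  : ℕ
    faceRep   : Fin numFaces → Dart m
    rep-surj  : ∀ d → ∃[ i ] SameFace (faceRep i) d
    rep-inj   : ∀ i j → SameFace (faceRep i) (faceRep j) → i ≡ j
    euler     : m ≡ 0 ⊎ n + numFaces ≡ m + 2

-- Demands: a multigraph H on Fin n with k edges, each of demand 1.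

Demands : ℕ → ℕ → Set
Demands n k = Fin k → Fin n × Fin n

crosses : {n : ℕ} → (Fin n → Bool) → Fin n × Fin n → Bool
crosses S (u , v) = S u xor S v

module _ {n m : ℕ} (G : PlaneGraph n m) where
  open PlaneGraph G

  δG : (Fin n → Bool) → ℕ
  δG S = sum (map (λ e → if crosses S (ends e) then cap e else 0) (allFin m))

  δH : {k : ℕ} → Demands n k → (Fin n → Bool) → ℕ
  δH {k} H S = sum (map (λ i → if crosses S (H i) then 1 else 0) (allFin k))

  CutCondition : {k : ℕ} → Demands n k → Set
  CutCondition H = ∀ S → δH H S Data.Nat.≤ δG S

  -- separability of the demands associated with the face of f:
  -- a contiguous segment d , φ d , … , φ^(ℓ-1) d of the boundary walk of the
  -- face (no dart repeated, so it does not wrap around), with vertex set S,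
  -- such that each such demand has exactly one endpoint in S.
  InSegment : Dart m → ℕ → Fin n → Set
  InSegment d ℓ v = ∃[ j ] (j < ℓ × tail (iter j φ d) ≡ v)

  SegmentNoWrap : Dart m → ℕ → Set
  SegmentNoWrap d ℓ = ∀ i j → i < ℓ → j < ℓ → iter i φ d ≡ iter j φ d → i ≡ j

  ExactlyOneIn : (Fin n → Set) → Fin n × Fin n → Set
  ExactlyOneIn S (u , v) = (S u × ¬ S v) ⊎ (¬ S u × S v)

  SeparableFaceInstance : {k : ℕ} → Demands n k → Set
  SeparableFaceInstance {k} H =
    Σ (Fin k → Dart m) λ face →
      -- face instance: demand i is associated with the face of (face i),
      -- which contains both endpoints
      (∀ i → OnFace (proj₁ (H i)) (face i) × OnFace (proj₂ (H i)) (face i))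
      ×
      -- separability: for every face F (represented by any of its darts f)
      (∀ f → ∃[ d ] ∃[ ℓ ] (SameFace f d × SegmentNoWrap d ℓ ×
         (∀ i → SameFace f (face i) → ExactlyOneIn (InSegment d ℓ) (H i))))

  record FlowPath {k : ℕ} (H : Demands n k) : Set where
    field
      demand : Fin k
      darts  : List (Dart m)
      isPath : IsPath (proj₁ (H demand)) darts (proj₂ (H demand))
      value  : ℚ
      value≥0 : 0ℚ ≤ℚ value

  sumℚ : List ℚ → ℚ
  sumℚ = foldr _+ℚ_ 0ℚ

  ℕtoℚ : ℕ → ℚ
  ℕtoℚ a = + a / 1

  uses : Fin m → List (Dart m) → ℕ
  uses e ds = length (filter (λ d → e ≟ proj₁ d) ds)

  Feasible : ℕ → {k : ℕ} → Demands n k → Set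
  Feasible t {k} H = Σ (List (FlowPath H)) λ P →
    (∀ i → sumℚ (map FlowPath.value (filter (λ p → FlowPath.demand p ≟ i) P)) ≡ 1ℚ)
    ×
    (∀ e → sumℚ (map (λ p → FlowPath.value p *ℚ ℕtoℚ (uses e (FlowPath.darts p))) P)
             ≤ℚ ℕtoℚ (t Data.Nat.* cap e))

{-# OPTIONS --safe #-}
-- By linear programming duality it suffices to prove Σ d(uᵢ, vᵢ) ≤ 3 Σ c(e) l(e) for the
-- shortest-path metric d of every choice of edge lengths l.  Cuts that are circuits of the dual
-- ("central" cuts) meet the boundary of a face in an interval, and on each face d satisfies the
-- Kalmanson inequalities, so there it is a nonnegative combination of interval cuts; demands on a
-- face may thus be compared by counting how many of them each interval separates.  In this sense
-- the separable demands H of a face are at most N + 2L, where N (nested) and L are families of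
-- noncrossing chords of the face, each of them at most H and hence satisfying the cut condition.
-- Adding noncrossing chords keeps the graph planar, and then Seymour's theorem on sums of circuits,
-- applied in the dual, bounds the total length of the chords by Σ c(e) l(e).

module Submission where

open import Defs
open import Data.Nat using (ℕ; zero; suc; _+_; _*_; _∸_; _⊓_; _≤_; _<_; z≤n; s≤s)
open import Data.Nat.Properties using
  ( +-*-isCommutativeSemiring; +-comm; +-assoc; +-identityʳ; +-mono-≤; +-monoˡ-≤; +-monoʳ-≤; +-mono-<-≤;
    +-mono-≤-<; +-monoʳ-<; +-cancelˡ-≤; +-cancelʳ-≤; +-cancelˡ-≡; +-suc; *-comm; *-monoʳ-≤; *-cancelˡ-≤;
    *-identityˡ; *-identityʳ; *-zeroʳ; *-suc; *-distribˡ-+; ≤-refl; ≤-trans; ≤-reflexive; ≤-antisym; ≤-total;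
    ≤-pred; <-trans; <-≤-trans; ≤-<-trans; <⇒≤; <-irrefl; <⇒≢; ≤∧≢⇒<; ≰⇒>; ≮⇒≥; n<1+n; n≤1+n; m≤m+n; m≤n+m;
    m≤n⇒m≤1+n; m+[n∸m]≡n; m∸n≤m; +-∸-assoc; m+n∸m≡n; m+n∸n≡m; m⊓n≤m; m⊓n≤n; ⊓-sel; n≤0⇒n≡0; suc-injective; 1+n≰n;
    <-cmp; _≤?_; module ≤-Reasoning; *-assoc; *-distribʳ-+; ^-monoʳ-<; m≥n⇒m⊓n≡n; ∸-monoˡ-≤; ⊓-mono-≤ )
open import Data.Nat.Induction using (<-wellFounded)
open import Induction.WellFounded using (Acc; acc)
open import Data.Bool using (Bool; true; false; not; _xor_; _∧_; _∨_; if_then_else_)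
open import Data.Bool.Properties using
  ( xor-∧-commutativeRing; xor-comm; xor-assoc; xor-same; xor-identityʳ; ∧-distribʳ-xor; ∧-distribˡ-xor; ∧-comm;
    ∧-zeroʳ; ¬-not; ∧-identityʳ; ∨-idem; not-involutive; not-distribˡ-xor )
open import Data.Fin using (Fin; zero; suc; toℕ; finToFun; funToFin; _↑ˡ_; _↑ʳ_; splitAt; join; combine)
open import Data.Fin.Properties using
  ( _≟_; pigeonhole; finToFun-funToFin; funToFin-finToFin; toℕ<n; toℕ-injective; any?; join-splitAt; splitAt-join;
    splitAt-↑ʳ; splitAt-↑ˡ )
open import Data.Integer using (ℤ; -[1+_])
open import Data.Product using (Σ; ∃-syntax; _×_; _,_; proj₁; proj₂)
open import Data.Product.Properties using (≡-dec)
open import Data.Sum using (_⊎_; inj₁; inj₂; [_,_]′)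
open import Data.Unit using (tt)
open import Data.List using
  ( List; []; _∷_; _++_; map; foldr; filter; length; allFin; concat; lookup; downFrom; cartesianProductWith )
open import Data.List.Properties using
  ( length-map; length-++; ++-assoc; ++-identityʳ; map-tabulate; concat-++; length-tabulate )
open import Data.List.Relation.Unary.All using (All; []; _∷_)
open import Data.List.Relation.Unary.Any using (Any; here; there)
open import Data.List.Relation.Unary.AllPairs using ([]; _∷_)
open import Data.List.Relation.Unary.Unique.Propositional using (Unique)
open import Data.List.Membership.Propositional using (_∈_; _∉_; find; lose)
open import Data.List.Membership.Propositional.Properties using
  ( ∈-allFin; ∈-∃++; ∈-++⁺ˡ; ∈-++⁺ʳ; ∈-++⁻; ∈-map⁺; ∈-map⁻; ∈-filter⁺; ∈-filter⁻; ∈-lookup;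
    ∈-cartesianProductWith⁺; ∈-cartesianProductWith⁻; ∈-concat⁺′ )
open import Data.List.Relation.Binary.Permutation.Propositional using
  ( _↭_; ↭-sym; ↭-trans; ↭-reflexive; refl; prep; swap; trans )
open import Data.List.Relation.Binary.Permutation.Propositional.Properties using
  ( ∈-resp-↭; All-resp-↭; shift; ↭-length )
  renaming (++⁺ to ↭-++⁺)
open import Algebra using (CommutativeRing; IsCommutativeSemiring)
open import Relation.Binary.PropositionalEquality using
  ( _≡_; _≢_; refl; sym; cong; cong₂; subst; subst₂; module ≡-Reasoning )
  renaming (trans to ≡-trans)
open import Relation.Binary using (DecidableEquality; tri<; tri≈; tri>)
open import Relation.Nullary using (¬_; Dec; yes; no; contradiction)
open import Relation.Nullary.Decidable using (⌊_⌋; _×-dec_; ¬?)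
open import Function using (_∘_; id)
import Data.Nat.Tactic.RingSolver as ℕ-Solver
import Data.Integer.Tactic.RingSolver as ℤ-Solver
import Data.Integer.Properties as ℤₚ
import Data.List.Relation.Unary.All as All
import Data.List.Relation.Unary.All.Properties as Allₚ
import Data.List.Relation.Unary.Any as Any
import Data.List.Relation.Unary.Unique.Propositional.Properties as Uniqueₚ
import Data.Nat as ℕ
import Data.Fin
import Data.Bool
import Data.Integer as ℤ
open import Data.Rational using (ℚ)
import Data.Rational as ℚ
import Data.Rational.Properties as ℚₚ
import Data.Rational.Unnormalised as ℚᵘ
import Data.Rational.Unnormalised.Properties as ℚᵘₚ

-- The constant is 1 + 2. A boundary interval with one end gap on each side of the break `ℓ`
-- separates two kinds of demands: those covering only its first end gap and those covering only its
-- last. The nested chords see just the difference of the two numbers. The smaller number cancels in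
-- the loads and is lost twice; `XL` is built to supply it. The obstacle is to keep the chords
-- within the cut condition. They are compared with the demands interval by interval, and this says
-- nothing about a cut that crosses a face boundary four times. Central cuts suffice all the same:
-- in a decomposition of a cut into central ones the capacities add up exactly, while the number of
-- separated chords is at most the sum of the numbers for the pieces. No drawing is ever formed.
-- Planarity is the F₂ statement that the cuts are exactly the even edge sets of the dual. It comes
-- from Euler's formula by counting dimensions, and a chord preserves it whenever all boundary darts
-- beneath the chord lie in one region. The order in which chords are peeled off a load ensures
-- this.

-- Finite sums over lists

lefts : ∀ {A B : Set} → List (A ⊎ B) → List A
lefts []            = []
lefts (inj₁ x ∷ xs) = x ∷ lefts xs
lefts (inj₂ _ ∷ xs) = lefts xs

rights : ∀ {A B : Set} → List (A ⊎ B) → List B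
rights []            = []
rights (inj₁ _ ∷ xs) = rights xs
rights (inj₂ y ∷ xs) = y ∷ rights xs

module BigOp {C : Set} {_⊕_ _⊗_ : C → C → C} {0# 1# : C} (isCS : IsCommutativeSemiring _≡_ _⊕_ _⊗_ 0# 1#) where
  private module R = IsCommutativeSemiring isCS
  open ≡-Reasoning

  ∑ : {A : Set} → List A → (A → C) → C
  ∑ []       f = 0#
  ∑ (x ∷ xs) f = f x ⊕ ∑ xs f

  interchange : ∀ a b c d → ((a ⊕ b) ⊕ (c ⊕ d)) ≡ ((a ⊕ c) ⊕ (b ⊕ d))
  interchange a b c d = begin
    (a ⊕ b) ⊕ (c ⊕ d)  ≡⟨ R.+-assoc a b _ ⟩
    a ⊕ (b ⊕ (c ⊕ d))  ≡⟨ cong (a ⊕_) (sym (R.+-assoc b c d)) ⟩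
    a ⊕ ((b ⊕ c) ⊕ d)  ≡⟨ cong (λ z → a ⊕ (z ⊕ d)) (R.+-comm b c) ⟩
    a ⊕ ((c ⊕ b) ⊕ d)  ≡⟨ cong (a ⊕_) (R.+-assoc c b d) ⟩
    a ⊕ (c ⊕ (b ⊕ d))  ≡⟨ sym (R.+-assoc a c _) ⟩
    (a ⊕ c) ⊕ (b ⊕ d)  ∎

  module _ {A : Set} where
    ∑-cong∈ : ∀ (xs : List A) {f g : A → C} → (∀ x → x ∈ xs → f x ≡ g x) → ∑ xs f ≡ ∑ xs g
    ∑-cong∈ []       h = refl
    ∑-cong∈ (x ∷ xs) h = cong₂ _⊕_ (h x (here refl)) (∑-cong∈ xs (λ y y∈ → h y (there y∈)))

    ∑-cong : ∀ (xs : List A) {f g : A → C} → (∀ x → f x ≡ g x) → ∑ xs f ≡ ∑ xs g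
    ∑-cong xs h = ∑-cong∈ xs (λ x _ → h x)

    ∑-0 : ∀ (xs : List A) → ∑ xs (λ _ → 0#) ≡ 0#
    ∑-0 []       = refl
    ∑-0 (x ∷ xs) = ≡-trans (R.+-identityˡ _) (∑-0 xs)

    ∑-+ : ∀ (xs : List A) (f g : A → C) → ∑ xs (λ x → f x ⊕ g x) ≡ (∑ xs f ⊕ ∑ xs g)
    ∑-+ []       f g = sym (R.+-identityˡ 0#)
    ∑-+ (x ∷ xs) f g = ≡-trans (cong ((f x ⊕ g x) ⊕_) (∑-+ xs f g)) (interchange (f x) (g x) _ _)

    ∑-*ˡ : ∀ (xs : List A) c (f : A → C) → ∑ xs (λ x → c ⊗ f x) ≡ (c ⊗ ∑ xs f)
    ∑-*ˡ []       c f = sym (R.zeroʳ c)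
    ∑-*ˡ (x ∷ xs) c f = ≡-trans (cong ((c ⊗ f x) ⊕_) (∑-*ˡ xs c f)) (sym (R.distribˡ c (f x) _))

    ∑-*ʳ : ∀ (xs : List A) c (f : A → C) → ∑ xs (λ x → f x ⊗ c) ≡ (∑ xs f ⊗ c)
    ∑-*ʳ xs c f = ≡-trans (∑-cong xs (λ x → R.*-comm (f x) c)) (≡-trans (∑-*ˡ xs c f) (R.*-comm c _))

    ∑-++ : ∀ (xs ys : List A) (f : A → C) → ∑ (xs ++ ys) f ≡ (∑ xs f ⊕ ∑ ys f)
    ∑-++ []       ys f = sym (R.+-identityˡ _)
    ∑-++ (x ∷ xs) ys f = ≡-trans (cong (f x ⊕_) (∑-++ xs ys f)) (sym (R.+-assoc (f x) _ _))

    ∑-↭ : ∀ {xs ys : List A} (f : A → C) → xs ↭ ys → ∑ xs f ≡ ∑ ys f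
    ∑-↭ f refl          = refl
    ∑-↭ f (prep x p)    = cong (f x ⊕_) (∑-↭ f p)
    ∑-↭ f (swap {_} {ys} x y p) = ≡-trans (cong (λ z → f x ⊕ (f y ⊕ z)) (∑-↭ f p))
      (≡-trans (sym (R.+-assoc _ _ _)) (≡-trans (cong (_⊕ ∑ ys f) (R.+-comm (f x) (f y))) (R.+-assoc _ _ _)))
    ∑-↭ f (trans p q)   = ≡-trans (∑-↭ f p) (∑-↭ f q)

  ∑-map : ∀ {A B : Set} (g : A → B) (xs : List A) (f : B → C) → ∑ (map g xs) f ≡ ∑ xs (λ x → f (g x))
  ∑-map g []       f = refl
  ∑-map g (x ∷ xs) f = cong (f (g x) ⊕_) (∑-map g xs f)

  ∑-swap : ∀ {A B : Set} (xs : List A) (ys : List B) (f : A → B → C) →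
           ∑ xs (λ x → ∑ ys (f x)) ≡ ∑ ys (λ y → ∑ xs (λ x → f x y))
  ∑-swap []       ys f = sym (∑-0 ys)
  ∑-swap (x ∷ xs) ys f = ≡-trans (cong (∑ ys (f x) ⊕_) (∑-swap xs ys f)) (sym (∑-+ ys (f x) _))

  ∑-concat : ∀ {A : Set} (xss : List (List A)) (f : A → C) → ∑ (concat xss) f ≡ ∑ xss (λ xs → ∑ xs f)
  ∑-concat []         f = refl
  ∑-concat (xs ∷ xss) f = ≡-trans (∑-++ xs (concat xss) f) (cong (∑ xs f ⊕_) (∑-concat xss f))

  ∑-⊎ : ∀ {A B : Set} (xs : List (A ⊎ B)) (f : A ⊎ B → C) →
         ∑ xs f ≡ (∑ (lefts xs) (λ x → f (inj₁ x)) ⊕ ∑ (rights xs) (λ y → f (inj₂ y)))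
  ∑-⊎ []            f = sym (R.+-identityˡ 0#)
  ∑-⊎ (inj₁ x ∷ xs) f = ≡-trans (cong (f (inj₁ x) ⊕_) (∑-⊎ xs f)) (sym (R.+-assoc _ _ _))
  ∑-⊎ (inj₂ y ∷ xs) f = ≡-trans (cong (f (inj₂ y) ⊕_) (∑-⊎ xs f))
    (≡-trans (sym (R.+-assoc _ _ _)) (≡-trans (cong (_⊕ ∑ (rights xs) (λ y → f (inj₂ y))) (R.+-comm _ _)) (R.+-assoc _ _ _)))

  ∑-suc : ∀ {n} (f : Fin (suc n) → C) → ∑ (allFin (suc n)) f ≡ (f zero ⊕ ∑ (allFin n) (λ i → f (suc i)))
  ∑-suc {n} f = cong (f zero ⊕_) (≡-trans (cong (λ z → ∑ z f) (sym (map-tabulate id suc))) (∑-map suc (allFin n) f))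

  ∑-pick : ∀ {A : Set} (_≟A_ : DecidableEquality A) (xs : List A) (e : A) (f : A → C) → Unique xs → e ∈ xs →
           ∑ xs (λ x → if ⌊ x ≟A e ⌋ then f x else 0#) ≡ f e
  ∑-pick _≟A_ (x ∷ xs) e f (x∉ ∷ u) e∈ with x ≟A e
  ... | yes refl = ≡-trans (cong (f x ⊕_) (≡-trans (∑-cong∈ xs rest) (∑-0 xs))) (R.+-identityʳ _)
    where
    rest : ∀ y → y ∈ xs → (if ⌊ y ≟A x ⌋ then f y else 0#) ≡ 0#
    rest y y∈ with y ≟A x
    ... | yes refl = contradiction refl (All.lookup x∉ y∈)
    ... | no _     = refl
  ∑-pick _≟A_ (x ∷ xs) e f (x∉ ∷ u) (here refl) | no x≢e = contradiction refl x≢e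
  ∑-pick _≟A_ (x ∷ xs) e f (x∉ ∷ u) (there e∈) | no x≢e =
    ≡-trans (R.+-identityˡ _) (∑-pick _≟A_ xs e f u e∈)

module B = BigOp {Bool} {_xor_} {_∧_} {false} {true} (CommutativeRing.isCommutativeSemiring xor-∧-commutativeRing)
module N = BigOp +-*-isCommutativeSemiring
module Z = BigOp ℤₚ.+-*-isCommutativeSemiring

∑-mono∈ : ∀ {A : Set} (xs : List A) {f g : A → ℕ} → (∀ x → x ∈ xs → f x ≤ g x) → N.∑ xs f ≤ N.∑ xs g
∑-mono∈ []       h = z≤n
∑-mono∈ (x ∷ xs) h = +-mono-≤ (h x (here refl)) (∑-mono∈ xs (λ y y∈ → h y (there y∈)))

∑-mono : ∀ {A : Set} (xs : List A) {f g : A → ℕ} → (∀ x → f x ≤ g x) → N.∑ xs f ≤ N.∑ xs g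
∑-mono xs h = ∑-mono∈ xs (λ x _ → h x)

term≤∑ : ∀ {A : Set} (xs : List A) (f : A → ℕ) {x} → x ∈ xs → f x ≤ N.∑ xs f
term≤∑ (x ∷ xs) f (here refl) = m≤m+n _ _
term≤∑ (x ∷ xs) f (there y∈)  = ≤-trans (term≤∑ xs f y∈) (m≤n+m _ (f x))

∑-strict : ∀ {A : Set} (xs : List A) {f g : A → ℕ} → (∀ x → f x ≤ g x) → ∀ {x} → x ∈ xs → f x < g x →
           N.∑ xs f < N.∑ xs g
∑-strict (x ∷ xs) h (here refl) lt = +-mono-<-≤ lt (∑-mono xs h)
∑-strict (x ∷ xs) h (there x∈)  lt = +-mono-≤-< (h x) (∑-strict xs h x∈ lt)

∑-nonneg : ∀ {A : Set} (xs : List A) (f : A → ℤ) → (∀ x → x ∈ xs → ℤ.0ℤ ℤ.≤ f x) → ℤ.0ℤ ℤ.≤ Z.∑ xs f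
∑-nonneg []       f h = ℤₚ.≤-refl
∑-nonneg (x ∷ xs) f h = ℤₚ.+-mono-≤ (h x (here refl)) (∑-nonneg xs f (λ y y∈ → h y (there y∈)))

∑-pos : ∀ {A : Set} (xs : List A) (f : A → ℕ) → Z.∑ xs (λ x → ℤ.+ f x) ≡ ℤ.+ N.∑ xs f
∑-pos []       f = refl
∑-pos (x ∷ xs) f = cong (ℤ._+_ (ℤ.+ f x)) (∑-pos xs f)

sum-map : ∀ {A : Set} (xs : List A) (f : A → ℕ) → foldr _+_ 0 (map f xs) ≡ N.∑ xs f
sum-map []       f = refl
sum-map (x ∷ xs) f = cong (f x +_) (sum-map xs f)

-- Bits and sums modulo 2

bit : Bool → ℕ
bit true  = 1
bit false = 0

bit≤1 : ∀ b → bit b ≤ 1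
bit≤1 true  = ≤-refl
bit≤1 false = z≤n

bit-xor-≤ : ∀ a b → bit (a xor b) ≤ bit a + bit b
bit-xor-≤ true  true  = z≤n
bit-xor-≤ true  false = ≤-refl
bit-xor-≤ false b     = ≤-refl

xor-cancelˡ : ∀ a b → a xor (a xor b) ≡ b
xor-cancelˡ true  true  = refl
xor-cancelˡ true  false = refl
xor-cancelˡ false b     = refl

xor≡false : ∀ {a b} → a xor b ≡ false → a ≡ b
xor≡false {true}  {true}  _ = refl
xor≡false {false} {false} _ = refl

xor-cross : ∀ a b c → (a xor b) xor (b xor c) ≡ a xor c
xor-cross true  true  c = refl
xor-cross true  false c = refl
xor-cross false true  true  = refl
xor-cross false true  false = refl
xor-cross false false c = refl

∑-odd : ∀ {A : Set} (xs : List A) (f : A → Bool) → B.∑ xs f ≡ true → ∃[ x ] (x ∈ xs × f x ≡ true)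
∑-odd (x ∷ xs) f eq with f x in fx
... | true  = x , here refl , fx
... | false with ∑-odd xs f eq
...   | y , y∈ , fy = y , there y∈ , fy

bit-∑-≤ : ∀ {A : Set} (xs : List A) (f : A → Bool) → bit (B.∑ xs f) ≤ N.∑ xs (bit ∘ f)
bit-∑-≤ []       f = z≤n
bit-∑-≤ (x ∷ xs) f = ≤-trans (bit-xor-≤ (f x) (B.∑ xs f)) (+-monoʳ-≤ (bit (f x)) (bit-∑-≤ xs f))

-- Lists without repetitions
Unique-resp-↭ : ∀ {A : Set} {xs ys : List A} → xs ↭ ys → Unique xs → Unique ys
Unique-resp-↭ refl         u                        = u
Unique-resp-↭ (prep x p)   (x∉ ∷ u)                 = All-resp-↭ p x∉ ∷ Unique-resp-↭ p u
Unique-resp-↭ (swap x y p) ((x≢y ∷ x∉) ∷ (y∉ ∷ u)) =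
  ((λ e → x≢y (sym e)) ∷ All-resp-↭ p y∉) ∷ (All-resp-↭ p x∉ ∷ Unique-resp-↭ p u)
Unique-resp-↭ (trans p q)  u                        = Unique-resp-↭ q (Unique-resp-↭ p u)

Unique-++⁻ : ∀ {A : Set} (xs : List A) {ys} → Unique (xs ++ ys) → Unique xs × Unique ys × (∀ {x} → x ∈ xs → x ∉ ys)
Unique-++⁻ []       u        = [] , u , λ ()
Unique-++⁻ (x ∷ xs) (x∉ ∷ u) with Unique-++⁻ xs u
... | uxs , uys , dis = (Allₚ.++⁻ˡ xs x∉ ∷ uxs) , uys ,
      λ { (here refl) x∈ → All.lookup (Allₚ.++⁻ʳ xs x∉) x∈ refl ; (there y∈) → dis y∈ }

Unique-lookup-injective : ∀ {A : Set} {xs : List A} → Unique xs → ∀ i j → lookup xs i ≡ lookup xs j → i ≡ j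
Unique-lookup-injective (x∉ ∷ u) zero    zero    eq = refl
Unique-lookup-injective {xs = x ∷ xs} (x∉ ∷ u) zero    (suc j) eq = contradiction eq (All.lookup x∉ (∈-lookup j))
Unique-lookup-injective {xs = x ∷ xs} (x∉ ∷ u) (suc i) zero    eq = contradiction (sym eq) (All.lookup x∉ (∈-lookup i))
Unique-lookup-injective (x∉ ∷ u) (suc i) (suc j) eq = cong suc (Unique-lookup-injective u i j eq)

Unique-⊆-length : ∀ {A : Set} {xs ys : List A} → Unique xs → (∀ {x} → x ∈ xs → x ∈ ys) → length xs ≤ length ys
Unique-⊆-length {xs = xs} {ys} u sub with length xs ≤? length ys
... | yes p = p
... | no ¬p with pigeonhole (≰⇒> ¬p) (λ i → Any.index (sub (∈-lookup {xs = xs} i)))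
...   | i , j , i<j , eq = contradiction (cong toℕ (Unique-lookup-injective u i j same)) (<⇒≢ i<j)
  where
  same : lookup xs i ≡ lookup xs j
  same = ≡-trans (index-lookup (sub (∈-lookup {xs = xs} i))) (≡-trans (cong (lookup ys) eq) (sym (index-lookup (sub (∈-lookup {xs = xs} j)))))
    where
    index-lookup : ∀ {x} {zs : List _} (p : x ∈ zs) → x ≡ lookup zs (Any.index p)
    index-lookup (here refl) = refl
    index-lookup (there p)   = index-lookup p

-- A finite search space: minima over trails and over simple paths are taken in such a list.
listsUpTo : {A : Set} → List A → ℕ → List (List A)
listsUpTo xs zero    = [] ∷ []
listsUpTo xs (suc k) = [] ∷ concat (map (λ x → map (x ∷_) (listsUpTo xs k)) xs)

∈-listsUpTo : ∀ {A : Set} {xs : List A} k {L} → (∀ {x} → x ∈ L → x ∈ xs) → length L ≤ k → L ∈ listsUpTo xs k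
∈-listsUpTo zero    {[]}    sub le = here refl
∈-listsUpTo (suc k) {[]}    sub le = here refl
∈-listsUpTo {xs = xs} (suc k) {x ∷ L} sub (s≤s le) =
  there (∈-concat⁺′ (∈-map⁺ (x ∷_) (∈-listsUpTo k (λ y∈ → sub (there y∈)) le)) (∈-map⁺ _ (sub (here refl))))

∈-split : ∀ {A : Set} {x : A} {xs} → x ∈ xs → ∃[ ys ] xs ↭ x ∷ ys
∈-split {x = x} x∈ with ∈-∃++ x∈
... | ys , zs , refl = ys ++ zs , shift x ys zs

-- Linear equations over F₂
private
  𝟚 : Fin 2 → Bool
  𝟚 zero    = false
  𝟚 (suc _) = true

  𝟚⁻¹ : Bool → Fin 2
  𝟚⁻¹ false = zero
  𝟚⁻¹ true  = suc zero

  𝟚⁻¹-𝟚 : ∀ i → 𝟚⁻¹ (𝟚 i) ≡ i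
  𝟚⁻¹-𝟚 zero       = refl
  𝟚⁻¹-𝟚 (suc zero) = refl

  𝟚-𝟚⁻¹ : ∀ b → 𝟚 (𝟚⁻¹ b) ≡ b
  𝟚-𝟚⁻¹ true  = refl
  𝟚-𝟚⁻¹ false = refl

-- Two of the 2^N vectors have the same image, and their difference is in the kernel.
abstract
  kernel-nontrivial : ∀ {N M} → M < N → (A : Fin M → Fin N → Bool) →
    Σ (Fin N → Bool) λ x → (∀ i → B.∑ (allFin N) (λ j → A i j ∧ x j) ≡ false) × Σ (Fin N) λ j → x j ≡ true
  kernel-nontrivial {N} {M} M<N A with pigeonhole (^-monoʳ-< 2 (s≤s (s≤s z≤n)) M<N) f
    where
    val : (Fin N → Bool) → Fin M → Bool
    val x i = B.∑ (allFin N) (λ j → A i j ∧ x j)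
    f : Fin (2 ℕ.^ N) → Fin (2 ℕ.^ M)
    f k = funToFin {M} {2} (λ i → 𝟚⁻¹ (val (λ j → 𝟚 (finToFun {2} {N} k j)) i))
  ... | k , l , k<l , eq = diff , zeros , some
    where
    x y : Fin N → Bool
    x j = 𝟚 (finToFun {2} {N} k j)
    y j = 𝟚 (finToFun {2} {N} l j)
    val : (Fin N → Bool) → Fin M → Bool
    val x i = B.∑ (allFin N) (λ j → A i j ∧ x j)
    diff : Fin N → Bool
    diff j = x j xor y j
    same : ∀ i → val x i ≡ val y i
    same i = ≡-trans (sym (𝟚-𝟚⁻¹ _)) (≡-trans (cong 𝟚 (≡-trans (sym (finToFun-funToFin {M} {2} (λ i → 𝟚⁻¹ (val x i)) i))
      (≡-trans (cong (λ z → finToFun {2} {M} z i) eq) (finToFun-funToFin {M} {2} (λ i → 𝟚⁻¹ (val y i)) i)))) (𝟚-𝟚⁻¹ _))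
    zeros : ∀ i → val diff i ≡ false
    zeros i = ≡-trans (B.∑-cong (allFin N) (λ j → ∧-distribˡ-xor (A i j) (x j) (y j)))
      (≡-trans (B.∑-+ (allFin N) _ _) (≡-trans (cong (_xor val y i) (same i)) (xor-same (val y i))))
    some : ∃[ j ] diff j ≡ true
    some with any? (λ j → diff j Data.Bool.≟ true)
    ... | yes p = p
    ... | no ¬p = contradiction (cong toℕ k≡l) (<⇒≢ k<l)
      where
      x≗y : ∀ j → finToFun {2} {N} k j ≡ finToFun {2} {N} l j
      x≗y j = ≡-trans (sym (𝟚⁻¹-𝟚 _)) (≡-trans (cong 𝟚⁻¹ (xor≡false (¬-not (λ e → ¬p (j , e))))) (𝟚⁻¹-𝟚 _))
      funToFin-cong : ∀ {N} {f g : Fin N → Fin 2} → (∀ j → f j ≡ g j) → funToFin f ≡ funToFin g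
      funToFin-cong {zero}  h = refl
      funToFin-cong {suc N} h = cong₂ combine (h zero) (funToFin-cong (λ j → h (suc j)))
        where import Data.Fin
      k≡l : k ≡ l
      k≡l = ≡-trans (sym (funToFin-finToFin {N} {2} k)) (≡-trans (funToFin-cong x≗y) (funToFin-finToFin {N} {2} l))

-- Graphs with edge set E and vertices in ℕ
pt : ℕ → ℕ → Bool
pt x v = ⌊ v ℕ.≟ x ⌋

pt-refl : ∀ x → pt x x ≡ true
pt-refl x with x ℕ.≟ x
... | yes _ = refl
... | no ¬p = contradiction refl ¬p

pt-≢ : ∀ {x v} → v ≢ x → pt x v ≡ false
pt-≢ {x} {v} ne with v ℕ.≟ x
... | yes p = contradiction p ne
... | no _  = refl

module Graph {E : Set} (a b : E → ℕ) where
  -- The coboundary of the vertex set `A`.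
  cr : (ℕ → Bool) → E → Bool
  cr A e = A (a e) xor A (b e)

  -- Orthogonality to all cuts instead of even degrees: loops drop out by themselves, and pulling
  -- `A` back along a map of vertices handles contraction.
  Even : List E → Set
  Even L = ∀ A → B.∑ L (cr A) ≡ false

  inc : ℕ → E → ℕ
  inc t e = bit (pt t (a e)) + bit (pt t (b e))

  Joins : E → ℕ → ℕ → Set
  Joins e x y = (a e ≡ x × b e ≡ y) ⊎ (a e ≡ y × b e ≡ x)

  NonLoop : E → Set
  NonLoop e = a e ≢ b e

  data Trail : ℕ → List E → ℕ → Set where
    []  : ∀ {x} → Trail x [] x
    _∷_ : ∀ {x y z e L} → Joins e x y → Trail y L z → Trail x (e ∷ L) z

  joins-cr : ∀ {e x y} → Joins e x y → ∀ A → cr A e ≡ A x xor A y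
  joins-cr (inj₁ (refl , refl)) A = refl
  joins-cr (inj₂ (refl , refl)) A = xor-comm (A _) (A _)

  trail-cr : ∀ {x L y} → Trail x L y → ∀ A → B.∑ L (cr A) ≡ A x xor A y
  trail-cr {x} []     A = sym (xor-same (A x))
  trail-cr {x} (_∷_ {y = y} {z} j p) A =
    ≡-trans (cong₂ _xor_ (joins-cr j A) (trail-cr p A)) (xor-cross (A x) (A y) (A z))

  trail-++ : ∀ {x y z L L'} → Trail x L y → Trail y L' z → Trail x (L ++ L') z
  trail-++ []      q = q
  trail-++ (j ∷ p) q = j ∷ trail-++ p q

  closed-even : ∀ {x L} → Trail x L x → Even L
  closed-even {x} p A = ≡-trans (trail-cr p A) (xor-same (A x))

  even-++ʳ : ∀ {L} C {L'} → Even L → L ↭ C ++ L' → Even C → Even L'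
  even-++ʳ {L} C {L'} eL p eC A = begin
    B.∑ L' (cr A)                    ≡⟨ cong (_xor B.∑ L' (cr A)) (sym (eC A)) ⟩
    B.∑ C (cr A) xor B.∑ L' (cr A)   ≡⟨ sym (B.∑-++ C L' (cr A)) ⟩
    B.∑ (C ++ L') (cr A)             ≡⟨ sym (B.∑-↭ (cr A) p) ⟩
    B.∑ L (cr A)                     ≡⟨ eL A ⟩
    false                            ∎
    where open ≡-Reasoning

  odd-end : ∀ {y g} → cr (pt y) g ≡ true → ∃[ y' ] (Joins g y y' × y' ≢ y)
  odd-end {y} {g} h with a g ℕ.≟ y | b g ℕ.≟ y
  ... | yes p | no ¬q = b g , inj₁ (p , refl) , ¬q
  ... | no ¬p | yes q = a g , inj₂ (refl , q) , ¬p

  joins-nonloop : ∀ {e x y} → Joins e x y → y ≢ x → NonLoop e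
  joins-nonloop (inj₁ (refl , refl)) ne eq = ne (sym eq)
  joins-nonloop (inj₂ (refl , refl)) ne eq = ne eq

  joins-inc : ∀ {e x y} t → Joins e x y → inc t e ≡ bit (pt t x) + bit (pt t y)
  joins-inc t (inj₁ (refl , refl)) = refl
  joins-inc {e} t (inj₂ (refl , refl)) = +-comm (bit (pt t (a e))) (bit (pt t (b e)))

  -- Modulo 2 the boundary of `R` is `t` plus `y`, so some edge of `R` leads from `y` to another
  -- vertex; deleting it moves `y` along. Stopping at the first arrival makes the trail incident
  -- with `t` exactly once.
  trail-out : ∀ {t} R → Acc _<_ (length R) → ∀ y → y ≢ t → (∀ A → B.∑ R (cr A) ≡ A t xor A y) →
    ∃[ D ] ∃[ R' ] (R ↭ D ++ R' × Trail y D t × N.∑ D (inc t) ≡ 1 × All NonLoop D)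
  trail-out {t} R (acc rs) y y≢t par
    with ∑-odd R (cr (pt y)) (≡-trans (par (pt y)) (cong₂ _xor_ (pt-≢ (λ e → y≢t (sym e))) (pt-refl y)))
  ... | g , g∈ , odd with odd-end odd | ∈-split g∈
  ...   | y' , j , y'≢y | R₁ , perm with y' ℕ.≟ t
  ...     | yes refl = g ∷ [] , R₁ , perm , j ∷ [] ,
              ≡-trans (+-identityʳ _) (≡-trans (joins-inc t j) (cong₂ (λ p q → bit p + bit q) (pt-≢ y≢t) (pt-refl t))) ,
              joins-nonloop j y'≢y ∷ []
  ...     | no y'≢t with trail-out R₁ (rs (≤-reflexive (sym (↭-length perm)))) y' y'≢t par'
    where
    open ≡-Reasoning
    par' : ∀ A → B.∑ R₁ (cr A) ≡ A t xor A y'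
    par' A = begin
      B.∑ R₁ (cr A)                         ≡⟨ sym (xor-cancelˡ (cr A g) _) ⟩
      cr A g xor (cr A g xor B.∑ R₁ (cr A)) ≡⟨ cong (cr A g xor_) (≡-trans (sym (B.∑-↭ (cr A) perm)) (par A)) ⟩
      cr A g xor (A t xor A y)              ≡⟨ cong₂ _xor_ (joins-cr j A) refl ⟩
      (A y xor A y') xor (A t xor A y)      ≡⟨ xor-comm (A y xor A y') _ ⟩
      (A t xor A y) xor (A y xor A y')      ≡⟨ xor-cross (A t) (A y) (A y') ⟩
      A t xor A y'                          ∎
  ...       | D , R' , perm' , tr , one , nl =
              g ∷ D , R' , ↭-trans perm (prep g perm') , j ∷ tr ,
              cong₂ _+_ (≡-trans (joins-inc t j) (cong₂ (λ p q → bit p + bit q) (pt-≢ y≢t) (pt-≢ y'≢t))) one ,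
              joins-nonloop j y'≢y ∷ nl

  -- Following an even edge set out of t until the first return to t.
  extract : ∀ {L t z f} → Even L → f ∈ L → Joins f t z → z ≢ t →
    ∃[ C ] ∃[ L' ] (L ↭ C ++ L' × Trail t C t × N.∑ C (inc t) ≡ 2 × All NonLoop C)
  extract {L} {t} {z} {f} eL f∈ j z≢t with ∈-split f∈
  ... | R , perm with trail-out R (<-wellFounded _) z z≢t par
    where
    par : ∀ A → B.∑ R (cr A) ≡ A t xor A z
    par A = ≡-trans (sym (xor-cancelˡ (cr A f) _)) (≡-trans (cong (cr A f xor_) (≡-trans (sym (B.∑-↭ (cr A) perm)) (eL A)))
      (≡-trans (xor-identityʳ _) (joins-cr j A)))
  ...   | D , R' , perm' , tr , one , nl = f ∷ D , R' , ↭-trans perm (prep f perm') , j ∷ tr ,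
          cong₂ _+_ (≡-trans (joins-inc t j) (cong₂ (λ p q → bit p + bit q) (pt-refl t) (pt-≢ z≢t))) one ,
          joins-nonloop j z≢t ∷ nl

  -- Vertex-disjoint unions of cycles qualify too: the degree bound is what later says that a cut
  -- crosses a face boundary at most twice.
  Circuit : List E → Set
  Circuit C = Even C × (∀ t → N.∑ C (inc t) ≤ 2)

  inc≤2 : ∀ t e → inc t e ≤ 2
  inc≤2 t e = +-mono-≤ (bit≤1 (pt t (a e))) (bit≤1 (pt t (b e)))

  inc-absent : ∀ L t → (∀ e → e ∈ L → a e ≢ t × b e ≢ t) → N.∑ L (inc t) ≡ 0
  inc-absent L t h = ≡-trans (N.∑-cong∈ L (λ e e∈ → cong₂ (λ p q → bit p + bit q) (pt-≢ (proj₁ (h e e∈))) (pt-≢ (proj₂ (h e e∈))))) (N.∑-0 L)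

  Split : List E → Set
  Split L = ∃[ C ] ∃[ L' ] (L ↭ C ++ L' × Even C × 0 < length C × 0 < length L')

  split-circuit : ∀ {L} t C L' → L ↭ C ++ L' → Even C → 0 < N.∑ C (inc t) → N.∑ C (inc t) ≤ 2 → 2 < N.∑ L (inc t) → Split L
  split-circuit t []        L'          perm eC ()  le big
  split-circuit t C@(_ ∷ _) []          perm eC pos le big = contradiction
    (≤-trans big (≤-trans (≤-reflexive (N.∑-↭ (inc t) (↭-trans perm (↭-reflexive (++-identityʳ C))))) le)) 1+n≰n
  split-circuit t C@(_ ∷ _) L'@(_ ∷ _) perm eC pos le big = C , L' , perm , eC , s≤s z≤n , s≤s z≤n

  split-at : ∀ {L e} t → Even L → e ∈ L → (∃[ z ] Joins e t z) → 2 < N.∑ L (inc t) → Split L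
  split-at {L} {e} t eL e∈ (z , j) big = by-cases (z ℕ.≟ t)
    where
    by-cases : Dec (z ≡ t) → Split L
    by-cases (no z≢t) = let (C , L' , perm , tr , two , _) = extract eL e∈ j z≢t in
      split-circuit t C L' perm (closed-even tr) (subst (0 <_) (sym two) (s≤s z≤n)) (≤-reflexive two) big
    by-cases (yes z≡t) = let (R , perm) = ∈-split e∈ in
      split-circuit t (e ∷ []) R perm (closed-even {t} (subst (Joins e t) z≡t j ∷ []))
        (subst (0 <_) (sym (≡-trans (+-identityʳ _) (joins-inc t j))) (≤-trans (≤-reflexive (cong bit (sym (pt-refl t)))) (m≤m+n _ _)))
        (≤-trans (≤-reflexive (+-identityʳ _)) (inc≤2 t e)) big

  -- At a vertex of degree above 2 an even part of degree at most 2 splits off, either a loop or a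
  -- closed trail, and both parts are shorter.
  circuits : ∀ L → Acc _<_ (length L) → Even L → ∃[ Cs ] (L ↭ concat Cs × All Circuit Cs)
  circuits L (acc rs) eL with All.all? (λ e → (N.∑ L (inc (a e)) ≤? 2) ×-dec (N.∑ L (inc (b e)) ≤? 2)) L
  ... | yes all≤2 = L ∷ [] , ↭-reflexive (sym (++-identityʳ L)) , (eL , deg) ∷ []
    where
    deg : ∀ t → N.∑ L (inc t) ≤ 2
    deg t with Any.any? (λ e → a e ℕ.≟ t) L | Any.any? (λ e → b e ℕ.≟ t) L
    ... | yes p | _     = let (e , e∈ , q) = find p in subst (λ z → N.∑ L (inc z) ≤ 2) q (proj₁ (All.lookup all≤2 e∈))
    ... | no _  | yes p = let (e , e∈ , q) = find p in subst (λ z → N.∑ L (inc z) ≤ 2) q (proj₂ (All.lookup all≤2 e∈))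
    ... | no ¬p | no ¬q = ≤-trans (≤-reflexive (inc-absent L t (λ e e∈ → (λ h → ¬p (lose e∈ h)) , (λ h → ¬q (lose e∈ h))))) z≤n
  ... | no ¬all = recurse (big (find (Allₚ.¬All⇒Any¬ (λ e → (N.∑ L (inc (a e)) ≤? 2) ×-dec (N.∑ L (inc (b e)) ≤? 2)) L ¬all)))
    where
    big : ∃[ e ] (e ∈ L × ¬ (N.∑ L (inc (a e)) ≤ 2 × N.∑ L (inc (b e)) ≤ 2)) → Split L
    big (e , e∈ , ¬p) with N.∑ L (inc (a e)) ≤? 2
    ... | no ¬q = split-at (a e) eL e∈ (b e , inj₁ (refl , refl)) (≰⇒> ¬q)
    ... | yes q = split-at (b e) eL e∈ (a e , inj₂ (refl , refl)) (≰⇒> (λ r → ¬p (q , r)))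
    recurse : Split L → ∃[ Cs ] (L ↭ concat Cs × All Circuit Cs)
    recurse (C , L' , perm , eC , 0<C , 0<L')
      with circuits C (rs (<-≤-trans (≤-trans (≤-reflexive (cong suc (sym (+-identityʳ _)))) (+-monoʳ-< (length C) 0<L')) len)) eC
         | circuits L' (rs (<-≤-trans (+-mono-<-≤ 0<C (≤-refl {length L'})) len)) (even-++ʳ C eL perm eC)
      where
      len : length C + length L' ≤ length L
      len = ≤-reflexive (sym (≡-trans (↭-length perm) (length-++ C)))
    ... | Cs , p , cs | Ds , q , ds = Cs ++ Ds , ↭-trans perm (↭-trans (↭-++⁺ p q) (↭-reflexive (concat-++ Cs Ds))) , Allₚ.++⁺ cs ds

-- Conservative weightings and sums of circuits
oddℕ : ℕ → Bool
oddℕ zero    = false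
oddℕ (suc n) = not (oddℕ n)

parity : ℤ → Bool
parity (ℤ.+ n)    = oddℕ n
parity -[1+ n ] = not (oddℕ n)

parity-suc : ∀ i → parity (ℤ.suc i) ≡ not (parity i)
parity-suc (ℤ.+ n)        = refl
parity-suc -[1+ zero ]  = refl
parity-suc -[1+ suc n ] = sym (not-involutive _)

parity-pred : ∀ i → parity (ℤ.pred i) ≡ not (parity i)
parity-pred i = ≡-trans (sym (not-involutive _)) (cong not (≡-trans (sym (parity-suc (ℤ.pred i))) (cong parity (ℤₚ.suc-pred i))))

parity-+ : ∀ i j → parity (i ℤ.+ j) ≡ parity i xor parity j
parity-+ (ℤ.+ zero)   j = cong parity (ℤₚ.+-identityˡ j)
parity-+ (ℤ.+ suc n)  j = ≡-trans (cong parity (ℤₚ.suc-+ n j))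
  (≡-trans (parity-suc (ℤ.+ n ℤ.+ j)) (≡-trans (cong not (parity-+ (ℤ.+ n) j)) (not-distribˡ-xor (oddℕ n) (parity j))))
parity-+ -[1+ zero ]  j = parity-pred j
parity-+ -[1+ suc n ] j = ≡-trans (cong parity (ℤₚ.pred-+ -[1+ n ] j))
  (≡-trans (parity-pred (-[1+ n ] ℤ.+ j)) (≡-trans (cong not (parity-+ -[1+ n ] j)) (not-distribˡ-xor (not (oddℕ n)) (parity j))))

parity-∑ : ∀ {A : Set} (L : List A) (w : A → ℤ) → parity (Z.∑ L w) ≡ B.∑ L (parity ∘ w)
parity-∑ []      w = refl
parity-∑ (x ∷ L) w = ≡-trans (parity-+ (w x) (Z.∑ L w)) (cong (parity (w x) xor_) (parity-∑ L w))

positive-even : ∀ i → ℤ.0ℤ ℤ.< i → parity i ≡ false → ℤ.+ 2 ℤ.≤ i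
positive-even (ℤ.+ zero)          (ℤ.+<+ ()) _
positive-even (ℤ.+ suc zero)      _ ()
positive-even (ℤ.+ suc (suc n)) _ _ = ℤ.+≤+ (s≤s (s≤s z≤n))

ℤ-cancelʳ-≤ : ∀ k {i j} → i ℤ.+ k ℤ.≤ j ℤ.+ k → i ℤ.≤ j
ℤ-cancelʳ-≤ k {i} {j} le = subst₂ ℤ._≤_ (cancel i k) (cancel j k) (ℤₚ.+-monoˡ-≤ (ℤ.- k) le)
  where
  cancel : ∀ i k → i ℤ.+ k ℤ.+ ℤ.- k ≡ i
  cancel = ℤ-Solver.solve-∀

minimal-list : ∀ {E : Set} (es : List E) → (∀ e → e ∈ es) → {P : List E → Set} → (∀ L → Dec (P L)) →
  (∀ {L} → P L → Unique L) → P [] → (cost : List E → ℤ) →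
  ∃[ M ] (P M × (∀ L → P L → cost M ℤ.≤ cost L))
minimal-list es all {P} P? P! P[] cost = argmin cost [] cands , argmin-all cost P[] (Allₚ.all-filter P? lists) ,
    λ L pL → All.lookup (f[argmin]≤f[xs] {f = cost} [] cands) (∈-filter⁺ P? (∈-listsUpTo (length es) (λ _ → all _) (Unique-⊆-length (P! pL) (λ _ → all _))) pL)
  where
  open import Data.List.Extrema ℤₚ.≤-totalOrder
  lists = listsUpTo es (length es)
  cands = filter P? lists

module SumsOfCircuits {E : Set} (_≟E_ : DecidableEquality E) (es : List E) (es! : Unique es) (es-all : ∀ e → e ∈ es) where

  -- No negative circuits, phrased for even sets, which are disjoint unions of circuits.
  Conservative : (E → ℕ) → (E → ℕ) → (E → ℤ) → Set
  Conservative a b w = ∀ L → Unique L → Graph.Even a b L → ℤ.0ℤ ℤ.≤ Z.∑ L w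

  module Step (a b : E → ℕ) (w : E → ℤ) (q : ℕ → Bool)
              (par : ∀ e → parity (w e) ≡ Graph.cr a b q e)
              (cons : Conservative a b w)
              (nz : ∀ e → a e ≢ b e → w e ≢ ℤ.0ℤ) where
    open Graph a b

    K = length es

    -- Lexicographic order by weight and then by length, packed into one integer; lists without
    -- repetition have length at most `K`.
    cost : List E → ℤ
    cost L = Z.∑ L w ℤ.* ℤ.+ suc K ℤ.+ ℤ.+ length L

    cost-++ : ∀ Q R → cost (Q ++ R) ≡ cost Q ℤ.+ cost R
    cost-++ Q R = ≡-trans (cong₂ (λ x y → x ℤ.* ℤ.+ suc K ℤ.+ y) (Z.∑-++ Q R w) (cong ℤ.+_ (length-++ Q)))
      (ring (Z.∑ Q w) (Z.∑ R w) (ℤ.+ suc K) (ℤ.+ length Q) (ℤ.+ length R))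
      where
      ring : ∀ x y k l m → (x ℤ.+ y) ℤ.* k ℤ.+ (l ℤ.+ m) ≡ (x ℤ.* k ℤ.+ l) ℤ.+ (y ℤ.* k ℤ.+ m)
      ring = ℤ-Solver.solve-∀

    cost≤0 : ∀ Q → 0 < length Q → cost Q ℤ.≤ ℤ.0ℤ → Z.∑ Q w ℤ.< ℤ.0ℤ
    cost≤0 Q len le with Z.∑ Q w
    ... | -[1+ n ] = ℤ.-<+
    ... | ℤ.+ n = contradiction (≤-trans len (≤-trans (m≤n+m _ (n * suc K)) (ℤₚ.drop‿+≤+
            (subst (ℤ._≤ ℤ.0ℤ) (cong (ℤ._+ ℤ.+ length Q) (sym (ℤₚ.pos-* n (suc K)))) le)))) λ ()

    0≤cost : ∀ Q → length Q ≤ K → ℤ.0ℤ ℤ.≤ cost Q → ℤ.0ℤ ℤ.≤ Z.∑ Q w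
    0≤cost Q len le with Z.∑ Q w
    ... | ℤ.+ n      = ℤ.+≤+ z≤n
    ... | -[1+ n ] = contradiction (ℤₚ.≤-trans le (ℤₚ.+-monoˡ-≤ (ℤ.+ length Q) (ℤₚ.*-monoʳ-≤-nonNeg (ℤ.+ suc K) { -[1+ n ]} {ℤ.-1ℤ} (ℤ.-≤- z≤n))))
            (ℤₚ.<⇒≱ (lt len))
      where
      lt : ∀ {l k} → l ≤ k → ℤ.-1ℤ ℤ.* ℤ.+ suc k ℤ.+ ℤ.+ l ℤ.< ℤ.0ℤ
      lt {l} {k} le = subst (ℤ._< ℤ.0ℤ) (cong (ℤ._+ ℤ.+ l) (sym (ℤₚ.-1*i≡-i (ℤ.+ suc k))))
        (subst (ℤ.- ℤ.+ suc k ℤ.+ ℤ.+ l ℤ.<_) (ℤₚ.+-inverseˡ (ℤ.+ suc k)) (ℤₚ.+-monoʳ-< (ℤ.- ℤ.+ suc k) (ℤ.+<+ (s≤s le))))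

    length≤K : ∀ {L} → Unique L → length L ≤ K
    length≤K u = Unique-⊆-length u (λ _ → es-all _)

    IsTrail : List E → Set
    IsTrail L = Unique L × ∃[ x ] ∃[ y ] Trail x L y

    trailFrom? : ∀ x L → Dec (∃[ y ] Trail x L y)
    trailFrom? x []      = yes (x , [])
    trailFrom? x (e ∷ L) with a e ℕ.≟ x | b e ℕ.≟ x | trailFrom? (b e) L | trailFrom? (a e) L
    ... | yes p | _ | yes (y , t) | _ = yes (y , inj₁ (p , refl) ∷ t)
    ... | _ | yes p | _ | yes (y , t) = yes (y , inj₂ (refl , p) ∷ t)
    ... | no ¬p | no ¬q | _ | _ = no λ { (_ , inj₁ (p , _) ∷ _) → ¬p p ; (_ , inj₂ (_ , p) ∷ _) → ¬q p }
    ... | no ¬p | yes q | _ | no ¬t = no λ { (_ , inj₁ (p , _) ∷ _) → ¬p p ; (_ , inj₂ (refl , _) ∷ t) → ¬t (_ , t) }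
    ... | yes p | no ¬q | no ¬t | _ = no λ { (_ , inj₁ (_ , refl) ∷ t) → ¬t (_ , t) ; (_ , inj₂ (_ , q) ∷ _) → ¬q q }
    ... | yes p | yes q | no ¬t | no ¬s = no λ { (_ , inj₁ (_ , refl) ∷ t) → ¬t (_ , t) ; (_ , inj₂ (refl , _) ∷ t) → ¬s (_ , t) }

    isTrail? : ∀ L → Dec (IsTrail L)
    isTrail? L = unique? L ×-dec start L
      where
      open import Data.List.Relation.Unary.Unique.DecPropositional _≟E_ using (unique?)
      start : ∀ L → Dec (∃[ x ] ∃[ y ] Trail x L y)
      start [] = yes (0 , 0 , [])
      start (e ∷ L) with trailFrom? (a e) (e ∷ L) | trailFrom? (b e) (e ∷ L)
      ... | yes t | _     = yes (_ , t)
      ... | no _  | yes t = yes (_ , t)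
      ... | no ¬t | no ¬s = no λ { (_ , y , t@(inj₁ (refl , _) ∷ _)) → ¬t (y , t) ; (_ , y , t@(inj₂ (_ , refl) ∷ _)) → ¬s (y , t) }

    trail-split : ∀ {x y} Q {R} → Trail x (Q ++ R) y → ∃[ m ] (Trail x Q m × Trail m R y)
    trail-split []      t       = _ , [] , t
    trail-split (e ∷ Q) (j ∷ t) = let (m , t₁ , t₂) = trail-split Q t in m , j ∷ t₁ , t₂

    On : ℕ → List E → Set
    On x C = Any (λ g → a g ≡ x ⊎ b g ≡ x) C

    on? : ∀ x C → Dec (On x C)
    on? x = Any.any? (λ g → dec g)
      where
      dec : ∀ g → Dec (a g ≡ x ⊎ b g ≡ x)
      dec g with a g ℕ.≟ x | b g ℕ.≟ x
      ... | yes p | _     = yes (inj₁ p)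
      ... | no _  | yes p = yes (inj₂ p)
      ... | no ¬p | no ¬q = no λ { (inj₁ p) → ¬p p ; (inj₂ q) → ¬q q }

    joins-On : ∀ {g y z C} → Joins g y z → g ∈ C → On y C
    joins-On j g∈ = lose g∈ (end j)
      where
      end : ∀ {g y z} → Joins g y z → a g ≡ y ⊎ b g ≡ y
      end (inj₁ (p , _)) = inj₁ p
      end (inj₂ (_ , p)) = inj₂ p

    trail-at : ∀ {x t u C} → Trail t C u → On x C → ∃[ C₁ ] ∃[ C₂ ] (C ≡ C₁ ++ C₂ × Trail t C₁ x × Trail x C₂ u)
    trail-at {C = g ∷ C} (inj₁ (refl , refl) ∷ t) (here (inj₁ refl)) = [] , g ∷ C , refl , [] , inj₁ (refl , refl) ∷ t
    trail-at {C = g ∷ C} (inj₁ (refl , refl) ∷ t) (here (inj₂ refl)) = g ∷ [] , C , refl , inj₁ (refl , refl) ∷ [] , t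
    trail-at {C = g ∷ C} (inj₂ (refl , refl) ∷ t) (here (inj₁ refl)) = g ∷ [] , C , refl , inj₂ (refl , refl) ∷ [] , t
    trail-at {C = g ∷ C} (inj₂ (refl , refl) ∷ t) (here (inj₂ refl)) = [] , g ∷ C , refl , [] , inj₂ (refl , refl) ∷ t
    trail-at {C = g ∷ C} (j ∷ t) (there on) with trail-at t on
    ... | C₁ , C₂ , refl , t₁ , t₂ = g ∷ C₁ , C₂ , refl , j ∷ t₁ , t₂

    -- e ∷ P' is a trail of least weight from t; among those it has the fewest edges.
    module MinTrail {e : E} {P' : List E} {t s y : ℕ} (P! : Unique (e ∷ P')) (je : Joins e t s) (tr : Trail s P' y)
                    (min : ∀ L → IsTrail L → cost (e ∷ P') ℤ.≤ cost L) where
      P = e ∷ P'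

      -- Without the prefix a trail remains, so by minimality the prefix costs at most 0; as its
      -- length counts positively, its weight is negative.
      prefix-negative : ∀ Q R → P ≡ Q ++ R → 0 < length Q → Z.∑ Q w ℤ.< ℤ.0ℤ
      prefix-negative Q R eq len = cost≤0 Q len (ℤ-cancelʳ-≤ (cost R)
        (ℤₚ.≤-trans (ℤₚ.≤-reflexive (≡-trans (sym (cost-++ Q R)) (cong cost (sym eq))))
          (ℤₚ.≤-trans (min R (proj₁ (proj₂ (Unique-++⁻ Q (subst Unique eq P!))) , _ , _ , proj₂ (proj₂ split)))
            (ℤₚ.≤-reflexive (sym (ℤₚ.+-identityˡ (cost R)))))))
        where
        split = trail-split Q (subst (λ z → Trail t z y) eq (je ∷ tr))

      -- A closed prefix would be an even set of negative weight.
      prefix-open : ∀ Q R {x} → P ≡ Q ++ R → 0 < length Q → Trail t Q x → x ≢ t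
      prefix-open Q R eq len tQ refl = ℤₚ.<⇒≱ (prefix-negative Q R eq len)
        (cons Q (proj₁ (Unique-++⁻ Q (subst Unique eq P!))) (closed-even tQ))

      -- `D` followed by `P` is again a trail, hence not cheaper than `P`.
      extend-nonneg : ∀ D {z} → Unique D → (∀ {g} → g ∈ D → g ∉ P) → Trail z D t → ℤ.0ℤ ℤ.≤ Z.∑ D w
      extend-nonneg D D! dis tD = 0≤cost D (length≤K D!) (ℤ-cancelʳ-≤ (cost P)
        (ℤₚ.≤-trans (ℤₚ.≤-reflexive (ℤₚ.+-identityˡ (cost P)))
          (ℤₚ.≤-trans (min (D ++ P) (Uniqueₚ.++⁺ D! P! (λ { (p , q) → dis p q }) , _ , _ , trail-++ tD (je ∷ tr)))
            (ℤₚ.≤-reflexive (cost-++ D P)))))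

      -- If `P` used `f`, its prefix up to or through `f` would return to `t`. So `f` can be put in
      -- front of `P`, which bounds its weight below by 0, and `nz` excludes equality.
      edge-positive : ∀ {f z} → Joins f t z → z ≢ t → f ≢ e → ℤ.0ℤ ℤ.< w f
      edge-positive {f} {z} j z≢t f≢e = ℤₚ.≤∧≢⇒<
          (subst (ℤ.0ℤ ℤ.≤_) (ℤₚ.+-identityʳ (w f)) (extend-nonneg (f ∷ []) ([] ∷ []) (λ { (here refl) → off }) (flip j ∷ [])))
          (λ eq → nz f (joins-nonloop j z≢t) (sym eq))
        where
        flip : ∀ {g x y} → Joins g x y → Joins g y x
        flip (inj₁ p) = inj₂ p
        flip (inj₂ p) = inj₁ p
        off : f ∉ P
        off f∈ with ∈-∃++ f∈
        ... | [] , R , refl = f≢e refl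
        ... | Q@(_ ∷ _) , R , eq with trail-split Q (subst (λ z → Trail t z y) eq (je ∷ tr))
        ...   | m , tQ , (jf ∷ _) with ends jf j
          where
          ends : ∀ {m m'} → Joins f m m' → Joins f t z → m ≡ t ⊎ m' ≡ t
          ends (inj₁ (p , _)) (inj₁ (q , _)) = inj₁ (≡-trans (sym p) q)
          ends (inj₁ (_ , p)) (inj₂ (_ , q)) = inj₂ (≡-trans (sym p) q)
          ends (inj₂ (p , _)) (inj₁ (q , _)) = inj₂ (≡-trans (sym p) q)
          ends (inj₂ (_ , p)) (inj₂ (_ , q)) = inj₁ (≡-trans (sym p) q)
        ...     | inj₁ m≡t  = prefix-open Q (f ∷ R) eq (s≤s z≤n) tQ m≡t
        ...     | inj₂ m'≡t = prefix-open (Q ++ f ∷ []) R (≡-trans eq (sym (++-assoc Q (f ∷ []) R))) (s≤s z≤n) (trail-++ tQ (jf ∷ [])) m'≡t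

      -- A circuit C through t avoiding e: where P first meets C again, the prefix Q of P
      -- closes up with either arc of C, so w(C) ≥ - 2 w(Q) > 0; if P never meets C,
      -- then C minus its first edge prolongs P.
      circuit-positive : ∀ {C} → Unique C → Trail t C t → e ∉ C → 0 < length C → All NonLoop C → ℤ.0ℤ ℤ.< Z.∑ C w
      circuit-positive {f ∷ C'} C!@(_ ∷ C'!) tC@(jf ∷ tC') e∉ len (nlf ∷ _) =
        scan (e ∷ []) P' refl (s≤s z≤n) (je ∷ []) tr (λ { (here refl) → e∉ })
        where
        C = f ∷ C'
        scan : ∀ {x} Q R → P ≡ Q ++ R → 0 < length Q → Trail t Q x → Trail x R y → (∀ {g} → g ∈ Q → g ∉ C) → ℤ.0ℤ ℤ.< Z.∑ C w
        scan {x} Q R eq len tQ tR dis with on? x C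
        scan {x} Q R eq len tQ tR dis | yes on with trail-at tC on
        ... | C₁ , C₂ , C≡ , t₁ , t₂ = pos (prefix-negative Q R eq len) (half C₁ (λ p → subst (_ ∈_) (sym C≡) (∈-++⁺ˡ p)) (proj₁ uC) (λ A → ≡-trans (trail-cr t₁ A) refl))
               (half C₂ (λ p → subst (_ ∈_) (sym C≡) (∈-++⁺ʳ C₁ p)) (proj₁ (proj₂ uC)) (λ A → ≡-trans (trail-cr t₂ A) (xor-comm (A x) (A t))))
               (≡-trans (cong (λ z → Z.∑ z w) C≡) (Z.∑-++ C₁ C₂ w))
          where
          uC = Unique-++⁻ C₁ (subst Unique C≡ C!)
          half : ∀ D → (∀ {g} → g ∈ D → g ∈ C) → Unique D → (∀ A → B.∑ D (cr A) ≡ A t xor A x) → ℤ.0ℤ ℤ.≤ Z.∑ Q w ℤ.+ Z.∑ D w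
          half D sub D! pD = subst (ℤ.0ℤ ℤ.≤_) (Z.∑-++ Q D w) (cons (Q ++ D)
            (Uniqueₚ.++⁺ (proj₁ (Unique-++⁻ Q (subst Unique eq P!))) D! (λ { (p , q) → dis p (sub q) }))
            (λ A → ≡-trans (B.∑-++ Q D (cr A)) (≡-trans (cong₂ _xor_ (trail-cr tQ A) (pD A)) (xor-same (A t xor A x)))))
          pos : ∀ {q c₁ c₂ c} → q ℤ.< ℤ.0ℤ → ℤ.0ℤ ℤ.≤ q ℤ.+ c₁ → ℤ.0ℤ ℤ.≤ q ℤ.+ c₂ → c ≡ c₁ ℤ.+ c₂ → ℤ.0ℤ ℤ.< c
          pos {q} {c₁} {c₂} q<0 h₁ h₂ refl = ℤₚ.≤-<-trans (ℤₚ.+-mono-≤ h₁ h₂)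
            (subst₂ ℤ._<_ (ring q c₁ c₂) (ℤₚ.+-identityˡ (c₁ ℤ.+ c₂)) (ℤₚ.+-monoˡ-< (c₁ ℤ.+ c₂) (ℤₚ.+-mono-< q<0 q<0)))
            where
            ring : ∀ q c d → (q ℤ.+ q) ℤ.+ (c ℤ.+ d) ≡ (q ℤ.+ c) ℤ.+ (q ℤ.+ d)
            ring = ℤ-Solver.solve-∀
        scan {x} Q [] eq len tQ tR dis | no ¬on =
          ℤₚ.<-≤-trans (edge-positive jf (λ z≡t → nonloop-≢ jf nlf z≡t) (λ { refl → e∉ (here refl) }))
            (subst (ℤ._≤ Z.∑ C w) (ℤₚ.+-identityʳ (w f)) (ℤₚ.+-monoʳ-≤ (w f)
              (extend-nonneg C' C'! (λ g∈C' g∈P → dis (subst (_ ∈_) (≡-trans eq (++-identityʳ Q)) g∈P) (there g∈C')) tC')))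
          where
          nonloop-≢ : ∀ {g u v} → Joins g u v → NonLoop g → v ≢ u
          nonloop-≢ (inj₁ (refl , refl)) nl eq = nl (sym eq)
          nonloop-≢ (inj₂ (refl , refl)) nl eq = nl eq
        scan {x} Q (g ∷ R) eq len tQ (jg ∷ tR) dis | no ¬on =
          scan (Q ++ g ∷ []) R (≡-trans eq (sym (++-assoc Q (g ∷ []) R))) (subst (0 <_) (sym (length-++ Q)) (<-≤-trans len (m≤m+n _ 1)))
            (trail-++ tQ (jg ∷ [])) tR dis'
          where
          dis' : ∀ {h} → h ∈ Q ++ g ∷ [] → h ∉ C
          dis' h∈ h∈C with ∈-++⁻ Q h∈
          ... | inj₁ p           = dis p h∈C
          ... | inj₂ (here refl) = ¬on (joins-On jg h∈C)

      star : E → Bool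
      star f = cr (pt t) f

      -- The cut around `t` with sign +1 at `e` and -1 elsewhere. Since `e` is negative and the
      -- other edges of the star are positive, all of these weights move towards 0, and the parities
      -- change by a cut.
      adj : E → ℤ
      adj f = if ⌊ f ≟E e ⌋ then ℤ.1ℤ else (if star f then ℤ.-1ℤ else ℤ.0ℤ)

      w' : E → ℤ
      w' f = w f ℤ.+ adj f

      s≢t : s ≢ t
      s≢t = prefix-open (e ∷ []) P' refl (s≤s z≤n) (je ∷ [])

      star-e : star e ≡ true
      star-e = ≡-trans (joins-cr je (pt t)) (cong₂ _xor_ (pt-refl t) (pt-≢ s≢t))

      star-inc : ∀ f → NonLoop f → bit (star f) ≡ inc t f
      star-inc f nl with a f ℕ.≟ t | b f ℕ.≟ t
      ... | yes p | yes q = contradiction (≡-trans p (sym q)) nl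
      ... | yes _ | no _  = refl
      ... | no _  | yes _ = refl
      ... | no _  | no _  = refl

      adj-off : ∀ L → e ∉ L → Z.∑ L adj ≡ ℤ.- (ℤ.+ N.∑ L (bit ∘ star))
      adj-off []      e∉ = refl
      adj-off (f ∷ L) e∉ with f ≟E e
      ... | yes refl = contradiction (here refl) e∉
      ... | no _     = ≡-trans (cong₂ ℤ._+_ (neg (star f)) (adj-off L (λ p → e∉ (there p))))
                         (≡-trans (sym (ℤₚ.neg-distrib-+ (ℤ.+ bit (star f)) (ℤ.+ N.∑ L (bit ∘ star)))) refl)
        where
        neg : ∀ c → (if c then ℤ.-1ℤ else ℤ.0ℤ) ≡ ℤ.- (ℤ.+ bit c)
        neg true  = refl
        neg false = refl

      adj-e : adj e ≡ ℤ.1ℤ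
      adj-e with e ≟E e
      ... | yes _ = refl
      ... | no ¬p = contradiction refl ¬p

      -- If `C` uses `e`, its two edges at `t` contribute 1 - 1. Otherwise it loses 2, and it can
      -- afford this because `w` is positive on it, by `circuit-positive`, and even, by `par`.
      w'-circuit : ∀ {C} → Unique C → Trail t C t → N.∑ C (inc t) ≡ 2 → All NonLoop C → ℤ.0ℤ ℤ.≤ Z.∑ C w'
      w'-circuit {C} C! tC two nl with Any.any? (λ f → e ≟E f) C
      ... | yes e∈ with ∈-split e∈
      ...   | C₁ , perm = subst (ℤ.0ℤ ℤ.≤_) (sym (≡-trans (Z.∑-+ C w adj) (≡-trans (cong (ℤ._+_ (Z.∑ C w)) total) (ℤₚ.+-identityʳ _)))) (cons C C! (closed-even tC))
        where
        C₁-star : N.∑ C₁ (bit ∘ star) ≡ 1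
        C₁-star = suc-injective (≡-trans (cong (_+ N.∑ C₁ (bit ∘ star)) (sym (cong bit star-e)))
          (≡-trans (sym (N.∑-↭ (bit ∘ star) perm)) (≡-trans (N.∑-cong∈ C (λ f f∈ → star-inc f (All.lookup nl f∈))) two)))
        e∉C₁ : e ∉ C₁
        e∉C₁ e∈₁ with Unique-resp-↭ perm C!
        ... | e≢ ∷ _ = All.lookup e≢ e∈₁ refl
        total : Z.∑ C adj ≡ ℤ.0ℤ
        total = ≡-trans (Z.∑-↭ adj perm) (≡-trans (cong₂ ℤ._+_ adj-e (adj-off C₁ e∉C₁)) (cong (λ z → ℤ.1ℤ ℤ.+ ℤ.- (ℤ.+ z)) C₁-star))
      w'-circuit {C} C! tC two nl | no e∉ = subst (ℤ.0ℤ ℤ.≤_) (sym (≡-trans (Z.∑-+ C w adj) (cong (ℤ._+_ (Z.∑ C w)) total)))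
          (ℤₚ.i≤j⇒0≤j-i (positive-even (Z.∑ C w) (circuit-positive C! tC e∉ (nonempty C two) nl) even))
        where
        nonempty : ∀ C → N.∑ C (inc t) ≡ 2 → 0 < length C
        nonempty (_ ∷ _) _ = s≤s z≤n
        total : Z.∑ C adj ≡ ℤ.- (ℤ.+ 2)
        total = ≡-trans (adj-off C e∉) (cong (λ z → ℤ.- (ℤ.+ z)) (≡-trans (N.∑-cong∈ C (λ f f∈ → star-inc f (All.lookup nl f∈))) two))
        even : parity (Z.∑ C w) ≡ false
        even = ≡-trans (parity-∑ C w) (≡-trans (B.∑-cong C par) (closed-even tC q))

      -- Closed trails of degree 2 through `t` are removed until no edge of the star is left; on the
      -- rest `w'` equals `w`.
      w'-conservative : Conservative a b w'
      w'-conservative L L! eL = go L (<-wellFounded _) L! eL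
        where
        go : ∀ L → Acc _<_ (length L) → Unique L → Even L → ℤ.0ℤ ℤ.≤ Z.∑ L w'
        go L (acc rs) L! eL with Any.any? (λ f → star f Data.Bool.≟ true) L
        ... | no ¬star = subst (ℤ.0ℤ ℤ.≤_) (sym (≡-trans (Z.∑-+ L w adj) (≡-trans (cong (ℤ._+_ (Z.∑ L w)) total) (ℤₚ.+-identityʳ _)))) (cons L L! eL)
          where
          total : Z.∑ L adj ≡ ℤ.0ℤ
          total = ≡-trans (adj-off L (λ e∈ → ¬star (lose e∈ star-e)))
            (cong (λ z → ℤ.- (ℤ.+ z)) (≡-trans (N.∑-cong∈ L (λ f f∈ → cong bit (¬-not (λ h → ¬star (lose f∈ h))))) (N.∑-0 L)))
        ... | yes has = let (f , f∈ , sf) = find has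
                            (z , j , z≢t) = odd-end sf
                            (C , L' , perm , tC , two , nl) = extract eL f∈ j z≢t
                        in peel C L' perm tC two nl
          where
          shorter : ∀ C L' → N.∑ C (inc t) ≡ 2 → length L ≡ length C + length L' → length L' < length L
          shorter []      L' () eq
          shorter (_ ∷ C) L' _  eq = ≤-trans (s≤s (m≤n+m _ (length C))) (≤-reflexive (sym eq))
          peel : ∀ C L' → L ↭ C ++ L' → Trail t C t → N.∑ C (inc t) ≡ 2 → All NonLoop C → ℤ.0ℤ ℤ.≤ Z.∑ L w'
          peel C L' perm tC two nl = subst (ℤ.0ℤ ℤ.≤_) (sym (≡-trans (Z.∑-↭ w' perm) (Z.∑-++ C L' w')))
              (ℤₚ.+-mono-≤ (w'-circuit (proj₁ u) tC two nl)
                (go L' (rs (shorter C L' two (≡-trans (↭-length perm) (length-++ C)))) (proj₁ (proj₂ u)) (even-++ʳ C eL perm (closed-even tC))))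
            where
            u = Unique-++⁻ C (Unique-resp-↭ perm L!)

      q' : ℕ → Bool
      q' v = q v xor pt t v

      w'-parity : ∀ f → parity (w' f) ≡ cr q' f
      w'-parity f = ≡-trans (parity-+ (w f) (adj f)) (≡-trans (cong₂ _xor_ (par f) (adj-parity)) (B.interchange (q (a f)) (q (b f)) (pt t (a f)) (pt t (b f))))
        where
        adj-parity : parity (adj f) ≡ star f
        adj-parity with f ≟E e
        ... | yes refl = sym star-e
        ... | no _ with star f
        ...   | true  = refl
        ...   | false = refl

      e-negative : w e ℤ.< ℤ.0ℤ
      e-negative = subst (ℤ._< ℤ.0ℤ) (ℤₚ.+-identityʳ (w e)) (prefix-negative (e ∷ []) P' refl (s≤s z≤n))

      w'-closer : ∀ f → ℤ.∣ w' f ∣ ≤ ℤ.∣ w f ∣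
      w'-closer f with f ≟E e
      ... | yes refl = up (w f) e-negative
        where
        up : ∀ i → i ℤ.< ℤ.0ℤ → ℤ.∣ i ℤ.+ ℤ.1ℤ ∣ ≤ ℤ.∣ i ∣
        up -[1+ zero ]  _ = z≤n
        up -[1+ suc n ] _ = n≤1+n _
        up (ℤ.+ n) (ℤ.+<+ ())
      ... | no f≢e with star f in sf
      ...   | false = ≤-reflexive (cong ℤ.∣_∣ (ℤₚ.+-identityʳ (w f)))
      ...   | true with odd-end sf
      ...     | z , j , z≢t = down (w f) (edge-positive j z≢t f≢e)
        where
        down : ∀ i → ℤ.0ℤ ℤ.< i → ℤ.∣ i ℤ.+ ℤ.-1ℤ ∣ ≤ ℤ.∣ i ∣
        down (ℤ.+ suc n) _ = n≤1+n n
        down (ℤ.+ zero) (ℤ.+<+ ())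

      w'-closer-e : ℤ.∣ w' e ∣ < ℤ.∣ w e ∣
      w'-closer-e = subst (λ z → ℤ.∣ w e ℤ.+ z ∣ < ℤ.∣ w e ∣) (sym adj-e) (up (w e) e-negative)
        where
        up : ∀ i → i ℤ.< ℤ.0ℤ → ℤ.∣ i ℤ.+ ℤ.1ℤ ∣ < ℤ.∣ i ∣
        up -[1+ zero ]  _ = s≤s z≤n
        up -[1+ suc n ] _ = n<1+n _
        up (ℤ.+ n) (ℤ.+<+ ())

      e-nonloop : NonLoop e
      e-nonloop = joins-nonloop je s≢t

      -- The value changes by `2 * p e` minus the total of `p` over the star of `t`.
      w'-value : ∀ (p : E → ℕ) → 2 * p e ≤ N.∑ es (λ f → if star f then p f else 0) →
        Z.∑ es (λ f → w' f ℤ.* ℤ.+ p f) ℤ.≤ Z.∑ es (λ f → w f ℤ.* ℤ.+ p f)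
      w'-value p cut = ℤ-cancelʳ-≤ (ℤ.+ (2 * p e)) (ℤₚ.≤-trans (ℤₚ.+-monoʳ-≤ (Z.∑ es (λ f → w' f ℤ.* ℤ.+ p f)) (ℤ.+≤+ cut)) (ℤₚ.≤-reflexive eq))
        where
        open ≡-Reasoning
        point : ∀ f → w' f ℤ.* ℤ.+ p f ℤ.+ ℤ.+ (if star f then p f else 0) ≡ w f ℤ.* ℤ.+ p f ℤ.+ (if ⌊ f ≟E e ⌋ then ℤ.+ (2 * p f) else ℤ.0ℤ)
        point f with f ≟E e
        ... | yes refl rewrite star-e = ≡-trans (ring (w f) (ℤ.+ p f)) (cong (ℤ._+_ (w f ℤ.* ℤ.+ p f)) (cong (ℤ._+_ (ℤ.+ p f)) (cong ℤ.+_ (sym (+-identityʳ (p f))))))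
          where
          ring : ∀ w p → (w ℤ.+ ℤ.1ℤ) ℤ.* p ℤ.+ p ≡ w ℤ.* p ℤ.+ (p ℤ.+ p)
          ring = ℤ-Solver.solve-∀
        ... | no _ with star f
        ...   | true  = ring (w f) (ℤ.+ p f)
          where
          ring : ∀ w p → (w ℤ.+ ℤ.-1ℤ) ℤ.* p ℤ.+ p ≡ w ℤ.* p ℤ.+ ℤ.0ℤ
          ring = ℤ-Solver.solve-∀
        ...   | false = ring (w f) (ℤ.+ p f)
          where
          ring : ∀ w p → (w ℤ.+ ℤ.0ℤ) ℤ.* p ℤ.+ ℤ.0ℤ ≡ w ℤ.* p ℤ.+ ℤ.0ℤ
          ring = ℤ-Solver.solve-∀
        eq : Z.∑ es (λ f → w' f ℤ.* ℤ.+ p f) ℤ.+ ℤ.+ N.∑ es (λ f → if star f then p f else 0) ≡ Z.∑ es (λ f → w f ℤ.* ℤ.+ p f) ℤ.+ ℤ.+ (2 * p e)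
        eq = begin
          Z.∑ es (λ f → w' f ℤ.* ℤ.+ p f) ℤ.+ ℤ.+ N.∑ es (λ f → if star f then p f else 0)
            ≡⟨ cong (ℤ._+_ (Z.∑ es (λ f → w' f ℤ.* ℤ.+ p f))) (sym (∑-pos es _)) ⟩
          Z.∑ es (λ f → w' f ℤ.* ℤ.+ p f) ℤ.+ Z.∑ es (λ f → ℤ.+ (if star f then p f else 0))
            ≡⟨ sym (Z.∑-+ es _ _) ⟩
          Z.∑ es (λ f → w' f ℤ.* ℤ.+ p f ℤ.+ ℤ.+ (if star f then p f else 0))
            ≡⟨ Z.∑-cong es point ⟩
          Z.∑ es (λ f → w f ℤ.* ℤ.+ p f ℤ.+ (if ⌊ f ≟E e ⌋ then ℤ.+ (2 * p f) else ℤ.0ℤ))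
            ≡⟨ Z.∑-+ es _ _ ⟩
          Z.∑ es (λ f → w f ℤ.* ℤ.+ p f) ℤ.+ Z.∑ es (λ f → if ⌊ f ≟E e ⌋ then ℤ.+ (2 * p f) else ℤ.0ℤ)
            ≡⟨ cong (ℤ._+_ (Z.∑ es (λ f → w f ℤ.* ℤ.+ p f))) (Z.∑-pick _≟E_ es e (λ f → ℤ.+ (2 * p f)) es! (es-all e)) ⟩
          Z.∑ es (λ f → w f ℤ.* ℤ.+ p f) ℤ.+ ℤ.+ (2 * p e) ∎

  module Contract (a b : E → ℕ) (w : E → ℤ) (q : ℕ → Bool) (par : ∀ e → parity (w e) ≡ Graph.cr a b q e)
                  (cons : Conservative a b w) (z : E) (wz : w z ≡ ℤ.0ℤ) where
    open Graph a b
    ρ : ℕ → ℕ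
    ρ v = if pt (b z) v then a z else v
    a' b' : E → ℕ
    a' e = ρ (a e)
    b' e = ρ (b e)

    -- The weight 0 of `z` is even, so the parity potential agrees at the two ends of `z`.
    q-ρ : ∀ v → q (ρ v) ≡ q v
    q-ρ v with v ℕ.≟ b z
    ... | yes refl = xor≡false (≡-trans (sym (par z)) (cong parity wz))
    ... | no _     = refl

    parity' : ∀ e → parity (w e) ≡ Graph.cr a' b' q e
    parity' e = ≡-trans (par e) (sym (cong₂ _xor_ (q-ρ (a e)) (q-ρ (b e))))

    -- A(v) = A(ρ v) + [v = b z] (A(a z) + A(b z))
    decompose : ∀ (A : ℕ → Bool) v → A v ≡ A (ρ v) xor ((A (a z) xor A (b z)) ∧ pt (b z) v)
    decompose A v with v ℕ.≟ b z
    ... | no _     = sym (≡-trans (cong (A v xor_) (∧-zeroʳ (A (a z) xor A (b z)))) (xor-identityʳ (A v)))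
    ... | yes refl = sym (≡-trans (cong (A (a z) xor_) (∧-identityʳ (A (a z) xor A v))) (xor-cancelˡ (A (a z)) (A v)))

    -- Before contraction such a set can fail to be even only by the boundary of `z`.
    L-cr : ∀ L → Graph.Even a' b' L → ∀ A → B.∑ L (cr A) ≡ cr A z ∧ B.∑ L (cr (pt (b z)))
    L-cr L eL A = begin
      B.∑ L (cr A)  ≡⟨ B.∑-cong L point ⟩
      B.∑ L (λ e → Graph.cr a' b' A e xor (κ ∧ cr (pt (b z)) e)) ≡⟨ B.∑-+ L _ _ ⟩
      B.∑ L (Graph.cr a' b' A) xor B.∑ L (λ e → κ ∧ cr (pt (b z)) e) ≡⟨ cong₂ _xor_ (eL A) (B.∑-*ˡ L κ _) ⟩
      κ ∧ B.∑ L (cr (pt (b z))) ∎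
      where
      open ≡-Reasoning
      κ = cr A z
      point : ∀ e → cr A e ≡ Graph.cr a' b' A e xor (κ ∧ cr (pt (b z)) e)
      point e = ≡-trans (cong₂ _xor_ (decompose A (a e)) (decompose A (b e)))
        (≡-trans (B.interchange (A (a' e)) (κ ∧ pt (b z) (a e)) (A (b' e)) (κ ∧ pt (b z) (b e)))
          (cong (Graph.cr a' b' A e xor_) (sym (∧-distribˡ-xor κ (pt (b z) (a e)) (pt (b z) (b e))))))

    -- If the set is odd at an end of `z`, inserting or deleting `z` repairs it without changing the
    -- weight.
    conservative' : Conservative a' b' w
    conservative' L L! eL with B.∑ L (cr (pt (b z))) in odd
    ... | false = cons L L! (λ A → ≡-trans (L-cr L eL A) (≡-trans (cong (cr A z ∧_) odd) (∧-zeroʳ (cr A z))))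
    ... | true with Any.any? (λ f → z ≟E f) L
    ...   | no z∉ = subst (ℤ.0ℤ ℤ.≤_) (≡-trans (cong (ℤ._+ Z.∑ L w) wz) (ℤₚ.+-identityˡ _))
              (cons (z ∷ L) (Allₚ.¬Any⇒All¬ L z∉ ∷ L!) (λ A → ≡-trans (cong (cr A z xor_) (crz A)) (xor-same (cr A z))))
      where
      crz : ∀ A → B.∑ L (cr A) ≡ cr A z
      crz A = ≡-trans (L-cr L eL A) (≡-trans (cong (cr A z ∧_) odd) (∧-identityʳ (cr A z)))
    ...   | yes z∈ with ∈-split z∈
    ...     | R , perm = subst (ℤ.0ℤ ℤ.≤_) (sym (≡-trans (Z.∑-↭ w perm) (≡-trans (cong (ℤ._+ Z.∑ R w) wz) (ℤₚ.+-identityˡ _))))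
              (cons R (tail! (Unique-resp-↭ perm L!)) even)
      where
      tail! : ∀ {x xs} → Unique {A = E} (x ∷ xs) → Unique xs
      tail! (_ ∷ u) = u
      even : ∀ (A : ℕ → Bool) → B.∑ R (cr A) ≡ false
      even A = ≡-trans (sym (xor-cancelˡ (cr A z) _)) (≡-trans (cong (cr A z xor_) (≡-trans (sym (B.∑-↭ (cr A) perm))
        (≡-trans (L-cr L eL A) (≡-trans (cong (cr A z ∧_) odd) (∧-identityʳ (cr A z)))))) (xor-same (cr A z)))

    contracted : a' z ≡ b' z
    contracted rewrite pt-refl (b z) with a z ℕ.≟ b z
    ... | yes _ = refl
    ... | no _  = refl

  -- The `suc` gives a non-loop of weight 0 positive measure, so that contracting it is progress as
  -- well.
  measure : (E → ℕ) → (E → ℕ) → (E → ℤ) → E → ℕ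
  measure a b w e = if ⌊ a e ℕ.≟ b e ⌋ then 0 else suc ℤ.∣ w e ∣

  measure-loop : ∀ (a b : E → ℕ) (w : E → ℤ) e → a e ≡ b e → measure a b w e ≡ 0
  measure-loop a b w e eq with a e ℕ.≟ b e
  ... | yes _ = refl
  ... | no ¬p = contradiction eq ¬p

  measure-nonloop : ∀ (a b : E → ℕ) (w : E → ℤ) e → a e ≢ b e → measure a b w e ≡ suc ℤ.∣ w e ∣
  measure-nonloop a b w e ne with a e ℕ.≟ b e
  ... | yes p = contradiction p ne
  ... | no _  = refl

  measure-mono : ∀ (a b a' b' : E → ℕ) (w w' : E → ℤ) e → (a e ≡ b e → a' e ≡ b' e) → ℤ.∣ w' e ∣ ≤ ℤ.∣ w e ∣ → measure a' b' w' e ≤ measure a b w e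
  measure-mono a b a' b' w w' e imp le with a' e ℕ.≟ b' e | a e ℕ.≟ b e
  ... | yes _ | _     = z≤n
  ... | no ¬p | yes q = contradiction (imp q) ¬p
  ... | no _  | no _  = s≤s le

  -- Seymour's sums-of-circuits theorem, in the dual form of a linear inequality.
  sums-of-circuits : ∀ (p : E → ℕ) (a b : E → ℕ) (w : E → ℤ) (q : ℕ → Bool) → Acc _<_ (N.∑ es (measure a b w)) →
    (∀ e → parity (w e) ≡ Graph.cr a b q e) → Conservative a b w →
    (∀ A e → Graph.cr a b A e ≡ true → 2 * p e ≤ N.∑ es (λ f → if Graph.cr a b A f then p f else 0)) →
    ℤ.0ℤ ℤ.≤ Z.∑ es (λ e → w e ℤ.* ℤ.+ p e)
  sums-of-circuits p a b w q (acc rs) par cons cut with Any.any? (λ e → ¬? (a e ℕ.≟ b e) ×-dec (w e ℤₚ.≟ ℤ.0ℤ)) es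
  ... | yes zero-edge with find zero-edge
  ...   | z , z∈ , nl , wz = sums-of-circuits p C.a' C.b' w q
            (rs (∑-strict es (λ e → measure-mono a b C.a' C.b' w w e (cong C.ρ) ≤-refl) z∈ smaller)) C.parity' C.conservative' (λ A → cut (λ v → A (C.ρ v)))
    where
    module C = Contract a b w q par cons z wz
    smaller : measure C.a' C.b' w z < measure a b w z
    smaller = subst₂ _<_ (sym (measure-loop C.a' C.b' w z C.contracted)) (sym (measure-nonloop a b w z nl)) (s≤s z≤n)
  sums-of-circuits p a b w q (acc rs) par cons cut | no ¬zero with Any.any? (λ e → ¬? (a e ℕ.≟ b e) ×-dec (w e ℤₚ.<? ℤ.0ℤ)) es
  ... | no ¬neg = ∑-nonneg es _ (λ e e∈ → subst (ℤ._≤ w e ℤ.* ℤ.+ p e) (ℤₚ.*-zeroˡ (ℤ.+ p e)) (ℤₚ.*-monoʳ-≤-nonNeg (ℤ.+ p e) (nonneg e e∈)))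
    where
    nonneg : ∀ e → e ∈ es → ℤ.0ℤ ℤ.≤ w e
    nonneg e e∈ with a e ℕ.≟ b e
    ... | yes p = subst (ℤ.0ℤ ℤ.≤_) (ℤₚ.+-identityʳ (w e)) (cons (e ∷ []) ([] ∷ []) (λ A → ≡-trans (xor-identityʳ _) (≡-trans (cong (λ v → A v xor A (b e)) p) (xor-same (A (b e))))))
    ... | no ¬p = ℤₚ.≮⇒≥ (λ h → ¬neg (lose e∈ (¬p , h)))
  ... | yes neg = go (find neg) (minimal-list es es-all S.isTrail? proj₁ ([] , 0 , 0 , []) S.cost)
    where
    module S = Step a b w q par cons (λ e nl wz → ¬zero (lose (es-all e) (nl , wz)))
    open Graph a b
    go : ∃[ f ] (f ∈ es × NonLoop f × w f ℤ.< ℤ.0ℤ) → ∃[ M ] (S.IsTrail M × (∀ L → S.IsTrail L → S.cost M ℤ.≤ S.cost L)) →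
         ℤ.0ℤ ℤ.≤ Z.∑ es (λ e → w e ℤ.* ℤ.+ p e)
    -- A single negative edge is a cheaper trail than the empty one.
    go (f , f∈ , nl , wf) ([] , _ , min) = contradiction
      (S.0≤cost (f ∷ []) (S.length≤K {f ∷ []} ([] ∷ [])) (min (f ∷ []) ([] ∷ [] , a f , b f , inj₁ (refl , refl) ∷ [])))
      (ℤₚ.<⇒≱ (subst (ℤ._< ℤ.0ℤ) (sym (ℤₚ.+-identityʳ (w f))) wf))
    go _ (e ∷ P' , (P! , t , y , je ∷ tr) , min) =
      ℤₚ.≤-trans (sums-of-circuits p a b M.w' M.q' (rs smaller) M.w'-parity M.w'-conservative cut) (M.w'-value p (cut (pt t) e M.star-e))
      where
      module M = S.MinTrail P! je tr min
      strict : measure a b M.w' e < measure a b w e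
      strict = subst₂ _<_ (sym (measure-nonloop a b M.w' e M.e-nonloop)) (sym (measure-nonloop a b w e M.e-nonloop)) (s≤s M.w'-closer-e)
      smaller : N.∑ es (measure a b M.w') < N.∑ es (measure a b w)
      smaller = ∑-strict es (λ f → measure-mono a b a b w M.w' f id (M.w'-closer f)) (es-all e) strict

-- Plane graphs: faces and cuts
≟-sym : ∀ {n} (i j : Fin n) → ⌊ i ≟ j ⌋ ≡ ⌊ j ≟ i ⌋
≟-sym i j with i ≟ j | j ≟ i
... | yes _ | yes _ = refl
... | no _  | no _  = refl
... | yes p | no ¬q = contradiction (sym p) ¬q
... | no ¬p | yes q = contradiction (sym q) ¬p

Unique-↭ : ∀ {A : Set} {xs ys : List A} → Unique xs → Unique ys → (∀ {x} → x ∈ xs → x ∈ ys) → (∀ {x} → x ∈ ys → x ∈ xs) → xs ↭ ys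
Unique-↭ {xs = []} {[]}     _ _ _ _ = refl
Unique-↭ {xs = []} {y ∷ ys} _ _ _ back with back (here refl)
... | ()
Unique-↭ {xs = x ∷ xs} {ys} (x∉ ∷ u) v sub back with ∈-split (sub (here refl))
... | zs , perm with Unique-resp-↭ perm v
...   | x∉zs ∷ uzs = ↭-trans (prep x (Unique-↭ u uzs sub' back')) (↭-sym perm)
  where
  sub' : ∀ {y} → y ∈ xs → y ∈ zs
  sub' y∈ with ∈-resp-↭ perm (sub (there y∈))
  ... | here refl = contradiction refl (All.lookup x∉ y∈)
  ... | there p   = p
  back' : ∀ {y} → y ∈ zs → y ∈ xs
  back' y∈ with back (∈-resp-↭ (↭-sym perm) (there y∈))
  ... | here refl = contradiction refl (All.lookup x∉zs y∈)
  ... | there p   = p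

iter-+ : ∀ {A : Set} (f : A → A) i j x → iter (i + j) f x ≡ iter i f (iter j f x)
iter-+ f zero    j x = refl
iter-+ f (suc i) j x = cong f (iter-+ f i j x)

iter-comm : ∀ {A : Set} (f : A → A) i x → iter i f (f x) ≡ f (iter i f x)
iter-comm f zero    x = refl
iter-comm f (suc i) x = cong f (iter-comm f i x)

iter-injective : ∀ {A : Set} {f : A → A} → (∀ {x y} → f x ≡ f y → x ≡ y) → ∀ i {x y} → iter i f x ≡ iter i f y → x ≡ y
iter-injective inj zero    eq = eq
iter-injective inj (suc i) eq = iter-injective inj i (inj eq)

least : ∀ {P : ℕ → Set} → (∀ k → Dec (P k)) → ∀ k → P k → ∃[ j ] (P j × (∀ i → i < j → ¬ P i))
least P? zero    p = 0 , p , λ _ ()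
least {P} P? (suc k) p with P? 0
... | yes p₀ = 0 , p₀ , λ _ ()
... | no ¬p₀ with least (λ i → P? (suc i)) k p
...   | j , pj , min = suc j , pj , λ { zero _ → ¬p₀ ; (suc i) (s≤s lt) → min i lt }

dartList : ∀ m → List (Dart m)
dartList m = map (_, false) (allFin m) ++ map (_, true) (allFin m)

dartList! : ∀ m → Unique (dartList m)
dartList! m = Uniqueₚ.++⁺ (Uniqueₚ.map⁺ (λ { refl → refl }) (Uniqueₚ.allFin⁺ m)) (Uniqueₚ.map⁺ (λ { refl → refl }) (Uniqueₚ.allFin⁺ m)) disj
  where
  disj : ∀ {d} → ¬ (d ∈ map (_, false) (allFin m) × d ∈ map (_, true) (allFin m))
  disj (p , q) with ∈-map⁻ (_, false) p | ∈-map⁻ (_, true) q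
  ... | _ , _ , refl | _ , _ , ()

∈-dartList : ∀ {m} (d : Dart m) → d ∈ dartList m
∈-dartList (e , false) = ∈-++⁺ˡ (∈-map⁺ (_, false) (∈-allFin e))
∈-dartList {m} (e , true) = ∈-++⁺ʳ (map (_, false) (allFin m)) (∈-map⁺ (_, true) (∈-allFin e))

B∑-darts : ∀ m (f : Dart m → Bool) → B.∑ (dartList m) f ≡ B.∑ (allFin m) (λ e → f (e , false) xor f (e , true))
B∑-darts m f = ≡-trans (B.∑-++ (map (_, false) (allFin m)) _ f)
  (≡-trans (cong₂ _xor_ (B.∑-map (_, false) (allFin m) f) (B.∑-map (_, true) (allFin m) f)) (sym (B.∑-+ (allFin m) _ _)))

N∑-darts : ∀ m (f : Dart m → ℕ) → N.∑ (dartList m) f ≡ N.∑ (allFin m) (λ e → f (e , false) + f (e , true))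
N∑-darts m f = ≡-trans (N.∑-++ (map (_, false) (allFin m)) _ f)
  (≡-trans (cong₂ _+_ (N.∑-map (_, false) (allFin m) f) (N.∑-map (_, true) (allFin m) f)) (sym (N.∑-+ (allFin m) _ _)))

B∑-↑ : ∀ n f (g : Fin (n + f) → Bool) →
  B.∑ (allFin (n + f)) g ≡ B.∑ (allFin n) (λ i → g (i ↑ˡ f)) xor B.∑ (allFin f) (λ i → g (n ↑ʳ i))
B∑-↑ zero    f g = refl
B∑-↑ (suc n) f g = ≡-trans (B.∑-suc g) (≡-trans (cong (g zero xor_) (B∑-↑ n f (λ i → g (suc i))))
  (≡-trans (sym (xor-assoc (g zero) (B.∑ (allFin n) (λ i → g (suc i ↑ˡ f))) (B.∑ (allFin f) (λ i → g (suc n ↑ʳ i)))))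
    (cong (_xor B.∑ (allFin f) (λ i → g (suc n ↑ʳ i))) (sym (B.∑-suc (λ i → g (i ↑ˡ f)))))))

xor-∑-pick : ∀ {n} (i : Fin n) (f : Fin n → Bool) → B.∑ (allFin n) (λ j → f j ∧ ⌊ j ≟ i ⌋) ≡ f i
xor-∑-pick {n} i f = ≡-trans (B.∑-cong (allFin n) (λ j → pick (f j) ⌊ j ≟ i ⌋)) (B.∑-pick _≟_ (allFin n) i f (Uniqueₚ.allFin⁺ n) (∈-allFin i))
  where
  pick : ∀ a b → a ∧ b ≡ (if b then a else false)
  pick true  true  = refl
  pick true  false = refl
  pick false true  = refl
  pick false false = refl

module Plane {n m : ℕ} (G : PlaneGraph n m) where
  open PlaneGraph G public

  rev-rev : ∀ d → rev (rev d) ≡ d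
  rev-rev (e , false) = refl
  rev-rev (e , true)  = refl

  φ-rev : ∀ d → φ (rev d) ≡ σ d
  φ-rev d = cong σ (rev-rev d)

  φ-injective : ∀ {d d'} → φ d ≡ φ d' → d ≡ d'
  φ-injective {d} {d'} eq = ≡-trans (sym (rev-rev d)) (≡-trans (cong rev (≡-trans (sym (σ-inv₂ (rev d))) (≡-trans (cong σ⁻¹ eq) (σ-inv₂ (rev d'))))) (rev-rev d'))

  _≟D_ : DecidableEquality (Dart m)
  _≟D_ = ≡-dec _≟_ Data.Bool._≟_

  returns : ∀ d → ∃[ k ] iter (suc k) φ d ≡ d
  returns d with pigeonhole (n<1+n (length (dartList m))) (λ i → Any.index (∈-dartList (iter (toℕ i) φ d)))
  ... | i , j , i<j , eq = toℕ j ∸ suc (toℕ i) , sym (iter-injective φ-injective (toℕ i) (begin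
      iter (toℕ i) φ d   ≡⟨ index-injective (∈-dartList _) (∈-dartList _) eq ⟩
      iter (toℕ j) φ d   ≡⟨ cong (λ k → iter k φ d) (sym (≡-trans (+-suc (toℕ i) _) (m+[n∸m]≡n i<j))) ⟩
      iter (toℕ i + suc (toℕ j ∸ suc (toℕ i))) φ d ≡⟨ iter-+ φ (toℕ i) _ d ⟩
      iter (toℕ i) φ (iter (suc (toℕ j ∸ suc (toℕ i))) φ d) ∎))
    where
    open ≡-Reasoning
    index-injective : ∀ {A : Set} {x y : A} {xs} (p : x ∈ xs) (q : y ∈ xs) → Any.index p ≡ Any.index q → x ≡ y
    index-injective (here refl) (here refl) _  = refl
    index-injective (there p)   (there q)   eq = index-injective p q (Data.Fin.Properties.suc-injective eq)
      where import Data.Fin.Properties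

  sameFace-sym : ∀ {d d'} → SameFace d d' → SameFace d' d
  sameFace-sym {d} (zero  , refl) = 0 , refl
  sameFace-sym {d} (suc k , refl) with returns (iter k φ d) | sameFace-sym {d} {iter k φ d} (k , refl)
  ... | j , eq | l , eq' = l + j , ≡-trans (iter-+ φ l j _) (≡-trans (cong (iter l φ) (≡-trans (iter-comm φ j _) eq)) eq')

  sameFace-trans : ∀ {d d' d''} → SameFace d d' → SameFace d' d'' → SameFace d d''
  sameFace-trans {d} (k , refl) (l , refl) = l + k , iter-+ φ l k d

  faceOf : Dart m → Fin numFaces
  faceOf d = proj₁ (rep-surj d)

  faceOf-sameFace : ∀ {d d'} → SameFace d d' → faceOf d ≡ faceOf d'
  faceOf-sameFace {d} {d'} s = rep-inj _ _ (sameFace-trans (proj₂ (rep-surj d)) (sameFace-trans s (sameFace-sym (proj₂ (rep-surj d')))))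

  sameFace-faceOf : ∀ {d d'} → faceOf d ≡ faceOf d' → SameFace d d'
  sameFace-faceOf {d} {d'} eq = sameFace-trans (sameFace-sym (proj₂ (rep-surj d))) (subst (λ i → SameFace (faceRep i) d') (sym eq) (proj₂ (rep-surj d')))

  faceOf-rep : ∀ i → faceOf (faceRep i) ≡ i
  faceOf-rep i = rep-inj _ _ (proj₂ (rep-surj (faceRep i)))

  cut : (Fin n → Bool) → Fin m → Bool
  cut S e = crosses S (ends e)

  cut-ends : ∀ S d → cut S (proj₁ d) ≡ S (tail d) xor S (head d)
  cut-ends S (e , false) = refl
  cut-ends S (e , true)  = xor-comm (S (tail (e , false))) _

  -- When `A` is a union of faces, this is its boundary modulo 2.
  bd : (Dart m → Bool) → Fin m → Bool
  bd A e = A (e , false) xor A (e , true)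

  -- Around a vertex the faces on the two sides of consecutive darts agree, so face boundaries
  -- meet every cut evenly.
  boundary-⊥-cut : ∀ A → (∀ d → A (φ d) ≡ A d) → ∀ S → B.∑ (allFin m) (λ e → bd A e ∧ cut S e) ≡ false
  boundary-⊥-cut A inv S = begin
    B.∑ (allFin m) (λ e → bd A e ∧ cut S e)
      ≡⟨ B.∑-cong (allFin m) (λ e → point (A (e , false)) (A (e , true)) (S (tail (e , false))) (S (tail (e , true)))) ⟩
    B.∑ (allFin m) (λ e → h (e , false) xor h (e , true))
      ≡⟨ sym (B∑-darts m h) ⟩
    B.∑ (dartList m) h
      ≡⟨ B.∑-cong (dartList m) (λ d → ≡-trans (∧-distribʳ-xor (S (tail d)) (A d) (A (rev d)))
           (cong (g d xor_) (cong₂ _∧_ (≡-trans (sym (inv (rev d))) (cong A (φ-rev d))) (cong S (sym (σ-tail d)))))) ⟩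
    B.∑ (dartList m) (λ d → g d xor g (σ d))
      ≡⟨ B.∑-+ (dartList m) g (g ∘ σ) ⟩
    B.∑ (dartList m) g xor B.∑ (dartList m) (g ∘ σ)
      ≡⟨ cong (B.∑ (dartList m) g xor_) (≡-trans (sym (B.∑-map σ (dartList m) g)) (B.∑-↭ g σ-perm)) ⟩
    B.∑ (dartList m) g xor B.∑ (dartList m) g
      ≡⟨ xor-same (B.∑ (dartList m) g) ⟩
    false ∎
    where
    open ≡-Reasoning
    g h : Dart m → Bool
    g d = A d ∧ S (tail d)
    h d = (A d xor A (rev d)) ∧ S (tail d)
    point : ∀ a b s t → (a xor b) ∧ (s xor t) ≡ ((a xor b) ∧ s) xor ((b xor a) ∧ t)
    point true  true  s t = refl
    point true  false s t = refl
    point false true  s t = refl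
    point false false s t = refl
    σ-injective : ∀ {d d'} → σ d ≡ σ d' → d ≡ d'
    σ-injective {d} {d'} eq = ≡-trans (sym (σ-inv₂ d)) (≡-trans (cong σ⁻¹ eq) (σ-inv₂ d'))
    σ-perm : map σ (dartList m) ↭ dartList m
    σ-perm = Unique-↭ (Uniqueₚ.map⁺ σ-injective (dartList! m)) (dartList! m) (λ _ → ∈-dartList _)
      (λ {d} _ → subst (_∈ map σ (dartList m)) (σ-inv₁ d) (∈-map⁺ σ (∈-dartList (σ⁻¹ d))))

  walk-cut : ∀ {u ds v} → Walk u ds v → ∀ S → B.∑ ds (λ d → cut S (proj₁ d)) ≡ S u xor S v
  walk-cut {u} nil S = sym (xor-same (S u))
  walk-cut {u} {d ∷ ds} {v} (cons refl w) S = ≡-trans (cong₂ _xor_ (cut-ends S d) (walk-cut w S)) (xor-cross (S (tail d)) (S (head d)) (S v))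

  -- Connectedness of the dual: `σ d` lies on the face of `rev d`, so `β` is constant around each
  -- vertex and then along each walk.
  constant-on-darts : ∀ (β : Dart m → Bool) → (∀ d → β (φ d) ≡ β d) → (∀ e → β (e , false) ≡ β (e , true)) → ∀ d d' → β d ≡ β d'
  constant-on-darts β inv edge d d' = along (proj₂ (connected (tail d) (tail d'))) refl refl
    where
    β-rev : ∀ d → β (rev d) ≡ β d
    β-rev (e , false) = sym (edge e)
    β-rev (e , true)  = edge e
    β-σ : ∀ d → β (σ d) ≡ β d
    β-σ d = ≡-trans (cong β (sym (φ-rev d))) (≡-trans (inv (rev d)) (β-rev d))
    β-iter : ∀ k d → β (iter k σ d) ≡ β d
    β-iter zero    d = refl
    β-iter (suc k) d = ≡-trans (β-σ _) (β-iter k d)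
    at-vertex : ∀ {d d'} → tail d ≡ tail d' → β d ≡ β d'
    at-vertex {d} {d'} eq = let (k , p) = σ-cyclic d d' eq in ≡-trans (sym (β-iter k d)) (cong β p)
    along : ∀ {u ds v} → Walk u ds v → ∀ {d d'} → tail d ≡ u → tail d' ≡ v → β d ≡ β d'
    along nil p q = at-vertex (≡-trans p (sym q))
    along (cons {d = d₁} refl w) p q = ≡-trans (at-vertex p) (≡-trans (sym (β-rev d₁)) (along w refl q))

-- Edge sets orthogonal to all face boundaries are cuts
module EvenCut {n m : ℕ} (G : PlaneGraph n m) where
  open Plane G

  -- Euler's formula makes the face boundaries span all closed walks: the n + f + 1 vectors
  -- consisting of walks from a root to each vertex, all face boundaries and one closed walk y
  -- satisfy m + 2 equations nontrivially, and such a relation can only involve y if x ⟂ y.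
  module Relation (x : Fin m → Bool) (x-even : ∀ (β : Fin numFaces → Bool) → B.∑ (allFin m) (λ e → x e ∧ bd (β ∘ faceOf) e) ≡ false)
                  (root : Fin n) (f₀ : Fin numFaces) (eul : n + numFaces ≡ m + 2) where
    walk : Fin n → List (Dart m)
    walk v = proj₁ (connected root v)

    -- The potential of `x` from `root`: if `x` is a cut at all, it is the cut of this set.
    S : Fin n → Bool
    S v = B.∑ (walk v) (x ∘ proj₁)

    chi : List (Dart m) → Fin m → Bool
    chi ds e = B.∑ ds (λ d → ⌊ e ≟ proj₁ d ⌋)

    chi-dot : ∀ (g : Fin m → Bool) ds → B.∑ (allFin m) (λ e → g e ∧ chi ds e) ≡ B.∑ ds (g ∘ proj₁)
    chi-dot g ds = begin
      B.∑ (allFin m) (λ e → g e ∧ chi ds e)                            ≡⟨ B.∑-cong (allFin m) (λ e → sym (B.∑-*ˡ ds (g e) _)) ⟩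
      B.∑ (allFin m) (λ e → B.∑ ds (λ d → g e ∧ ⌊ e ≟ proj₁ d ⌋))      ≡⟨ B.∑-swap (allFin m) ds _ ⟩
      B.∑ ds (λ d → B.∑ (allFin m) (λ e → g e ∧ ⌊ e ≟ proj₁ d ⌋))      ≡⟨ B.∑-cong ds (λ d → xor-∑-pick (proj₁ d) g) ⟩
      B.∑ ds (g ∘ proj₁) ∎
      where open ≡-Reasoning

    module Closed (e₀ : Fin m) where
      u₀ v₀ : Fin n
      u₀ = tail (e₀ , false)
      v₀ = tail (e₀ , true)

      -- The closed walk from `root` over `e₀` and back, with directions ignored as everything is
      -- modulo 2.
      ys : List (Dart m)
      ys = (e₀ , false) ∷ walk u₀ ++ walk v₀

      ys-dot : ∀ g → B.∑ ys (g ∘ proj₁) ≡ g e₀ xor (B.∑ (walk u₀) (g ∘ proj₁) xor B.∑ (walk v₀) (g ∘ proj₁))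
      ys-dot g = cong (g e₀ xor_) (B.∑-++ (walk u₀) (walk v₀) (g ∘ proj₁))

      ys-closed : ∀ T → B.∑ ys (cut T ∘ proj₁) ≡ false
      ys-closed T = ≡-trans (ys-dot (cut T)) (≡-trans (cong (cut T e₀ xor_) (cong₂ _xor_ (walk-cut (proj₂ (connected root u₀)) T) (walk-cut (proj₂ (connected root v₀)) T)))
        (table (T root) (T u₀) (T v₀)))
        where
        table : ∀ r a b → (a xor b) xor ((r xor a) xor (r xor b)) ≡ false
        table true  true  true  = refl
        table true  true  false = refl
        table true  false true  = refl
        table true  false false = refl
        table false true  true  = refl
        table false true  false = refl
        table false false true  = refl
        table false false false = refl

      N' M' : ℕ
      N' = suc (n + numFaces)
      M' = m + 2

      faceCol : Fin m → Fin numFaces → Bool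
      faceCol e F = ⌊ F ≟ faceOf (e , false) ⌋ xor ⌊ F ≟ faceOf (e , true) ⌋

      -- One equation per edge says that the combination vanishes there. The two others normalise:
      -- the walk to `root` and the face `f₀` get coefficient 0. The latter removes the trivial
      -- relation that all face boundaries sum to 0.
      row : Fin m ⊎ Fin 2 → Fin N' → Bool
      row (inj₁ e) zero    = chi ys e
      row (inj₁ e) (suc j) = [ (λ v → chi (walk v) e) , faceCol e ]′ (splitAt n j)
      row (inj₂ _) zero    = false
      row (inj₂ zero) (suc j)    = [ (λ v → ⌊ v ≟ root ⌋) , (λ _ → false) ]′ (splitAt n j)
      row (inj₂ (suc _)) (suc j) = [ (λ _ → false) , (λ F → ⌊ F ≟ f₀ ⌋) ]′ (splitAt n j)

      module Solved (ξ : Fin N' → Bool) (sol : ∀ i → B.∑ (allFin N') (λ j → row (splitAt m i) j ∧ ξ j) ≡ false)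
                    (odd : S u₀ xor S v₀ ≢ x e₀) where
        η : Bool
        η = ξ zero
        ζ : Fin n → Bool
        ζ v = ξ (suc (v ↑ˡ numFaces))
        β : Fin numFaces → Bool
        β F = ξ (suc (n ↑ʳ F))

        expand : ∀ (r₀ : Bool) (rv : Fin n → Bool) (rF : Fin numFaces → Bool) (r : Fin N' → Bool) →
          r zero ≡ r₀ → (∀ j → r (suc j) ≡ [ rv , rF ]′ (splitAt n j)) →
          B.∑ (allFin N') (λ j → r j ∧ ξ j) ≡ (r₀ ∧ η) xor (B.∑ (allFin n) (λ v → ζ v ∧ rv v) xor B.∑ (allFin numFaces) (λ F → β F ∧ rF F))
        expand r₀ rv rF r refl h = ≡-trans (B.∑-suc (λ j → r j ∧ ξ j)) (cong ((r₀ ∧ η) xor_)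
          (≡-trans (B∑-↑ n numFaces (λ j → r (suc j) ∧ ξ (suc j))) (cong₂ _xor_
            (B.∑-cong (allFin n) (λ v → ≡-trans (cong (_∧ ζ v) (≡-trans (h _) (cong [ rv , rF ]′ (splitAt-↑ˡ n v numFaces)))) (∧-comm (rv v) (ζ v))))
            (B.∑-cong (allFin numFaces) (λ F → ≡-trans (cong (_∧ β F) (≡-trans (h _) (cong [ rv , rF ]′ (splitAt-↑ʳ n numFaces F)))) (∧-comm (rF F) (β F)))))))

        sol' : ∀ s → B.∑ (allFin N') (λ j → row s j ∧ ξ j) ≡ false
        sol' s = ≡-trans (cong (λ z → B.∑ (allFin N') (λ j → row z j ∧ ξ j)) (sym (splitAt-join m 2 s))) (sol (join m 2 s))

        edge-eq : ∀ e → (chi ys e ∧ η) xor (B.∑ (allFin n) (λ v → ζ v ∧ chi (walk v) e) xor bd (β ∘ faceOf) e) ≡ false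
        edge-eq e = ≡-trans (cong (λ z → (chi ys e ∧ η) xor (B.∑ (allFin n) (λ v → ζ v ∧ chi (walk v) e) xor z)) (sym faces))
          (≡-trans (sym (expand (chi ys e) (λ v → chi (walk v) e) (faceCol e) (row (inj₁ e)) refl (λ j → refl))) (sol' (inj₁ e)))
          where
          faces : B.∑ (allFin numFaces) (λ F → β F ∧ faceCol e F) ≡ bd (β ∘ faceOf) e
          faces = ≡-trans (B.∑-cong (allFin numFaces) (λ F → ∧-distribˡ-xor (β F) ⌊ F ≟ faceOf (e , false) ⌋ ⌊ F ≟ faceOf (e , true) ⌋))
            (≡-trans (B.∑-+ (allFin numFaces) _ _) (cong₂ _xor_ (xor-∑-pick (faceOf (e , false)) β) (xor-∑-pick (faceOf (e , true)) β)))

        -- The relation evaluated against an edge function `g`; suitable choices of `g` isolate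
        -- single coefficients.
        paired : ∀ g → (B.∑ ys (g ∘ proj₁) ∧ η) xor (B.∑ (allFin n) (λ v → ζ v ∧ B.∑ (walk v) (g ∘ proj₁)) xor B.∑ (allFin m) (λ e → g e ∧ bd (β ∘ faceOf) e)) ≡ false
        paired g = begin
          (B.∑ ys (g ∘ proj₁) ∧ η) xor (B.∑ (allFin n) (λ v → ζ v ∧ B.∑ (walk v) (g ∘ proj₁)) xor B.∑ (allFin m) (λ e → g e ∧ bd (β ∘ faceOf) e))
            ≡⟨ cong₂ _xor_ first (cong (_xor B.∑ (allFin m) (λ e → g e ∧ bd (β ∘ faceOf) e)) second) ⟩
          B.∑ (allFin m) f₁ xor (B.∑ (allFin m) f₂ xor B.∑ (allFin m) f₃)
            ≡⟨ cong (B.∑ (allFin m) f₁ xor_) (sym (B.∑-+ (allFin m) f₂ f₃)) ⟩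
          B.∑ (allFin m) f₁ xor B.∑ (allFin m) (λ e → f₂ e xor f₃ e)
            ≡⟨ sym (B.∑-+ (allFin m) f₁ _) ⟩
          B.∑ (allFin m) (λ e → f₁ e xor (f₂ e xor f₃ e))
            ≡⟨ B.∑-cong (allFin m) (λ e → ≡-trans (factor (g e) (chi ys e ∧ η) (Y e) (bd (β ∘ faceOf) e)) (≡-trans (cong (g e ∧_) (edge-eq e)) (∧-zeroʳ (g e)))) ⟩
          B.∑ (allFin m) (λ _ → false)
            ≡⟨ B.∑-0 (allFin m) ⟩
          false ∎
          where
          open ≡-Reasoning
          Y : Fin m → Bool
          Y e = B.∑ (allFin n) (λ v → ζ v ∧ chi (walk v) e)
          f₁ f₂ f₃ : Fin m → Bool
          f₁ e = g e ∧ (chi ys e ∧ η)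
          f₂ e = g e ∧ Y e
          f₃ e = g e ∧ bd (β ∘ faceOf) e
          factor : ∀ a b c d → (a ∧ b) xor ((a ∧ c) xor (a ∧ d)) ≡ a ∧ (b xor (c xor d))
          factor true  b c d = refl
          factor false b c d = refl
          ∧-assoc' : ∀ a b c → (a ∧ b) ∧ c ≡ a ∧ (b ∧ c)
          ∧-assoc' true  b c = refl
          ∧-assoc' false b c = refl
          ∧-left : ∀ a b c → a ∧ (b ∧ c) ≡ b ∧ (a ∧ c)
          ∧-left true  b c = refl
          ∧-left false true  c = refl
          ∧-left false false c = refl
          first : B.∑ ys (g ∘ proj₁) ∧ η ≡ B.∑ (allFin m) f₁
          first = ≡-trans (cong (_∧ η) (sym (chi-dot g ys))) (≡-trans (sym (B.∑-*ʳ (allFin m) η _)) (B.∑-cong (allFin m) (λ e → ∧-assoc' (g e) (chi ys e) η)))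
          second : B.∑ (allFin n) (λ v → ζ v ∧ B.∑ (walk v) (g ∘ proj₁)) ≡ B.∑ (allFin m) f₂
          second = ≡-trans (B.∑-cong (allFin n) (λ v → ≡-trans (cong (ζ v ∧_) (sym (chi-dot g (walk v)))) (≡-trans (sym (B.∑-*ˡ (allFin m) (ζ v) _))
              (B.∑-cong (allFin m) (λ e → ∧-left (ζ v) (g e) (chi (walk v) e))))))
            (≡-trans (B.∑-swap (allFin n) (allFin m) _) (B.∑-cong (allFin m) (λ e → B.∑-*ˡ (allFin n) (g e) _)))

        ζ-root : ζ root ≡ false
        ζ-root = ≡-trans (sym (≡-trans (cong₂ _xor_ (xor-∑-pick root ζ) (≡-trans (B.∑-cong (allFin numFaces) (λ F → ∧-zeroʳ (β F))) (B.∑-0 (allFin numFaces)))) (xor-identityʳ _)))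
          (≡-trans (sym (expand false (λ v → ⌊ v ≟ root ⌋) (λ _ → false) (row (inj₂ zero)) refl (λ j → refl))) (sol' (inj₂ zero)))

        β-f₀ : β f₀ ≡ false
        β-f₀ = ≡-trans (sym (≡-trans (cong₂ _xor_ (≡-trans (B.∑-cong (allFin n) (λ v → ∧-zeroʳ (ζ v))) (B.∑-0 (allFin n))) (xor-∑-pick f₀ β)) refl))
          (≡-trans (sym (expand false (λ _ → false) (λ F → ⌊ F ≟ f₀ ⌋) (row (inj₂ (suc zero))) refl (λ j → refl))) (sol' (inj₂ (suc zero))))

        -- Pairing with the cut around `v`: closed walks and face boundaries meet it evenly, and
        -- among the chosen walks only the one ending at `v` meets it oddly.
        ζ≡0 : ∀ v → ζ v ≡ false
        ζ≡0 v with v ≟ root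
        ... | yes refl = ζ-root
        ... | no v≢root = begin
          ζ v
            ≡⟨ sym (xor-∑-pick v ζ) ⟩
          B.∑ (allFin n) (λ j → ζ j ∧ T j)
            ≡⟨ B.∑-cong (allFin n) (λ j → cong (ζ j ∧_) (sym (≡-trans (walk-cut (proj₂ (connected root j)) T) (cong (_xor T j) T-root)))) ⟩
          B.∑ (allFin n) (λ j → ζ j ∧ B.∑ (walk j) (cut T ∘ proj₁))
            ≡⟨ sym (≡-trans (cong₂ (λ p q → (p ∧ η) xor (B.∑ (allFin n) (λ j → ζ j ∧ B.∑ (walk j) (cut T ∘ proj₁)) xor q)) (ys-closed T) boundary) (xor-identityʳ _)) ⟩
          (B.∑ ys (cut T ∘ proj₁) ∧ η) xor (B.∑ (allFin n) (λ j → ζ j ∧ B.∑ (walk j) (cut T ∘ proj₁)) xor B.∑ (allFin m) (λ e → cut T e ∧ bd (β ∘ faceOf) e))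
            ≡⟨ paired (cut T) ⟩
          false ∎
          where
          open ≡-Reasoning
          T : Fin n → Bool
          T j = ⌊ j ≟ v ⌋
          T-root : T root ≡ false
          T-root with root ≟ v
          ... | yes p = contradiction (sym p) v≢root
          ... | no _  = refl
          boundary : B.∑ (allFin m) (λ e → cut T e ∧ bd (β ∘ faceOf) e) ≡ false
          boundary = ≡-trans (B.∑-cong (allFin m) (λ e → ∧-comm (cut T e) _)) (boundary-⊥-cut (β ∘ faceOf) (λ d → cong β (sym (faceOf-sameFace (1 , refl)))) T)

        ζ-sum≡0 : ∀ (g : Fin n → Bool) → B.∑ (allFin n) (λ v → ζ v ∧ g v) ≡ false
        ζ-sum≡0 g = ≡-trans (B.∑-cong (allFin n) (λ v → cong (_∧ g v) (ζ≡0 v))) (B.∑-0 (allFin n))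

        -- Pairing with `x`: the walks are gone, `x` is orthogonal to the face boundaries, and it is
        -- odd on `ys`.
        η≡0 : η ≡ false
        η≡0 = ≡-trans (cong (_∧ η) (sym x-odd)) (≡-trans (sym (xor-identityʳ _)) (≡-trans (cong ((B.∑ ys (x ∘ proj₁) ∧ η) xor_) (sym (cong₂ _xor_ (ζ-sum≡0 _) (x-even β)))) (paired x)))
          where
          flip : ∀ {a b c} → b xor c ≢ a → a xor (b xor c) ≡ true
          flip {true}  {true}  {true}  ne = refl
          flip {true}  {true}  {false} ne = contradiction refl ne
          flip {true}  {false} {true}  ne = contradiction refl ne
          flip {true}  {false} {false} ne = refl
          flip {false} ne = ¬-not ne
          x-odd : B.∑ ys (x ∘ proj₁) ≡ true
          x-odd = ≡-trans (ys-dot x) (flip {x e₀} {S u₀} {S v₀} odd)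

        -- Only face boundaries remain, so `β` agrees on both sides of every edge; it is constant,
        -- and 0 at `f₀`.
        β≡0 : ∀ F → β F ≡ false
        β≡0 F = ≡-trans (cong β (sym (faceOf-rep F))) (≡-trans (constant-on-darts (β ∘ faceOf) (λ d → cong β (sym (faceOf-sameFace (1 , refl)))) edge (faceRep F) (faceRep f₀)) (≡-trans (cong β (faceOf-rep f₀)) β-f₀))
          where
          edge : ∀ e → β (faceOf (e , false)) ≡ β (faceOf (e , true))
          edge e = xor≡false (≡-trans (sym (≡-trans (cong₂ (λ p q → p xor (q xor bd (β ∘ faceOf) e)) (≡-trans (cong (chi ys e ∧_) η≡0) (∧-zeroʳ (chi ys e))) (ζ-sum≡0 _)) refl)) (edge-eq e))

        ξ≡0 : ∀ j → ξ j ≡ false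
        ξ≡0 zero    = η≡0
        ξ≡0 (suc j) = subst (λ z → ξ (suc z) ≡ false) (join-splitAt n numFaces j) (by (splitAt n j))
          where
          by : ∀ s → ξ (suc (join n numFaces s)) ≡ false
          by (inj₁ v) = ζ≡0 v
          by (inj₂ F) = β≡0 F

      S-edge : S u₀ xor S v₀ ≡ x e₀
      S-edge with (S u₀ xor S v₀) Data.Bool.≟ x e₀
      ... | yes p = p
      -- By Euler's formula there are `m + 3` unknowns for `m + 2` equations.
      ... | no ¬p = contradict (kernel-nontrivial {N'} {M'} (s≤s (≤-reflexive (sym eul))) (λ i → row (splitAt m i)))
        where
        contradict : ∃[ ξ ] ((∀ i → B.∑ (allFin N') (λ j → row (splitAt m i) j ∧ ξ j) ≡ false) × ∃[ j ] ξ j ≡ true) → S u₀ xor S v₀ ≡ x e₀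
        contradict (ξ , sol , j , ξj) = contradiction (≡-trans (sym ξj) (Solved.ξ≡0 ξ sol ¬p j)) λ ()

  even-is-cut : ∀ x → (∀ (β : Fin numFaces → Bool) → B.∑ (allFin m) (λ e → x e ∧ bd (β ∘ faceOf) e) ≡ false) → ∃[ S ] (∀ e → x e ≡ cut S e)
  even-is-cut x x-even with Data.Fin.Properties.any? {n = m} (λ _ → yes tt)
    where import Data.Fin.Properties
  ... | no none = (λ _ → false) , λ e → contradiction (e , tt) none
  ... | yes (e₀ , _) with euler
  ...   | inj₂ eul = Rel.S , λ e → sym (Rel.Closed.S-edge e)
    where module Rel = Relation x x-even (tail (e₀ , false)) (faceOf (e₀ , false)) eul
  ...   | inj₁ m≡0 = (λ _ → false) , λ e → contradiction (subst Fin m≡0 e) λ ()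

-- Decomposing a cut into central cuts
oddℕ-bit : ∀ b → oddℕ (bit b) ≡ b
oddℕ-bit true  = refl
oddℕ-bit false = refl

oddℕ-+ : ∀ i j → oddℕ (i + j) ≡ oddℕ i xor oddℕ j
oddℕ-+ zero    j = refl
oddℕ-+ (suc i) j = ≡-trans (cong not (oddℕ-+ i j)) (not-distribˡ-xor (oddℕ i) (oddℕ j))

oddℕ-∑ : ∀ {A : Set} (xs : List A) (f : A → Bool) → oddℕ (N.∑ xs (bit ∘ f)) ≡ B.∑ xs f
oddℕ-∑ []       f = refl
oddℕ-∑ (x ∷ xs) f = ≡-trans (oddℕ-+ (bit (f x)) _) (cong₂ _xor_ (oddℕ-bit (f x)) (oddℕ-∑ xs f))

count : ∀ {m} → List (Fin m) → Fin m → ℕ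
count L e = N.∑ L (λ e' → bit ⌊ e ≟ e' ⌋)

∑-count : ∀ {m} (L : List (Fin m)) (g : Fin m → ℕ) → N.∑ (allFin m) (λ e → g e * count L e) ≡ N.∑ L g
∑-count {m} L g = begin
  N.∑ (allFin m) (λ e → g e * count L e)                                ≡⟨ N.∑-cong (allFin m) (λ e → sym (N.∑-*ˡ L (g e) _)) ⟩
  N.∑ (allFin m) (λ e → N.∑ L (λ e' → g e * bit ⌊ e ≟ e' ⌋))           ≡⟨ N.∑-swap (allFin m) L _ ⟩
  N.∑ L (λ e' → N.∑ (allFin m) (λ e → g e * bit ⌊ e ≟ e' ⌋))           ≡⟨ N.∑-cong L (λ e' → N.∑-cong (allFin m) (λ e → pick (g e) ⌊ e ≟ e' ⌋)) ⟩
  N.∑ L (λ e' → N.∑ (allFin m) (λ e → if ⌊ e ≟ e' ⌋ then g e else 0))  ≡⟨ N.∑-cong L (λ e' → N.∑-pick _≟_ (allFin m) e' g (Uniqueₚ.allFin⁺ m) (∈-allFin e')) ⟩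
  N.∑ L g ∎
  where
  open ≡-Reasoning
  pick : ∀ a b → a * bit b ≡ (if b then a else 0)
  pick a true  = *-identityʳ a
  pick a false = *-zeroʳ a

B∑-count : ∀ {m} (L : List (Fin m)) (g : Fin m → Bool) → B.∑ (allFin m) (λ e → oddℕ (count L e) ∧ g e) ≡ B.∑ L g
B∑-count {m} L g = begin
  B.∑ (allFin m) (λ e → oddℕ (count L e) ∧ g e)                ≡⟨ B.∑-cong (allFin m) (λ e → ≡-trans (cong (_∧ g e) (oddℕ-∑ L (λ e' → ⌊ e ≟ e' ⌋)))
                                                                    (≡-trans (∧-comm (B.∑ L (λ e' → ⌊ e ≟ e' ⌋)) (g e)) (sym (B.∑-*ˡ L (g e) _)))) ⟩
  B.∑ (allFin m) (λ e → B.∑ L (λ e' → g e ∧ ⌊ e ≟ e' ⌋))       ≡⟨ B.∑-swap (allFin m) L _ ⟩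
  B.∑ L (λ e' → B.∑ (allFin m) (λ e → g e ∧ ⌊ e ≟ e' ⌋))       ≡⟨ B.∑-cong L (λ e' → xor-∑-pick e' g) ⟩
  B.∑ L g ∎
  where open ≡-Reasoning

count-∉ : ∀ {m} (L : List (Fin m)) {e} → e ∉ L → count L e ≡ 0
count-∉ []      e∉ = refl
count-∉ (x ∷ L) {e} e∉ with e ≟ x
... | yes p = contradiction (here p) e∉
... | no _  = count-∉ L (λ p → e∉ (there p))

count-unique : ∀ {m} {L : List (Fin m)} → Unique L → ∀ e → count L e ≡ bit (oddℕ (count L e))
count-unique {L = []}    u e = refl
count-unique {L = x ∷ L} (x∉ ∷ u) e with e ≟ x
... | no _     = count-unique u e
... | yes refl rewrite count-∉ L {e} (λ p → All.lookup x∉ p refl) = refl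

count-++ : ∀ {m} (L L' : List (Fin m)) e → count (L ++ L') e ≡ count L e + count L' e
count-++ L L' e = N.∑-++ L L' _

support : ∀ {m} → (Fin m → Bool) → List (Fin m)
support x = filter (λ e → x e Data.Bool.≟ true) (allFin _)

B∑-filter : ∀ {A : Set} (x : A → Bool) (g : A → Bool) (xs : List A) → B.∑ (filter (λ e → x e Data.Bool.≟ true) xs) g ≡ B.∑ xs (λ e → g e ∧ x e)
B∑-filter x g []       = refl
B∑-filter x g (y ∷ ys) with x y
... | true  = cong₂ _xor_ (sym (∧-identityʳ (g y))) (B∑-filter x g ys)
... | false = ≡-trans (B∑-filter x g ys) (cong (_xor B.∑ ys (λ e → g e ∧ x e)) (sym (∧-zeroʳ (g y))))

support! : ∀ {m} (x : Fin m → Bool) → Unique (support x)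
support! x = Uniqueₚ.filter⁺ _ (Uniqueₚ.allFin⁺ _)

count-support : ∀ {m} (x : Fin m → Bool) e → count (support x) e ≡ bit (x e)
count-support {m} x e = ≡-trans (count-unique (support! x) e) (cong bit (begin
  oddℕ (count (support x) e)                          ≡⟨ oddℕ-∑ (support x) (λ e' → ⌊ e ≟ e' ⌋) ⟩
  B.∑ (support x) (λ e' → ⌊ e ≟ e' ⌋)                 ≡⟨ B∑-filter x _ (allFin m) ⟩
  B.∑ (allFin m) (λ e' → ⌊ e ≟ e' ⌋ ∧ x e')           ≡⟨ B.∑-cong (allFin m) (λ e' → ≡-trans (∧-comm ⌊ e ≟ e' ⌋ (x e')) (cong (x e' ∧_) (≟-sym e e'))) ⟩
  B.∑ (allFin m) (λ e' → x e' ∧ ⌊ e' ≟ e ⌋)           ≡⟨ xor-∑-pick e x ⟩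
  x e ∎))
  where
  open ≡-Reasoning

-- Graphs take their vertices from ℕ, so a colouring of the faces is extended; the default `false`
-- is never met at a face number.
extend : ∀ {k} → (Fin k → Bool) → ℕ → Bool
extend {zero}  β i       = false
extend {suc k} β zero    = β zero
extend {suc k} β (suc i) = extend (λ j → β (suc j)) i

extend-toℕ : ∀ {k} (β : Fin k → Bool) i → extend β (toℕ i) ≡ β i
extend-toℕ β zero    = refl
extend-toℕ β (suc i) = extend-toℕ (λ j → β (suc j)) i

module CentralCuts {n m : ℕ} (G : PlaneGraph n m) where
  open Plane G public
  open EvenCut G public using (even-is-cut)

  faceℕ : Dart m → ℕ
  faceℕ d = toℕ (faceOf d)

  lo hi : Fin m → ℕ
  lo e = faceℕ (e , false)
  hi e = faceℕ (e , true)

  faceCross : Fin numFaces → (Fin n → Bool) → Dart m → ℕ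
  faceCross F S d = if ⌊ faceOf d ≟ F ⌋ then bit (cut S (proj₁ d)) else 0

  -- Crossings are counted by darts: an edge with the same face on both sides counts twice.
  Central : (Fin n → Bool) → Set
  Central S = ∀ F → N.∑ (dartList m) (faceCross F S) ≤ 2

  dual-even-cut : ∀ L → Graph.Even lo hi L → ∃[ S ] (∀ e → oddℕ (count L e) ≡ cut S e)
  dual-even-cut L eL = even-is-cut (λ e → oddℕ (count L e)) (λ β → ≡-trans (B∑-count L (bd (β ∘ faceOf)))
    (≡-trans (B.∑-cong L (λ e → sym (cong₂ _xor_ (extend-toℕ β (faceOf (e , false))) (extend-toℕ β (faceOf (e , true)))))) (eL (extend β))))

  cut-even : ∀ S A → B.∑ (allFin m) (λ e → Graph.cr lo hi A e ∧ cut S e) ≡ false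
  cut-even S A = boundary-⊥-cut (A ∘ faceℕ) (λ d → cong (A ∘ toℕ) (sym (faceOf-sameFace (1 , refl)))) S

  -- The degree of the dual vertex `F` in `C` is the number of darts of `F` whose edge is cut.
  circuit-central : ∀ {C S} → Graph.Circuit lo hi C → (∀ e → count C e ≡ bit (cut S e)) → Central S
  circuit-central {C} {S} (_ , deg) eq F = ≤-trans (≤-reflexive (begin
    N.∑ (dartList m) (faceCross F S)
      ≡⟨ N∑-darts m (faceCross F S) ⟩
    N.∑ (allFin m) (λ e → faceCross F S (e , false) + faceCross F S (e , true))
      ≡⟨ N.∑-cong (allFin m) (λ e → point (faceOf (e , false)) (faceOf (e , true)) (bit (cut S e))) ⟩
    N.∑ (allFin m) (λ e → Graph.inc lo hi (toℕ F) e * bit (cut S e))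
      ≡⟨ N.∑-cong (allFin m) (λ e → cong (Graph.inc lo hi (toℕ F) e *_) (sym (eq e))) ⟩
    N.∑ (allFin m) (λ e → Graph.inc lo hi (toℕ F) e * count C e)
      ≡⟨ ∑-count C _ ⟩
    N.∑ C (Graph.inc lo hi (toℕ F)) ∎)) (deg (toℕ F))
    where
    open ≡-Reasoning
    half : ∀ F' c → (if ⌊ F' ≟ F ⌋ then c else 0) ≡ bit (pt (toℕ F) (toℕ F')) * c
    half F' c with F' ≟ F | toℕ F' ℕ.≟ toℕ F
    ... | yes _ | yes _ = sym (*-identityˡ c)
    ... | no _  | no _  = refl
    ... | yes p | no ¬q = contradiction (cong toℕ p) ¬q
    ... | no ¬p | yes q = contradiction (toℕ-injective q) ¬p
    point : ∀ F₁ F₂ c → (if ⌊ F₁ ≟ F ⌋ then c else 0) + (if ⌊ F₂ ≟ F ⌋ then c else 0) ≡ (bit (pt (toℕ F) (toℕ F₁)) + bit (pt (toℕ F) (toℕ F₂))) * c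
    point F₁ F₂ c = ≡-trans (cong₂ _+_ (half F₁ c) (half F₂ c)) (sym (*-distribʳ-+ c (bit (pt (toℕ F) (toℕ F₁))) _))

  CutList : List (Fin m) → Set
  CutList L = Σ (List (Fin n → Bool)) λ Ss → All Central Ss × (∀ e → count L e ≡ N.∑ Ss (λ T → bit (cut T e)))

  circuit-cuts : ∀ Cs → Unique (concat Cs) → All (Graph.Circuit lo hi) Cs → CutList (concat Cs)
  circuit-cuts []       u []        = [] , [] , λ e → refl
  circuit-cuts (C ∷ Cs) u (cC ∷ cs) = add (circuit-cuts Cs (proj₁ (proj₂ u')) cs) (dual-even-cut C (proj₁ cC))
    where
    u' = Unique-++⁻ C u
    add : CutList (concat Cs) → ∃[ S ] (∀ e → oddℕ (count C e) ≡ cut S e) → CutList (C ++ concat Cs)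
    add (Ss , central , eq) (S , eqS) = S ∷ Ss , circuit-central {C} {S} cC eqC ∷ central ,
        λ e → ≡-trans (count-++ C (concat Cs) e) (cong₂ _+_ (eqC e) (eq e))
      where
      eqC : ∀ e → count C e ≡ bit (cut S e)
      eqC e = ≡-trans (count-unique (proj₁ u') e) (cong bit (eqS e))

  -- A cut is an even edge set of the dual, hence a disjoint union of circuits of the dual,
  -- and circuits of the dual are central cuts.
  central-decomposition : ∀ S → Σ (List (Fin n → Bool)) λ Ss → All Central Ss ×
    (∀ e → bit (cut S e) ≡ N.∑ Ss (λ T → bit (cut T e))) ×
    (∀ u v → bit (S u xor S v) ≤ N.∑ Ss (λ T → bit (T u xor T v)))
  central-decomposition S = finish (Graph.circuits lo hi L (<-wellFounded _) even)
    where
    L = support (cut S)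
    even : Graph.Even lo hi L
    even A = ≡-trans (B∑-filter (cut S) (Graph.cr lo hi A) (allFin m)) (cut-even S A)
    finish : ∃[ Cs ] (L ↭ concat Cs × All (Graph.Circuit lo hi) Cs) → _
    finish (Cs , perm , cs) = pack (circuit-cuts Cs (Unique-resp-↭ perm (support! (cut S))) cs)
      where
      pack : CutList (concat Cs) → _
      pack (Ss , central , eq) = Ss , central , edges , pairs
        where
        edges : ∀ e → bit (cut S e) ≡ N.∑ Ss (λ T → bit (cut T e))
        edges e = ≡-trans (sym (count-support (cut S) e)) (≡-trans (N.∑-↭ _ perm) (eq e))
        edges-xor : ∀ e → cut S e ≡ B.∑ Ss (λ T → cut T e)
        edges-xor e = ≡-trans (sym (oddℕ-bit (cut S e))) (≡-trans (cong oddℕ (edges e)) (oddℕ-∑ Ss (λ T → cut T e)))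
        -- Edge by edge the pieces add up to `S` modulo 2. Summing along a walk from `u` to `v`
        -- carries this over to pairs of vertices, where cancellation can leave only an inequality.
        pairs : ∀ u v → bit (S u xor S v) ≤ N.∑ Ss (λ T → bit (T u xor T v))
        pairs u v = ≤-trans (≤-reflexive (cong bit total)) (bit-∑-≤ Ss (λ T → T u xor T v))
          where
          open ≡-Reasoning
          W = connected u v
          total : S u xor S v ≡ B.∑ Ss (λ T → T u xor T v)
          total = begin
            S u xor S v                                             ≡⟨ sym (walk-cut (proj₂ W) S) ⟩
            B.∑ (proj₁ W) (λ d → cut S (proj₁ d))                   ≡⟨ B.∑-cong (proj₁ W) (λ d → edges-xor (proj₁ d)) ⟩
            B.∑ (proj₁ W) (λ d → B.∑ Ss (λ T → cut T (proj₁ d)))    ≡⟨ B.∑-swap (proj₁ W) Ss _ ⟩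
            B.∑ Ss (λ T → B.∑ (proj₁ W) (λ d → cut T (proj₁ d)))    ≡⟨ B.∑-cong Ss (λ T → walk-cut (proj₂ W) T) ⟩
            B.∑ Ss (λ T → T u xor T v)                              ∎

-- Shortest paths
module Distance {n m : ℕ} (G : PlaneGraph n m) where
  open PlaneGraph G

  walk-++ : ∀ {u v x ds ds'} → Walk u ds v → Walk v ds' x → Walk u (ds ++ ds') x
  walk-++ nil        w' = w'
  walk-++ (cons p w) w' = cons p (walk-++ w w')

  walk-split : ∀ {u ds v x} → Walk u ds v → x ∈ u ∷ map head ds → ∃[ ps ] ∃[ qs ] (ds ≡ ps ++ qs × Walk u ps x × Walk x qs v)
  walk-split {ds = ds} w (here refl) = [] , ds , refl , nil , w
  walk-split {ds = d ∷ ds} (cons p w) (there x∈) with walk-split w x∈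
  ... | ps , qs , refl , w₁ , w₂ = d ∷ ps , qs , refl , cons p w₁ , w₂

  vertices-++ : ∀ {u ps x} → Walk u ps x → ∀ qs → ∃[ vs ] (u ∷ map head (ps ++ qs) ≡ vs ++ x ∷ map head qs)
  vertices-++ nil qs = [] , refl
  vertices-++ {u} (cons p w) qs = let (vs , eq) = vertices-++ w qs in u ∷ vs , cong (u ∷_) eq

  walk-reverse : ∀ {u ds v} → Walk u ds v → ∃[ ds' ] (Walk v ds' u × (∀ (l : Fin m → ℕ) → N.∑ ds' (l ∘ proj₁) ≡ N.∑ ds (l ∘ proj₁)))
  walk-reverse nil = [] , nil , λ l → refl
  walk-reverse {u} {d ∷ ds} {v} (cons p w) with walk-reverse w
  ... | ds' , w' , eq = ds' ++ rev d ∷ [] , walk-++ w' (cons refl (subst (λ z → Walk z [] u) (sym (≡-trans (head-rev d) p)) nil)) ,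
        λ l → ≡-trans (N.∑-++ ds' (rev d ∷ []) (l ∘ proj₁)) (≡-trans (cong₂ _+_ (eq l) (+-identityʳ (l (proj₁ d)))) (+-comm _ (l (proj₁ d))))
    where
    head-rev : ∀ d → head (rev d) ≡ tail d
    head-rev (e , true)  = refl
    head-rev (e , false) = refl

  open import Data.List.Relation.Unary.Unique.DecPropositional (_≟_ {n}) using (unique?)

  walk? : ∀ u ds v → Dec (Walk u ds v)
  walk? u [] v with u ≟ v
  ... | yes refl = yes nil
  ... | no ¬p    = no λ { nil → ¬p refl }
  walk? u (d ∷ ds) v with tail d ≟ u | walk? (head d) ds v
  ... | yes p | yes w = yes (cons p w)
  ... | no ¬p | _     = no λ { (cons p _) → ¬p p }
  ... | _     | no ¬w = no λ { (cons _ w) → ¬w w }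

  isPath? : ∀ u v ds → Dec (IsPath u ds v)
  isPath? u v ds = walk? u ds v ×-dec unique? (u ∷ map head ds)

  paths : Fin n → Fin n → List (List (Dart m))
  paths u v = filter (isPath? u v) (listsUpTo (dartList m) n)

  ∈-paths : ∀ {u v ds} → IsPath u ds v → ds ∈ paths u v
  ∈-paths {u} {v} {ds} p@(_ , u!) = ∈-filter⁺ (isPath? u v) (∈-listsUpTo n (λ _ → ∈-dartList _)
    (<⇒≤ (≤-trans (≤-reflexive (cong suc (sym (length-map head ds)))) (≤-trans (Unique-⊆-length u! (λ _ → ∈-allFin _)) (≤-reflexive (length-tabulate {n = n} id)))))) p

  module _ (l : Fin m → ℕ) where
    len : List (Dart m) → ℕ
    len ds = N.∑ ds (l ∘ proj₁)

    -- If the new first vertex already occurs on the rest, the part before that occurrence is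
    -- dropped; flow paths may not repeat a vertex.
    loop-erase : ∀ {u ds v} → Walk u ds v → ∃[ ps ] (IsPath u ps v × len ps ≤ len ds)
    loop-erase nil = [] , (nil , [] ∷ []) , z≤n
    loop-erase {u} {d ∷ ds} {v} (cons p w) = step (loop-erase w)
      where
      step : ∃[ ps ] (IsPath (head d) ps v × len ps ≤ len ds) → ∃[ ps ] (IsPath u ps v × len ps ≤ len (d ∷ ds))
      step (ps , (w' , u!) , le) with Any.any? (u ≟_) (head d ∷ map head ps)
      ... | no u∉  = d ∷ ps , (cons p w' , Allₚ.¬Any⇒All¬ _ u∉ ∷ u!) , +-monoʳ-≤ (l (proj₁ d)) le
      ... | yes u∈ with walk-split w' u∈
      ...   | ps₁ , ps₂ , refl , w₁ , w₂ with vertices-++ w₁ ps₂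
      ...     | vs , eq = ps₂ , (w₂ , proj₁ (proj₂ (Unique-++⁻ vs (subst Unique eq u!)))) ,
                ≤-trans (≤-trans (m≤n+m (len ps₂) (len ps₁)) (≤-reflexive (sym (N.∑-++ ps₁ ps₂ _)))) (≤-trans le (m≤n+m _ (l (proj₁ d))))

    private
      open import Data.List.Extrema.Nat
      first : Fin n → Fin n → List (Dart m)
      first u v = proj₁ (loop-erase (proj₂ (connected u v)))
      shortest : Fin n → Fin n → List (Dart m)
      shortest u v = argmin len (first u v) (paths u v)

    abstract
      dist : Fin n → Fin n → ℕ
      dist u v = len (shortest u v)

      dist-attained : ∀ u v → ∃[ ds ] (IsPath u ds v × len ds ≡ dist u v)
      dist-attained u v = shortest u v , argmin-all len (proj₁ (proj₂ (loop-erase (proj₂ (connected u v))))) (Allₚ.all-filter (isPath? u v) (listsUpTo (dartList m) n)) , refl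

      dist-≤ : ∀ {u ds v} → Walk u ds v → dist u v ≤ len ds
      dist-≤ {u} {ds} {v} w = let (ps , isP , le) = loop-erase w in
        ≤-trans (All.lookup (f[argmin]≤f[xs] {f = len} (first u v) (paths u v)) (∈-paths isP)) le

    dist-refl : ∀ u → dist u u ≡ 0
    dist-refl u = n≤0⇒n≡0 (dist-≤ nil)

    dist-triangle : ∀ u v x → dist u x ≤ dist u v + dist v x
    dist-triangle u v x = let (ps , (w , _) , eq) = dist-attained u v
                              (qs , (w' , _) , eq') = dist-attained v x in
      ≤-trans (dist-≤ (walk-++ w w')) (≤-reflexive (≡-trans (N.∑-++ ps qs _) (cong₂ _+_ eq eq')))

    dist-sym-≤ : ∀ u v → dist u v ≤ dist v u
    dist-sym-≤ u v = let (ps , (w , _) , eq) = dist-attained v u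
                         (ps' , w' , eq') = walk-reverse w in ≤-trans (dist-≤ w') (≤-reflexive (≡-trans (eq' l) eq))

    dist-sym : ∀ u v → dist u v ≡ dist v u
    dist-sym u v = ≤-antisym (dist-sym-≤ u v) (dist-sym-≤ v u)

    dist-edge : ∀ e → dist (proj₁ (ends e)) (proj₂ (ends e)) ≤ l e
    dist-edge e = ≤-trans (dist-≤ {ds = (e , false) ∷ []} (cons refl nil)) (≤-reflexive (+-identityʳ (l e)))

-- Counting thresholds

downFrom-< : ∀ {r M} → r ∈ downFrom M → r < M
downFrom-< {M = suc M} (here refl) = ≤-refl
downFrom-< {M = suc M} (there r∈)  = m≤n⇒m≤1+n (downFrom-< r∈)

-- The thresholds that tell `a` from `b` are those with `a ≤ t < b`. With distances for `a` and `b`,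
-- this counts the balls that separate two vertices.
threshold-sum-≤ : ∀ a b T → a ≤ b → N.∑ (downFrom T) (λ t → bit (⌊ a ≤? t ⌋ xor ⌊ b ≤? t ⌋)) ≤ b ∸ a
threshold-sum-≤ a b T a≤b = ≤-trans (below T) (∸-monoˡ-≤ a (m⊓n≤m b T))
  where
  below : ∀ T → N.∑ (downFrom T) (λ t → bit (⌊ a ≤? t ⌋ xor ⌊ b ≤? t ⌋)) ≤ (b ⊓ T) ∸ a
  below zero = z≤n
  below (suc T) with a ≤? T | b ≤? T
  ... | yes _   | yes b≤T = ≤-trans (below T) (∸-monoˡ-≤ a (⊓-mono-≤ (≤-refl {b}) (n≤1+n T)))
  ... | no _    | no _    = ≤-trans (below T) (∸-monoˡ-≤ a (⊓-mono-≤ (≤-refl {b}) (n≤1+n T)))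
  ... | no a≰T  | yes b≤T = contradiction (≤-trans a≤b b≤T) a≰T
  ... | yes a≤T | no b≰T  = ≤-trans (+-monoʳ-≤ 1 (≤-trans (below T) (∸-monoˡ-≤ a (m⊓n≤n b T))))
      (≤-reflexive (≡-trans (sym (+-∸-assoc 1 a≤T)) (cong (_∸ a) (sym (m≥n⇒m⊓n≡n (≰⇒> b≰T))))))

threshold-sum : ∀ a b c T → a ≤ b + c → b ≤ a + c → N.∑ (downFrom T) (λ t → bit (⌊ a ≤? t ⌋ xor ⌊ b ≤? t ⌋)) ≤ c
threshold-sum a b c T p q with ≤-total a b
... | inj₁ a≤b = ≤-trans (threshold-sum-≤ a b T a≤b) (≤-trans (∸-monoˡ-≤ a q) (≤-reflexive (m+n∸m≡n a c)))
... | inj₂ b≤a = ≤-trans (≤-reflexive (N.∑-cong (downFrom T) (λ t → cong bit (xor-comm ⌊ a ≤? t ⌋ ⌊ b ≤? t ⌋))))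
    (≤-trans (threshold-sum-≤ b a T b≤a) (≤-trans (∸-monoˡ-≤ b p) (≤-reflexive (m+n∸m≡n b c))))

-- Chords drawn inside the faces
lefts! : ∀ {A B : Set} {L : List (A ⊎ B)} → Unique L → Unique (lefts L)
lefts! {L = []}         []       = []
lefts! {L = inj₁ x ∷ L} (x∉ ∷ u) = fresh L x∉ ∷ lefts! u
  where
  fresh : ∀ L → All (inj₁ x ≢_) L → All (x ≢_) (lefts L)
  fresh []           []        = []
  fresh (inj₁ y ∷ L) (ne ∷ ns) = (λ { refl → ne refl }) ∷ fresh L ns
  fresh (inj₂ _ ∷ L) (_ ∷ ns)  = fresh L ns
lefts! {L = inj₂ y ∷ L} (_ ∷ u)  = lefts! u

rights! : ∀ {A B : Set} {L : List (A ⊎ B)} → Unique L → Unique (rights L)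
rights! {L = []}         []       = []
rights! {L = inj₂ y ∷ L} (y∉ ∷ u) = fresh L y∉ ∷ rights! u
  where
  fresh : ∀ L → All (inj₂ y ≢_) L → All (y ≢_) (rights L)
  fresh []           []        = []
  fresh (inj₂ z ∷ L) (ne ∷ ns) = (λ { refl → ne refl }) ∷ fresh L ns
  fresh (inj₁ _ ∷ L) (_ ∷ ns)  = fresh L ns
rights! {L = inj₁ x ∷ L} (_ ∷ u)  = rights! u

oddℕ-double : ∀ k → oddℕ (2 * k) ≡ false
oddℕ-double k = ≡-trans (cong oddℕ (cong (k +_) (+-identityʳ k))) (≡-trans (oddℕ-+ k k) (xor-same (oddℕ k)))

even-≥2 : ∀ {A : Set} (xs : List A) (f : A → Bool) → B.∑ xs f ≡ false → ∀ {x} → x ∈ xs → f x ≡ true → 2 ≤ N.∑ xs (bit ∘ f)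
even-≥2 xs f even x∈ fx with N.∑ xs (bit ∘ f) | oddℕ-∑ xs f | ≤-trans (≤-reflexive (cong bit (sym fx))) (term≤∑ xs (bit ∘ f) x∈)
... | zero        | _  | ()
... | suc zero    | eq | _ = contradiction (≡-trans eq even) λ ()
... | suc (suc _) | _  | _ = s≤s (s≤s z≤n)

module Chords {n m : ℕ} (G : PlaneGraph n m) where
  open CentralCuts G public

  -- The plane graph with j chords added: the dart d lies on the region lab d, and the chord c
  -- joins cu c to cv c and separates the regions clo c and chi c.
  record Chorded : Set where
    field
      j       : ℕ
      cu cv   : Fin j → Fin n
      clo chi : Fin j → ℕ
      lab     : Dart m → ℕ
      bound   : ℕ
      lab<    : ∀ d → lab d < bound
      clo<    : ∀ c → clo c < bound
      chi<    : ∀ c → chi c < bound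

    chord : (Fin n → Bool) → Fin j → Bool
    chord S c = S (cu c) xor S (cv c)
    dual : (ℕ → Bool) → Fin j → Bool
    dual A c = A (clo c) xor A (chi c)

    field
      -- This field and the next are planarity in algebraic form: the cuts of the graph with its
      -- chords are even in the dual graph on the regions, and conversely every even set there is a
      -- cut.
      orthogonal : ∀ (A : ℕ → Bool) (S : Fin n → Bool) → B.∑ (allFin m) (λ e → bd (A ∘ lab) e ∧ cut S e) xor B.∑ (allFin j) (λ c → dual A c ∧ chord S c) ≡ false
      even⇒cut   : ∀ (x : Fin m → Bool) (y : Fin j → Bool) →
        (∀ (A : ℕ → Bool) → B.∑ (allFin m) (λ e → x e ∧ bd (A ∘ lab) e) xor B.∑ (allFin j) (λ c → y c ∧ dual A c) ≡ false) →
        Σ (Fin n → Bool) λ S → (∀ e → x e ≡ cut S e) × (∀ c → y c ≡ chord S c)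

  noChords : Chorded
  noChords = record
    { j = 0 ; cu = λ () ; cv = λ () ; clo = λ () ; chi = λ () ; lab = faceℕ ; bound = numFaces
    ; lab< = λ d → toℕ<n (faceOf d) ; clo< = λ () ; chi< = λ ()
    ; orthogonal = λ A S → ≡-trans (xor-identityʳ _) (cut-even S A)
    ; even⇒cut = λ x y h → proj₁ (base x h) , proj₂ (base x h) , λ ()
    }
    where
    base : ∀ (x : Fin m → Bool) → (∀ (A : ℕ → Bool) → B.∑ (allFin m) (λ e → x e ∧ bd (A ∘ faceℕ) e) xor false ≡ false) → ∃[ S ] (∀ e → x e ≡ cut S e)
    base x h = even-is-cut x (λ β → ≡-trans (B.∑-cong (allFin m) (λ e → cong (x e ∧_)
        (sym (cong₂ _xor_ (extend-toℕ β (faceOf (e , false))) (extend-toℕ β (faceOf (e , true)))))))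
        (≡-trans (sym (xor-identityʳ _)) (h (extend β))))

  -- A new chord from u to v cuts off the dart set R, homologous to it, from the region r.
  module AddChord (K : Chorded) (R : Dart m → Bool) (r : ℕ) (u v : Fin n) where
    open Chorded K

    -- All labels in use are below `bound`, so `bound` itself names the new region.
    lab' : Dart m → ℕ
    lab' d = if R d then bound else lab d

    module _ (R-lab : ∀ d → R d ≡ true → lab d ≡ r) (r< : r < bound)
             (R-hom : ∀ (S : Fin n → Bool) → B.∑ (dartList m) (λ d → R d ∧ cut S (proj₁ d)) ≡ S u xor S v) where

      R-sum : ∀ (x : Fin m → Bool) → B.∑ (dartList m) (λ d → R d ∧ x (proj₁ d)) ≡ B.∑ (allFin m) (λ e → x e ∧ bd R e)
      R-sum x = ≡-trans (B∑-darts m (λ d → R d ∧ x (proj₁ d))) (B.∑-cong (allFin m) (λ e →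
        ≡-trans (sym (∧-distribʳ-xor (x e) (R (e , false)) (R (e , true)))) (∧-comm (bd R e) (x e))))

      relabel : ∀ (A : ℕ → Bool) d → A (lab' d) ≡ A (lab d) xor (R d ∧ (A r xor A bound))
      relabel A d with R d in Rd
      ... | false = sym (xor-identityʳ (A (lab d)))
      ... | true rewrite R-lab d Rd = sym (xor-cancelˡ (A r) (A bound))

      -- Relabelling adds `κ` on `R`. By `R-hom` this contributes `κ` times the separation of `u`
      -- from `v`, which cancels the term of the new chord.
      orthogonal' : ∀ (A : ℕ → Bool) (S : Fin n → Bool) → B.∑ (allFin m) (λ e → bd (A ∘ lab') e ∧ cut S e) xor
        (((A r xor A bound) ∧ (S u xor S v)) xor B.∑ (allFin j) (λ c → dual A c ∧ chord S c)) ≡ false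
      orthogonal' A S = ≡-trans (cong (_xor ((κ ∧ (S u xor S v)) xor Y)) edges) (≡-trans (cancel X (κ ∧ (S u xor S v)) Y) (orthogonal A S))
        where
        κ = A r xor A bound
        X = B.∑ (allFin m) (λ e → bd (A ∘ lab) e ∧ cut S e)
        Y = B.∑ (allFin j) (λ c → dual A c ∧ chord S c)
        cancel : ∀ x k y → (x xor k) xor (k xor y) ≡ x xor y
        cancel x k y = xor-cross x k y
        point : ∀ a a' p p' k s → ((a xor (p ∧ k)) xor (a' xor (p' ∧ k))) ∧ s ≡ ((a xor a') ∧ s) xor (k ∧ (s ∧ (p xor p')))
        point a a' p p' true true = ≡-trans (∧-identityʳ _) (≡-trans (cong₂ (λ i i' → (a xor i) xor (a' xor i')) (∧-identityʳ p) (∧-identityʳ p'))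
            (≡-trans (B.interchange a p a' p') (cong (_xor (p xor p')) (sym (∧-identityʳ (a xor a'))))))
        point a a' p p' k false = ≡-trans (∧-zeroʳ _) (sym (cong₂ _xor_ (∧-zeroʳ (a xor a')) (∧-zeroʳ k)))
        point a a' p p' false true = ≡-trans (cong₂ (λ i i' → ((a xor i) xor (a' xor i')) ∧ true) (∧-zeroʳ p) (∧-zeroʳ p'))
            (≡-trans (cong₂ (λ i i' → (i xor i') ∧ true) (xor-identityʳ a) (xor-identityʳ a')) (sym (xor-identityʳ _)))
        open ≡-Reasoning
        edges : B.∑ (allFin m) (λ e → bd (A ∘ lab') e ∧ cut S e) ≡ X xor (κ ∧ (S u xor S v))
        edges = begin
          B.∑ (allFin m) (λ e → bd (A ∘ lab') e ∧ cut S e)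
            ≡⟨ B.∑-cong (allFin m) (λ e → ≡-trans (cong (_∧ cut S e) (cong₂ _xor_ (relabel A (e , false)) (relabel A (e , true))))
                 (point (A (lab (e , false))) (A (lab (e , true))) (R (e , false)) (R (e , true)) κ (cut S e))) ⟩
          B.∑ (allFin m) (λ e → (bd (A ∘ lab) e ∧ cut S e) xor (κ ∧ (cut S e ∧ bd R e)))
            ≡⟨ B.∑-+ (allFin m) _ _ ⟩
          X xor B.∑ (allFin m) (λ e → κ ∧ (cut S e ∧ bd R e))
            ≡⟨ cong (X xor_) (B.∑-*ˡ (allFin m) κ _) ⟩
          X xor (κ ∧ B.∑ (allFin m) (λ e → cut S e ∧ bd R e))
            ≡⟨ cong (λ z → X xor (κ ∧ z)) (≡-trans (sym (R-sum (cut S))) (R-hom S)) ⟩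
          X xor (κ ∧ (S u xor S v)) ∎

      -- Colourings that give the new region the colour of `r` recover the hypothesis for the old
      -- chords. The indicator of the new region then determines the value at the new chord.
      even⇒cut' : ∀ (x : Fin m → Bool) (y₀ : Bool) (y : Fin j → Bool) →
        (∀ (A : ℕ → Bool) → B.∑ (allFin m) (λ e → x e ∧ bd (A ∘ lab') e) xor ((y₀ ∧ (A r xor A bound)) xor B.∑ (allFin j) (λ c → y c ∧ dual A c)) ≡ false) →
        Σ (Fin n → Bool) λ S → (∀ e → x e ≡ cut S e) × y₀ ≡ S u xor S v × (∀ c → y c ≡ chord S c)
      even⇒cut' x y₀ y h = new (even⇒cut x y old)
        where
        lift : (ℕ → Bool) → ℕ → Bool
        lift A k = if pt bound k then A r else A k
        lift-< : ∀ (A : ℕ → Bool) {k} → k < bound → lift A k ≡ A k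
        lift-< A {k} lt rewrite pt-≢ {bound} {k} (<⇒≢ lt) = refl
        lift-bound : ∀ (A : ℕ → Bool) → lift A bound ≡ A r
        lift-bound A rewrite pt-refl bound = refl
        lift-lab : ∀ (A : ℕ → Bool) d → lift A (lab' d) ≡ A (lab d)
        lift-lab A d with R d in Rd
        ... | false = lift-< A (lab< d)
        ... | true  = ≡-trans (lift-bound A) (cong A (sym (R-lab d Rd)))
        old : ∀ (A : ℕ → Bool) → B.∑ (allFin m) (λ e → x e ∧ bd (A ∘ lab) e) xor B.∑ (allFin j) (λ c → y c ∧ dual A c) ≡ false
        old A = ≡-trans (cong₂ _xor_ (B.∑-cong (allFin m) (λ e → cong (x e ∧_) (sym (cong₂ _xor_ (lift-lab A (e , false)) (lift-lab A (e , true))))))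
          (sym (≡-trans (cong (_xor B.∑ (allFin j) (λ c → y c ∧ dual (lift A) c)) (≡-trans (cong (y₀ ∧_) (≡-trans (cong₂ _xor_ (lift-< A r<) (lift-bound A)) (xor-same (A r)))) (∧-zeroʳ y₀)))
            (B.∑-cong (allFin j) (λ c → cong (y c ∧_) (cong₂ _xor_ (lift-< A (clo< c)) (lift-< A (chi< c)))))))) (h (lift A))
        new : (Σ (Fin n → Bool) λ S → (∀ e → x e ≡ cut S e) × (∀ c → y c ≡ chord S c)) →
              Σ (Fin n → Bool) λ S → (∀ e → x e ≡ cut S e) × y₀ ≡ S u xor S v × (∀ c → y c ≡ chord S c)
        new (S , xS , yS) = S , xS , sym (xor≡false (≡-trans (cong₂ _xor_ first (sym second)) (h (pt bound)))) , yS
          where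
          pt-lab : ∀ d → pt bound (lab' d) ≡ R d
          pt-lab d with R d
          ... | true  = pt-refl bound
          ... | false = pt-≢ (<⇒≢ (lab< d))
          first : S u xor S v ≡ B.∑ (allFin m) (λ e → x e ∧ bd (pt bound ∘ lab') e)
          first = ≡-trans (sym (R-hom S)) (≡-trans (R-sum (cut S)) (B.∑-cong (allFin m) (λ e → cong₂ _∧_ (sym (xS e)) (sym (cong₂ _xor_ (pt-lab (e , false)) (pt-lab (e , true)))))))
          second : (y₀ ∧ (pt bound r xor pt bound bound)) xor B.∑ (allFin j) (λ c → y c ∧ dual (pt bound) c) ≡ y₀
          second = ≡-trans (cong₂ _xor_ (≡-trans (cong (y₀ ∧_) (cong₂ _xor_ (pt-≢ (<⇒≢ r<)) (pt-refl bound))) (∧-identityʳ y₀))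
            (≡-trans (B.∑-cong (allFin j) (λ c → ≡-trans (cong (y c ∧_) (cong₂ _xor_ (pt-≢ (<⇒≢ (clo< c))) (pt-≢ (<⇒≢ (chi< c))))) (∧-zeroʳ (y c)))) (B.∑-0 (allFin j)))) (xor-identityʳ y₀)

      cons' : ∀ {A : Set} → A → (Fin j → A) → Fin (suc j) → A
      cons' x f zero    = x
      cons' x f (suc c) = f c

      addChord : Chorded
      addChord = record
        { j = suc j ; cu = cons' u cu ; cv = cons' v cv ; clo = cons' r clo ; chi = cons' bound chi ; lab = lab' ; bound = suc bound
        ; lab< = lab'<
        ; clo< = λ { zero → m≤n⇒m≤1+n r< ; (suc c) → m≤n⇒m≤1+n (clo< c) }
        ; chi< = λ { zero → n<1+n bound ; (suc c) → m≤n⇒m≤1+n (chi< c) }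
        ; orthogonal = λ A S → ≡-trans (cong (B.∑ (allFin m) (λ e → bd (A ∘ lab') e ∧ cut S e) xor_)
            (B.∑-suc (λ c → (A (cons' r clo c) xor A (cons' bound chi c)) ∧ (S (cons' u cu c) xor S (cons' v cv c))))) (orthogonal' A S)
        ; even⇒cut = λ x y h → unpack x y (even⇒cut' x (y zero) (λ c → y (suc c)) (λ A →
            ≡-trans (cong (B.∑ (allFin m) (λ e → x e ∧ bd (A ∘ lab') e) xor_)
              (sym (B.∑-suc (λ c → y c ∧ (A (cons' r clo c) xor A (cons' bound chi c)))))) (h A)))
        }
        where
        unpack : ∀ x (y : Fin (suc j) → Bool) → (Σ (Fin n → Bool) λ S → (∀ e → x e ≡ cut S e) × y zero ≡ S u xor S v × (∀ c → y (suc c) ≡ chord S c)) →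
          Σ (Fin n → Bool) λ S → (∀ e → x e ≡ cut S e) × (∀ c → y c ≡ S (cons' u cu c) xor S (cons' v cv c))
        unpack x y (S , xS , y₀S , yS) = S , xS , λ { zero → y₀S ; (suc c) → yS c }
        lab'< : ∀ d → lab' d < suc bound
        lab'< d with R d
        ... | true  = n<1+n bound
        ... | false = m≤n⇒m≤1+n (lab< d)

-- The metric inequality for noncrossing chords
module ChordsBound {n m : ℕ} (G : PlaneGraph n m) (l : Fin m → ℕ) where
  open Chords G
  open Distance G using (dist; dist-refl; dist-sym; dist-triangle; dist-edge)

  D : Fin n → Fin n → ℕ
  D = dist l

  capacity : (Fin n → Bool) → ℕ
  capacity S = N.∑ (allFin m) (λ e → cap e * bit (cut S e))

  module _ (K : Chorded) (cut-condition : ∀ S → N.∑ (allFin (Chorded.j K)) (λ c → bit (Chorded.chord K S c)) ≤ capacity S) where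
    open Chorded K

    E : Set
    E = Fin m ⊎ Fin j

    _≟E_ : DecidableEquality E
    _≟E_ = Data.Sum.Properties.≡-dec _≟_ _≟_
      where import Data.Sum.Properties

    es : List E
    es = map inj₁ (allFin m) ++ map inj₂ (allFin j)

    es! : Unique es
    es! = Uniqueₚ.++⁺ (Uniqueₚ.map⁺ (λ { refl → refl }) (Uniqueₚ.allFin⁺ m)) (Uniqueₚ.map⁺ (λ { refl → refl }) (Uniqueₚ.allFin⁺ j)) disj
      where
      disj : ∀ {x} → ¬ (x ∈ map inj₁ (allFin m) × x ∈ map inj₂ (allFin j))
      disj (p , q) with ∈-map⁻ inj₁ p | ∈-map⁻ inj₂ q
      ... | _ , _ , refl | _ , _ , ()

    es-all : ∀ e → e ∈ es
    es-all (inj₁ e) = ∈-++⁺ˡ (∈-map⁺ inj₁ (∈-allFin e))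
    es-all (inj₂ c) = ∈-++⁺ʳ (map inj₁ (allFin m)) (∈-map⁺ inj₂ (∈-allFin c))

    a b : E → ℕ
    a (inj₁ e) = lab (e , false)
    a (inj₂ c) = clo c
    b (inj₁ e) = lab (e , true)
    b (inj₂ c) = chi c

    -- the parity invariant of the sums-of-circuits theorem is met by doubling all capacities
    w : E → ℤ
    w (inj₁ e) = ℤ.+ (2 * cap e)
    w (inj₂ c) = ℤ.- (ℤ.+ 2)

    side : (Fin n → Bool) → E → Bool
    side S (inj₁ e) = cut S e
    side S (inj₂ c) = chord S c

    -- Distances of the ends, even for supply edges: balls around one end of an edge miss its other
    -- end only at radii below that distance. The lengths `l` return at the very end, through
    -- `dist-edge`.
    p : E → ℕ
    p (inj₁ e) = D (proj₁ (ends e)) (proj₂ (ends e))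
    p (inj₂ c) = D (cu c) (cv c)

    open Graph a b

    B∑-es : ∀ (f : E → Bool) → B.∑ es f ≡ B.∑ (allFin m) (f ∘ inj₁) xor B.∑ (allFin j) (f ∘ inj₂)
    B∑-es f = ≡-trans (B.∑-++ (map inj₁ (allFin m)) _ f) (cong₂ _xor_ (B.∑-map inj₁ (allFin m) f) (B.∑-map inj₂ (allFin j) f))

    even-at : ∀ A S → B.∑ es (λ f → cr A f ∧ side S f) ≡ false
    even-at A S = ≡-trans (B∑-es (λ f → cr A f ∧ side S f)) (orthogonal A S)

    w-parity : ∀ e → parity (w e) ≡ cr (λ _ → false) e
    w-parity (inj₁ e) = oddℕ-double (cap e)
    w-parity (inj₂ c) = refl

    -- An even set of the dual is a cut, and its weight is twice the excess of the capacity over the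
    -- number of chords in that cut.
    conservative : SumsOfCircuits.Conservative _≟E_ es es! es-all a b w
    conservative L L! eL = subst (ℤ.0ℤ ℤ.≤_) (sym total) (ℤₚ.i≤j⇒0≤j-i (ℤ.+≤+ (*-monoʳ-≤ 2 (≤-trans (≤-reflexive right) (≤-trans (cut-condition S) (≤-reflexive (sym left)))))))
      where
      L₁ = lefts L
      L₂ = rights L
      hom = even⇒cut (λ e → oddℕ (count L₁ e)) (λ c → oddℕ (count L₂ c)) (λ A →
        ≡-trans (cong₂ _xor_ (B∑-count L₁ (bd (A ∘ lab))) (B∑-count L₂ (dual A))) (≡-trans (sym (B.∑-⊎ L (cr A))) (eL A)))
      S = proj₁ hom
      left : N.∑ L₁ cap ≡ capacity S
      left = ≡-trans (sym (∑-count L₁ cap)) (N.∑-cong (allFin m) (λ e → cong (cap e *_) (≡-trans (count-unique (lefts! L!) e) (cong bit (proj₁ (proj₂ hom) e)))))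
      right : N.∑ L₂ (λ _ → 1) ≡ N.∑ (allFin j) (λ c → bit (chord S c))
      right = ≡-trans (sym (∑-count L₂ (λ _ → 1))) (N.∑-cong (allFin j) (λ c → ≡-trans (*-identityˡ _) (≡-trans (count-unique (rights! L!) c) (cong bit (proj₂ (proj₂ hom) c)))))
      minus-twos : ∀ (xs : List (Fin j)) → Z.∑ xs (λ _ → ℤ.- (ℤ.+ 2)) ≡ ℤ.- (ℤ.+ (2 * N.∑ xs (λ _ → 1)))
      minus-twos []       = refl
      minus-twos (x ∷ xs) = ≡-trans (cong (ℤ._+_ (ℤ.- (ℤ.+ 2))) (minus-twos xs))
        (≡-trans (sym (ℤₚ.neg-distrib-+ (ℤ.+ 2) (ℤ.+ (2 * N.∑ xs (λ _ → 1))))) (cong (λ z → ℤ.- (ℤ.+ z)) (sym (*-suc 2 (N.∑ xs (λ _ → 1))))))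
      total : Z.∑ L w ≡ ℤ.+ (2 * N.∑ L₁ cap) ℤ.- ℤ.+ (2 * N.∑ L₂ (λ _ → 1))
      total = ≡-trans (Z.∑-⊎ L w) (cong₂ ℤ._+_ (≡-trans (∑-pos L₁ (λ e → 2 * cap e)) (cong ℤ.+_ (N.∑-*ˡ L₁ 2 cap))) (minus-twos L₂))

    -- Balls around an end of e₀ are cut evenly by every dual cut; averaging over the radii gives
    -- the cut inequality for distances.
    cut-inequality : ∀ A e₀ → cr A e₀ ≡ true → 2 * p e₀ ≤ N.∑ es (λ f → if cr A f then p f else 0)
    cut-inequality A e₀ cr₀ = begin
      2 * p e₀                                                        ≡⟨ twos (p e₀) ⟩
      N.∑ (downFrom (p e₀)) (λ _ → 2)                                 ≤⟨ ∑-mono∈ (downFrom (p e₀)) crossing ⟩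
      N.∑ (downFrom (p e₀)) (λ t → N.∑ es (λ f → bit (cr A f ∧ side (ball t) f)))  ≡⟨ N.∑-swap (downFrom (p e₀)) es _ ⟩
      N.∑ es (λ f → N.∑ (downFrom (p e₀)) (λ t → bit (cr A f ∧ side (ball t) f)))  ≤⟨ ∑-mono es radii ⟩
      N.∑ es (λ f → if cr A f then p f else 0)                        ∎
      where
      open ≤-Reasoning
      pu pv : E → Fin n
      pu (inj₁ e) = proj₁ (ends e)
      pu (inj₂ c) = cu c
      pv (inj₁ e) = proj₂ (ends e)
      pv (inj₂ c) = cv c
      side-ends : ∀ S f → side S f ≡ S (pu f) xor S (pv f)
      side-ends S (inj₁ e) = refl
      side-ends S (inj₂ c) = refl
      p-ends : ∀ f → p f ≡ D (pu f) (pv f)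
      p-ends (inj₁ e) = refl
      p-ends (inj₂ c) = refl
      ball : ℕ → Fin n → Bool
      ball t x = ⌊ D (pu e₀) x ≤? t ⌋
      twos : ∀ T → 2 * T ≡ N.∑ (downFrom T) (λ _ → 2)
      twos zero    = refl
      twos (suc T) = ≡-trans (*-suc 2 T) (cong (2 +_) (twos T))
      crosses₀ : ∀ t → t < p e₀ → side (ball t) e₀ ≡ true
      crosses₀ t lt = ≡-trans (side-ends (ball t) e₀) (cong₂ _xor_ inside outside)
        where
        inside : ball t (pu e₀) ≡ true
        inside with D (pu e₀) (pu e₀) ≤? t
        ... | yes _ = refl
        ... | no ¬p = contradiction (≤-trans (≤-reflexive (dist-refl l (pu e₀))) z≤n) ¬p
        outside : ball t (pv e₀) ≡ false
        outside with D (pu e₀) (pv e₀) ≤? t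
        ... | yes q = contradiction (≤-trans lt (≤-trans (≤-reflexive (p-ends e₀)) q)) 1+n≰n
        ... | no _  = refl
      crossing : ∀ t → t ∈ downFrom (p e₀) → 2 ≤ N.∑ es (λ f → bit (cr A f ∧ side (ball t) f))
      crossing t t∈ = even-≥2 es (λ f → cr A f ∧ side (ball t) f) (even-at A (ball t)) (es-all e₀) (cong₂ _∧_ cr₀ (crosses₀ t (downFrom-< t∈)))
      radii : ∀ f → N.∑ (downFrom (p e₀)) (λ t → bit (cr A f ∧ side (ball t) f)) ≤ (if cr A f then p f else 0)
      radii f with cr A f
      ... | false = ≤-reflexive (N.∑-0 (downFrom (p e₀)))
      ... | true  = ≤-trans (≤-reflexive (N.∑-cong (downFrom (p e₀)) (λ t → cong bit (side-ends (ball t) f))))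
          (≤-trans (threshold-sum (D (pu e₀) (pu f)) (D (pu e₀) (pv f)) (D (pu f) (pv f)) (p e₀)
            (≤-trans (dist-triangle l (pu e₀) (pv f) (pu f)) (+-monoʳ-≤ _ (≤-reflexive (dist-sym l (pv f) (pu f)))))
            (dist-triangle l (pu e₀) (pu f) (pv f))) (≤-reflexive (sym (p-ends f))))

    -- The pairing of `w` with `p` is twice the difference of the two sides, with `l` replaced by
    -- distances.
    chords-bound : N.∑ (allFin j) (λ c → D (cu c) (cv c)) ≤ N.∑ (allFin m) (λ e → cap e * l e)
    chords-bound = ≤-trans (*-cancelˡ-≤ 2 doubled) (∑-mono (allFin m) (λ e → *-monoʳ-≤ (cap e) (dist-edge l e)))
      where
      X = N.∑ (allFin m) (λ e → cap e * p (inj₁ e))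
      Y = N.∑ (allFin j) (λ c → p (inj₂ c))
      nonneg : ℤ.0ℤ ℤ.≤ Z.∑ es (λ e → w e ℤ.* ℤ.+ p e)
      nonneg = SumsOfCircuits.sums-of-circuits _≟E_ es es! es-all p a b w (λ _ → false) (<-wellFounded _) w-parity conservative cut-inequality
      total : Z.∑ es (λ e → w e ℤ.* ℤ.+ p e) ≡ ℤ.+ (2 * X) ℤ.- ℤ.+ (2 * Y)
      total = ≡-trans (Z.∑-++ (map inj₁ (allFin m)) _ _) (cong₂ ℤ._+_
        (≡-trans (Z.∑-map inj₁ (allFin m) _) (≡-trans (Z.∑-cong (allFin m) (λ e → ≡-trans (sym (ℤₚ.pos-* (2 * cap e) (p (inj₁ e)))) (cong ℤ.+_ (*-assoc 2 (cap e) (p (inj₁ e))))))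
          (≡-trans (∑-pos (allFin m) (λ e → 2 * (cap e * p (inj₁ e)))) (cong ℤ.+_ (N.∑-*ˡ (allFin m) 2 _)))))
        (≡-trans (Z.∑-map inj₂ (allFin j) _) (≡-trans (Z.∑-*ˡ (allFin j) (ℤ.- (ℤ.+ 2)) (λ c → ℤ.+ p (inj₂ c)))
          (≡-trans (cong (ℤ.- (ℤ.+ 2) ℤ.*_) (∑-pos (allFin j) (λ c → p (inj₂ c))))
            (≡-trans (sym (ℤₚ.neg-distribˡ-* (ℤ.+ 2) (ℤ.+ Y))) (cong ℤ.-_ (sym (ℤₚ.pos-* 2 Y))))))))
      doubled : 2 * Y ≤ 2 * X
      doubled = ℤₚ.drop‿+≤+ (ℤₚ.0≤i-j⇒j≤i (subst (ℤ.0ℤ ℤ.≤_) total nonneg))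

-- Cyclic sequences and Kalmanson metrics
χ : ℕ × ℕ → ℕ → Bool
χ (s , t) p = ⌊ p ≤? s ⌋ xor ⌊ p ≤? t ⌋

-- the number of pairs separated by the interval of positions p, …, q - 1
cross : List (ℕ × ℕ) → ℕ → ℕ → ℕ
cross X p q = N.∑ X (λ c → bit (χ c p xor χ c q))

≤?-true : ∀ {p r} → p ≤ r → ⌊ p ≤? r ⌋ ≡ true
≤?-true {p} {r} le with p ≤? r
... | yes _ = refl
... | no ¬p = contradiction le ¬p

≤?-false : ∀ {p r} → r < p → ⌊ p ≤? r ⌋ ≡ false
≤?-false {p} {r} lt with p ≤? r
... | yes q = contradiction (<-≤-trans lt q) (<-irrefl refl)
... | no _  = refl

inside : ℕ → ℕ → ℕ → Bool
inside p q r = ⌊ p ≤? r ⌋ xor ⌊ q ≤? r ⌋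

changes : (ℕ → Bool) → ℕ → ℕ
changes f M = N.∑ (downFrom M) (λ r → bit (f r xor f (suc r)))

module Intervals (f : ℕ → Bool) where
  same : ∀ a b → a xor b ≡ false → b ≡ a
  same a b h = sym (xor≡false {a} {b} h)

  differ : ∀ a b → a xor b ≡ true → b ≡ a xor true
  differ true  false _ = refl
  differ false true  _ = refl

  constant : ∀ M → changes f M ≡ 0 → ∀ r → r ≤ M → f r ≡ f 0
  constant zero    _  zero z≤n = refl
  constant (suc M) ch r r≤ with f M xor f (suc M) in eq
  ... | false with r ≤? M
  ...   | yes r≤M = constant M ch r r≤M
  ...   | no r≰M rewrite ≤-antisym r≤ (≰⇒> r≰M) = ≡-trans (same (f M) (f (suc M)) eq) (constant M ch M ≤-refl)

  one-change : ∀ M → changes f M ≡ 1 → ∃[ q ] (q ≤ M × ∀ r → r ≤ M → f r ≡ f 0 xor ⌊ q ≤? r ⌋)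
  one-change (suc M) ch with f M xor f (suc M) in eq
  ... | true  = suc M , ≤-refl , at
    where
    at : ∀ r → r ≤ suc M → f r ≡ f 0 xor ⌊ suc M ≤? r ⌋
    at r r≤ with r ≤? M
    ... | yes r≤M = ≡-trans (constant M (suc-injective ch) r r≤M) (sym (≡-trans (cong (f 0 xor_) (≤?-false (s≤s r≤M))) (xor-identityʳ (f 0))))
    ... | no r≰M rewrite ≤-antisym r≤ (≰⇒> r≰M) = ≡-trans (differ (f M) (f (suc M)) eq) (cong₂ _xor_ (constant M (suc-injective ch) M ≤-refl) (sym (≤?-true (≤-refl {suc M}))))
  ... | false with one-change M ch
  ...   | q , q≤M , h = q , m≤n⇒m≤1+n q≤M , at
    where
    at : ∀ r → r ≤ suc M → f r ≡ f 0 xor ⌊ q ≤? r ⌋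
    at r r≤ with r ≤? M
    ... | yes r≤M = h r r≤M
    ... | no r≰M rewrite ≤-antisym r≤ (≰⇒> r≰M) = ≡-trans (same (f M) (f (suc M)) eq) (≡-trans (h M ≤-refl) (cong (f 0 xor_) (≡-trans (≤?-true q≤M) (sym (≤?-true (m≤n⇒m≤1+n q≤M))))))

  two-changes : ∀ M → changes f M ≡ 2 → ∃[ p ] ∃[ q ] (p ≤ q × q ≤ M × ∀ r → r ≤ M → f r ≡ f 0 xor inside p q r)
  two-changes (suc M) ch with f M xor f (suc M) in eq
  ... | true with one-change M (suc-injective ch)
  ...   | p , p≤M , h = p , suc M , m≤n⇒m≤1+n p≤M , ≤-refl , at
    where
    at : ∀ r → r ≤ suc M → f r ≡ f 0 xor inside p (suc M) r
    at r r≤ with r ≤? M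
    ... | yes r≤M = ≡-trans (h r r≤M) (cong (f 0 xor_) (sym (≡-trans (cong (⌊ p ≤? r ⌋ xor_) (≤?-false (s≤s r≤M))) (xor-identityʳ _))))
    ... | no r≰M rewrite ≤-antisym r≤ (≰⇒> r≰M) = ≡-trans (differ (f M) (f (suc M)) eq) (≡-trans (cong (_xor true) (h M ≤-refl)) (≡-trans (xor-assoc (f 0) ⌊ p ≤? M ⌋ true)
          (cong (f 0 xor_) (cong₂ _xor_ (≡-trans (≤?-true p≤M) (sym (≤?-true (m≤n⇒m≤1+n p≤M)))) (sym (≤?-true (≤-refl {suc M})))))))
  two-changes (suc M) ch | false with two-changes M ch
  ...   | p , q , p≤q , q≤M , h = p , q , p≤q , m≤n⇒m≤1+n q≤M , at
    where
    at : ∀ r → r ≤ suc M → f r ≡ f 0 xor inside p q r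
    at r r≤ with r ≤? M
    ... | yes r≤M = h r r≤M
    ... | no r≰M rewrite ≤-antisym r≤ (≰⇒> r≰M) = ≡-trans (same (f M) (f (suc M)) eq) (≡-trans (h M ≤-refl) (cong (f 0 xor_) (cong₂ _xor_
          (≡-trans (≤?-true (≤-trans p≤q q≤M)) (sym (≤?-true (m≤n⇒m≤1+n (≤-trans p≤q q≤M))))) (≡-trans (≤?-true q≤M) (sym (≤?-true (m≤n⇒m≤1+n q≤M)))))))

  -- A closed sequence cannot change exactly once.
  interval : ∀ M → changes f M ≤ 2 → f M ≡ f 0 → ∃[ p ] ∃[ q ] (p ≤ q × q ≤ M × ∀ r → r ≤ M → f r ≡ f 0 xor inside p q r)
  interval M le closed = by (changes f M) refl le
    where
    by : ∀ c → changes f M ≡ c → c ≤ 2 → ∃[ p ] ∃[ q ] (p ≤ q × q ≤ M × ∀ r → r ≤ M → f r ≡ f 0 xor inside p q r)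
    by zero                ch _ = 0 , 0 , z≤n , z≤n , λ r r≤ → ≡-trans (constant M ch r r≤) (sym (≡-trans (cong (f 0 xor_) (xor-same ⌊ 0 ≤? r ⌋)) (xor-identityʳ (f 0))))
    by (suc zero)          ch _ = let (q , q≤M , h) = one-change M ch in
      contradiction (≡-trans (sym (xor-cancelˡ (f 0) true)) (≡-trans (cong (f 0 xor_) (≡-trans (cong (f 0 xor_) (sym (≤?-true q≤M))) (≡-trans (sym (h M ≤-refl)) closed))) (xor-same (f 0)))) λ ()
    by (suc (suc zero))    ch _ = two-changes M ch
    by (suc (suc (suc _))) ch (s≤s (s≤s ()))

-- Duality of positions and gaps: an interval separates the ends of a chord exactly when the chord
-- covers one of its two end gaps.
inside-χ : ∀ p q s t → inside p q s xor inside p q t ≡ χ (s , t) p xor χ (s , t) q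
inside-χ p q s t = B.interchange ⌊ p ≤? s ⌋ ⌊ q ≤? s ⌋ ⌊ p ≤? t ⌋ ⌊ q ≤? t ⌋

inside-true : ∀ {p q r} → p ≤ q → inside p q r ≡ true → p ≤ r × r < q
inside-true {p} {q} {r} p≤q h with p ≤? r | q ≤? r
... | yes a | no b  = a , ≰⇒> b
... | no a  | yes b = contradiction (≤-trans p≤q b) a

inside-intro : ∀ {p q r} → p ≤ r → r < q → inside p q r ≡ true
inside-intro p≤r r<q = cong₂ _xor_ (≤?-true p≤r) (≤?-false r<q)

-- Convexity: an interval holding `i` and `k` contains `j`, and one holding `j` and `r` contains
-- `k`. So interleaved pairs cannot be pulled apart by an interval.
inside-noncrossing : ∀ {p q i j k r} → p ≤ q → i ≤ j → j ≤ k → k ≤ r →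
  inside p q i ≡ inside p q k → inside p q j ≡ inside p q r → inside p q i ≡ inside p q j
inside-noncrossing {p} {q} {i} {j} {k} {r} p≤q i≤j j≤k k≤r ik jr with inside p q i in eqi | inside p q j in eqj
... | true  | true  = refl
... | false | false = refl
... | true  | false = contradiction (≡-trans (sym eqj) (inside-intro (≤-trans (proj₁ (inside-true p≤q eqi)) i≤j) (≤-<-trans j≤k (proj₂ (inside-true p≤q (sym ik)))))) λ ()
... | false | true  = contradiction (≡-trans ik (inside-intro (≤-trans (proj₁ (inside-true p≤q eqj)) j≤k) (≤-<-trans k≤r (proj₂ (inside-true p≤q (sym jr)))))) λ ()

telescope-below : ∀ (u : ℕ → ℤ) s M → s ≤ M → Z.∑ (downFrom M) (λ r → (u (suc r) ℤ.- u r) ℤ.* ℤ.+ bit ⌊ suc r ≤? s ⌋) ≡ u s ℤ.- u 0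
telescope-below u zero zero z≤n = sym (ℤₚ.+-inverseʳ (u 0))
telescope-below u s (suc M) s≤ with suc M ≤? s
... | no s≰M = ≡-trans (cong (ℤ._+ Z.∑ (downFrom M) _) (ℤₚ.*-zeroʳ (u (suc M) ℤ.- u M))) (≡-trans (ℤₚ.+-identityˡ _) (telescope-below u s M (≤-pred (≰⇒> s≰M))))
... | yes M<s rewrite ≤-antisym s≤ M<s = ≡-trans (cong₂ ℤ._+_ (ℤₚ.*-identityʳ (u (suc M) ℤ.- u M))
        (≡-trans (Z.∑-cong∈ (downFrom M) (λ r r∈ → cong (λ z → (u (suc r) ℤ.- u r) ℤ.* ℤ.+ bit z) (≡-trans (≤?-true (m≤n⇒m≤1+n (downFrom-< r∈))) (sym (≤?-true (downFrom-< r∈)))))) (telescope-below u M M ≤-refl)))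
        (ring (u (suc M)) (u M) (u 0))
  where
  ring : ∀ a b c → (a ℤ.- b) ℤ.+ (b ℤ.- c) ≡ a ℤ.- c
  ring = ℤ-Solver.solve-∀

telescope-above : ∀ (u : ℕ → ℤ) t M → t ≤ M → Z.∑ (downFrom M) (λ r → (u (suc r) ℤ.- u r) ℤ.* ℤ.+ bit ⌊ t ≤? r ⌋) ≡ u M ℤ.- u t
telescope-above u zero zero z≤n = sym (ℤₚ.+-inverseʳ (u 0))
telescope-above u t (suc M) t≤ with t ≤? M
... | yes t≤M = ≡-trans (cong₂ ℤ._+_ (ℤₚ.*-identityʳ (u (suc M) ℤ.- u M)) (telescope-above u t M t≤M)) (ring (u (suc M)) (u M) (u t))
  where
  ring : ∀ a b c → (a ℤ.- b) ℤ.+ (b ℤ.- c) ≡ a ℤ.- c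
  ring = ℤ-Solver.solve-∀
... | no t≰M rewrite ≤-antisym t≤ (≰⇒> t≰M) = ≡-trans (cong (ℤ._+ Z.∑ (downFrom M) (λ r → (u (suc r) ℤ.- u r) ℤ.* ℤ.+ bit ⌊ suc M ≤? r ⌋)) (ℤₚ.*-zeroʳ (u (suc M) ℤ.- u M))) (≡-trans (ℤₚ.+-identityˡ _)
      (≡-trans (Z.∑-cong∈ (downFrom M) (λ r r∈ → ≡-trans (cong (λ z → (u (suc r) ℤ.- u r) ℤ.* ℤ.+ bit z) (≤?-false (m≤n⇒m≤1+n (downFrom-< r∈)))) (ℤₚ.*-zeroʳ (u (suc r) ℤ.- u r))))
        (≡-trans (Z.∑-0 (downFrom M)) (sym (ℤₚ.+-inverseʳ (u (suc M)))))))

∑-monoℤ : ∀ {A : Set} (xs : List A) {f g : A → ℤ} → (∀ x → x ∈ xs → f x ℤ.≤ g x) → Z.∑ xs f ℤ.≤ Z.∑ xs g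
∑-monoℤ []       h = ℤₚ.≤-refl
∑-monoℤ (x ∷ xs) h = ℤₚ.+-mono-≤ (h x (here refl)) (∑-monoℤ xs (λ y y∈ → h y (there y∈)))

-- Every Kalmanson metric δ is a nonnegative combination of cut metrics of cyclic intervals:
-- the interval between the gaps a < b gets the weight W a b.
module Kalmanson (δ : ℕ → ℕ → ℕ) (M : ℕ) (δ-refl : ∀ i → δ i i ≡ 0) (δ-sym : ∀ i k → δ i k ≡ δ k i)
                 (δ-cyclic : ∀ k → δ M k ≡ δ 0 k)
                 (kalmanson : ∀ i j k r → i ≤ j → j ≤ k → k ≤ r → r ≤ M → δ i r + δ j k ≤ δ i k + δ j r) where
  g : ℕ → ℕ → ℤ
  g a b = ℤ.+ δ a b

  -- The mixed second difference of `δ`. The interval weighted consists of the positions `a + 1` to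
  -- `b`, so its end gaps are `suc a` and `suc b`.
  W : ℕ → ℕ → ℤ
  W a b = (g (suc a) (suc b) ℤ.- g (suc a) b) ℤ.- (g a (suc b) ℤ.- g a b)

  W-nonneg : ∀ {a b} → a < b → b < M → ℤ.0ℤ ℤ.≤ W a b
  W-nonneg {a} {b} a<b b<M = subst (ℤ.0ℤ ℤ.≤_) (ring (g a b) (g (suc a) (suc b)) (g a (suc b)) (g (suc a) b))
    (ℤₚ.i≤j⇒0≤j-i (ℤ.+≤+ (kalmanson a (suc a) b (suc b) (n≤1+n a) a<b (n≤1+n b) b<M)))
    where
    ring : ∀ x y z w → (x ℤ.+ y) ℤ.- (z ℤ.+ w) ≡ (y ℤ.- w) ℤ.- (z ℤ.- x)
    ring = ℤ-Solver.solve-∀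

  Φ : (ℕ → ℕ → ℕ) → ℤ
  Φ c = Z.∑ (downFrom M) (λ b → Z.∑ (downFrom b) (λ a → W a b ℤ.* ℤ.+ c a b))

  rect : ℕ → ℕ → ℕ → ℕ → ℕ
  rect s t a b = bit ⌊ suc a ≤? s ⌋ * bit ⌊ t ≤? b ⌋

  -- None of the weighted intervals contains position 0. Those containing both `s` and `t` have
  -- total weight twice the Gromov product of `s` and `t` at 0, by telescoping in both variables.
  rectangle : ∀ s t → s ≤ t → t ≤ M → Φ (rect s t) ≡ g 0 s ℤ.+ g 0 t ℤ.- g s t
  rectangle s t s≤t t≤M = begin
    Φ (rect s t)
      ≡⟨ Z.∑-cong (downFrom M) inner ⟩
    Z.∑ (downFrom M) (λ b → (h (suc b) ℤ.- h b) ℤ.* ℤ.+ bit ⌊ t ≤? b ⌋)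
      ≡⟨ telescope-above h t M t≤M ⟩
    (g s M ℤ.- g 0 M) ℤ.- (g s t ℤ.- g 0 t)
      ≡⟨ cong₂ (λ x y → (x ℤ.- y) ℤ.- (g s t ℤ.- g 0 t)) (cong ℤ.+_ (≡-trans (δ-sym s M) (δ-cyclic s))) (cong ℤ.+_ (≡-trans (δ-sym 0 M) (≡-trans (δ-cyclic 0) (δ-refl 0)))) ⟩
    (g 0 s ℤ.- ℤ.0ℤ) ℤ.- (g s t ℤ.- g 0 t)
      ≡⟨ ring (g 0 s) (g s t) (g 0 t) ⟩
    g 0 s ℤ.+ g 0 t ℤ.- g s t ∎
    where
    open ≡-Reasoning
    h : ℕ → ℤ
    h b = g s b ℤ.- g 0 b
    ring : ∀ x y z → (x ℤ.- ℤ.0ℤ) ℤ.- (y ℤ.- z) ≡ x ℤ.+ z ℤ.- y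
    ring = ℤ-Solver.solve-∀
    inner : ∀ b → Z.∑ (downFrom b) (λ a → W a b ℤ.* ℤ.+ rect s t a b) ≡ (h (suc b) ℤ.- h b) ℤ.* ℤ.+ bit ⌊ t ≤? b ⌋
    inner b with t ≤? b
    ... | no _ = ≡-trans (Z.∑-cong (downFrom b) (λ a → ≡-trans (cong (λ z → W a b ℤ.* ℤ.+ z) (*-zeroʳ (bit ⌊ suc a ≤? s ⌋))) (ℤₚ.*-zeroʳ (W a b))))
                   (≡-trans (Z.∑-0 (downFrom b)) (sym (ℤₚ.*-zeroʳ (h (suc b) ℤ.- h b))))
    ... | yes t≤b = ≡-trans (Z.∑-cong (downFrom b) (λ a → cong (λ z → W a b ℤ.* ℤ.+ z) (*-identityʳ (bit ⌊ suc a ≤? s ⌋))))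
                   (≡-trans (telescope-below (λ a → g a (suc b) ℤ.- g a b) s b (≤-trans s≤t t≤b))
                     (ring' (g s (suc b)) (g s b) (g 0 (suc b)) (g 0 b)))
      where
      ring' : ∀ x y z w → (x ℤ.- y) ℤ.- (z ℤ.- w) ≡ ((x ℤ.- z) ℤ.- (y ℤ.- w)) ℤ.* ℤ.1ℤ
      ring' = ℤ-Solver.solve-∀

  Φ-+ : ∀ c c' → Φ (λ a b → c a b + c' a b) ≡ Φ c ℤ.+ Φ c'
  Φ-+ c c' = ≡-trans (Z.∑-cong (downFrom M) (λ b → ≡-trans (Z.∑-cong (downFrom b) (λ a → ℤₚ.*-distribˡ-+ (W a b) (ℤ.+ c a b) (ℤ.+ c' a b))) (Z.∑-+ (downFrom b) _ _))) (Z.∑-+ (downFrom M) _ _)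

  Φ-cong : ∀ {c c'} → (∀ a b → a < b → b < M → c a b ≡ c' a b) → Φ c ≡ Φ c'
  Φ-cong h = Z.∑-cong∈ (downFrom M) (λ b b∈ → Z.∑-cong∈ (downFrom b) (λ a a∈ → cong (λ z → W a b ℤ.* ℤ.+ z) (h a b (downFrom-< a∈) (downFrom-< b∈))))

  Φ-mono : ∀ {c c'} → (∀ a b → a < b → b < M → c a b ≤ c' a b) → Φ c ℤ.≤ Φ c'
  Φ-mono h = ∑-monoℤ (downFrom M) (λ b b∈ → ∑-monoℤ (downFrom b) (λ a a∈ → mul (W-nonneg (downFrom-< a∈) (downFrom-< b∈)) (h a b (downFrom-< a∈) (downFrom-< b∈))))
    where
    mul : ∀ {w c c'} → ℤ.0ℤ ℤ.≤ w → c ≤ c' → w ℤ.* ℤ.+ c ℤ.≤ w ℤ.* ℤ.+ c'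
    mul {ℤ.+ k} _ le = ℤₚ.*-monoˡ-≤-nonNeg (ℤ.+ k) (ℤ.+≤+ le)

  -- [s ∈ I] + [t ∈ I] = [I separates s, t] + 2 [s, t ∈ I]
  split-cut : ∀ s t a b → s ≤ t → a < b → bit (χ (s , t) (suc a) xor χ (s , t) (suc b)) + (rect s t a b + rect s t a b) ≡ rect s s a b + rect t t a b
  split-cut s t a b s≤t a<b rewrite +-identityʳ 0
    with suc a ≤? s | suc a ≤? t | suc b ≤? s | suc b ≤? t | s ≤? b | t ≤? b
  ... | _ | _ | yes p | _ | yes q | _ = contradiction (≤-trans p q) 1+n≰n
  ... | _ | _ | no p  | _ | no q | _ = contradiction (≰⇒> q) p
  ... | _ | _ | _ | yes p | _ | yes q = contradiction (≤-trans p q) 1+n≰n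
  ... | _ | _ | _ | no p  | _ | no q = contradiction (≰⇒> q) p
  ... | yes p | no q | _ | _ | _ | _ = contradiction (≤-trans p s≤t) q
  ... | _ | _ | yes p | no q | _ | _ = contradiction (≤-trans p s≤t) q
  ... | no p | _ | yes q | _ | _ | _ = contradiction (≤-trans (m≤n⇒m≤1+n a<b) q) p
  ... | _ | no p | _ | yes q | _ | _ = contradiction (≤-trans (m≤n⇒m≤1+n a<b) q) p
  ... | yes _ | yes _ | yes _ | yes _ | no _  | no _  = refl
  ... | yes _ | yes _ | no _  | yes _ | yes _ | no _  = refl
  ... | yes _ | yes _ | no _  | no _  | yes _ | yes _ = refl
  ... | no _  | yes _ | no _  | yes _ | yes _ | no _  = refl
  ... | no _  | yes _ | no _  | no _  | yes _ | yes _ = refl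
  ... | no _  | no _  | no _  | no _  | yes _ | yes _ = refl

  Proper : ℕ × ℕ → Set
  Proper (s , t) = s ≤ t × t ≤ M

  -- Summing `split-cut` cancels the distances from 0. The factor 2 stems from the doubled Gromov
  -- products.
  pair-sum : ∀ c → Proper c → Φ (λ a b → bit (χ c (suc a) xor χ c (suc b))) ≡ ℤ.+ (2 * δ (proj₁ c) (proj₂ c))
  pair-sum (s , t) (s≤t , t≤M) = cancel (begin
    Φ cutc ℤ.+ (Φ (rect s t) ℤ.+ Φ (rect s t))       ≡⟨ cong (ℤ._+_ (Φ cutc)) (sym (Φ-+ (rect s t) (rect s t))) ⟩
    Φ cutc ℤ.+ Φ (λ a b → rect s t a b + rect s t a b) ≡⟨ sym (Φ-+ cutc _) ⟩
    Φ (λ a b → cutc a b + (rect s t a b + rect s t a b)) ≡⟨ Φ-cong (λ a b a<b _ → split-cut s t a b s≤t a<b) ⟩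
    Φ (λ a b → rect s s a b + rect t t a b)            ≡⟨ Φ-+ (rect s s) (rect t t) ⟩
    Φ (rect s s) ℤ.+ Φ (rect t t)                      ≡⟨ cong₂ ℤ._+_ (rectangle s s ≤-refl (≤-trans s≤t t≤M)) (rectangle t t ≤-refl t≤M) ⟩
    (g 0 s ℤ.+ g 0 s ℤ.- g s s) ℤ.+ (g 0 t ℤ.+ g 0 t ℤ.- g t t) ≡⟨ cong₂ (λ x y → (g 0 s ℤ.+ g 0 s ℤ.- x) ℤ.+ (g 0 t ℤ.+ g 0 t ℤ.- y)) (cong ℤ.+_ (δ-refl s)) (cong ℤ.+_ (δ-refl t)) ⟩
    (g 0 s ℤ.+ g 0 s ℤ.- ℤ.0ℤ) ℤ.+ (g 0 t ℤ.+ g 0 t ℤ.- ℤ.0ℤ) ≡⟨ ring (g 0 s) (g 0 t) (g s t) ⟩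
    (g s t ℤ.+ g s t) ℤ.+ ((g 0 s ℤ.+ g 0 t ℤ.- g s t) ℤ.+ (g 0 s ℤ.+ g 0 t ℤ.- g s t)) ≡⟨ cong (λ z → (g s t ℤ.+ g s t) ℤ.+ (z ℤ.+ z)) (sym (rectangle s t s≤t t≤M)) ⟩
    (g s t ℤ.+ g s t) ℤ.+ (Φ (rect s t) ℤ.+ Φ (rect s t)) ∎)
    where
    open ≡-Reasoning
    cutc : ℕ → ℕ → ℕ
    cutc a b = bit (χ (s , t) (suc a) xor χ (s , t) (suc b))
    ring : ∀ x y z → (x ℤ.+ x ℤ.- ℤ.0ℤ) ℤ.+ (y ℤ.+ y ℤ.- ℤ.0ℤ) ≡ (z ℤ.+ z) ℤ.+ ((x ℤ.+ y ℤ.- z) ℤ.+ (x ℤ.+ y ℤ.- z))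
    ring = ℤ-Solver.solve-∀
    cancel : Φ cutc ℤ.+ (Φ (rect s t) ℤ.+ Φ (rect s t)) ≡ (g s t ℤ.+ g s t) ℤ.+ (Φ (rect s t) ℤ.+ Φ (rect s t)) → Φ cutc ≡ ℤ.+ (2 * δ s t)
    cancel h = ≡-trans (ℤₚ.≤-antisym (ℤ-cancelʳ-≤ _ (ℤₚ.≤-reflexive h)) (ℤ-cancelʳ-≤ _ (ℤₚ.≤-reflexive (sym h)))) (cong (λ z → ℤ.+ (δ s t + z)) (sym (+-identityʳ (δ s t))))

  total : List (ℕ × ℕ) → ℕ
  total X = N.∑ X (λ c → δ (proj₁ c) (proj₂ c))

  list-sum : ∀ X → All Proper X → Φ (λ a b → cross X (suc a) (suc b)) ≡ ℤ.+ (2 * total X)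
  list-sum [] [] = ≡-trans (Z.∑-cong (downFrom M) (λ b → ≡-trans (Z.∑-cong (downFrom b) (λ a → ℤₚ.*-zeroʳ (W a b))) (Z.∑-0 (downFrom b)))) (Z.∑-0 (downFrom M))
  list-sum (c ∷ X) (pc ∷ pX) = ≡-trans (Φ-+ (λ a b → bit (χ c (suc a) xor χ c (suc b))) (λ a b → cross X (suc a) (suc b)))
    (≡-trans (cong₂ ℤ._+_ (pair-sum c pc) (list-sum X pX)) (cong ℤ.+_ (sym (*-distribˡ-+ 2 (δ (proj₁ c) (proj₂ c)) (total X)))))

  total-mono : ∀ X Y → All Proper X → All Proper Y → (∀ p q → p ≤ q → q ≤ M → cross X p q ≤ cross Y p q) → total X ≤ total Y
  total-mono X Y pX pY h = *-cancelˡ-≤ 2 (ℤₚ.drop‿+≤+ (subst₂ ℤ._≤_ (list-sum X pX) (list-sum Y pY)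
    (Φ-mono (λ a b a<b b<M → h (suc a) (suc b) (s≤s (<⇒≤ a<b)) b<M))))

-- Noncrossing chords with prescribed loads
load : List (ℕ × ℕ) → ℕ → ℕ
load X r = N.∑ X (λ c → bit (χ c r))

χ-in : ∀ {s t r} → s < r → r ≤ t → χ (s , t) r ≡ true
χ-in s<r r≤t = cong₂ _xor_ (≤?-false s<r) (≤?-true r≤t)

χ-left : ∀ {s t r} → s ≤ t → r ≤ s → χ (s , t) r ≡ false
χ-left s≤t r≤s = cong₂ _xor_ (≤?-true r≤s) (≤?-true (≤-trans r≤s s≤t))

χ-right : ∀ {s t r} → s ≤ t → t < r → χ (s , t) r ≡ false
χ-right s≤t t<r = cong₂ _xor_ (≤?-false (≤-<-trans s≤t t<r)) (≤?-false t<r)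

χ-true : ∀ {s t r} → s ≤ t → χ (s , t) r ≡ true → s < r × r ≤ t
χ-true {s} {t} {r} s≤t h with r ≤? s | r ≤? t
... | no a  | yes b = ≰⇒> a , b
... | yes a | no b  = contradiction (≤-trans a s≤t) b

χ-convex : ∀ {c p r q} → proj₁ c ≤ proj₂ c → p ≤ r → r ≤ q → χ c p ≡ true → χ c q ≡ true → χ c r ≡ true
χ-convex st p≤r r≤q hp hq = χ-in (<-≤-trans (proj₁ (χ-true st hp)) p≤r) (≤-trans r≤q (proj₂ (χ-true st hq)))

-- A pair covering `p` and `q` covers every gap `r` between them. This holds for any family of
-- pairs; `Peel-upper` reverses it for peeled ones.
load-lower : ∀ X {p r q} → All (λ c → proj₁ c ≤ proj₂ c) X → p ≤ r → r ≤ q → load X p + load X q ≤ cross X p q + 2 * load X r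
load-lower X {p} {r} {q} proper p≤r r≤q = begin
  load X p + load X q                                          ≡⟨ sym (N.∑-+ X _ _) ⟩
  N.∑ X (λ c → bit (χ c p) + bit (χ c q))                      ≤⟨ ∑-mono∈ X (λ c c∈ → point (χ c p) (χ c q) (χ c r) (χ-convex {c} {p} {r} {q} (All.lookup proper c∈) p≤r r≤q)) ⟩
  N.∑ X (λ c → bit (χ c p xor χ c q) + 2 * bit (χ c r))        ≡⟨ N.∑-+ X _ _ ⟩
  cross X p q + N.∑ X (λ c → 2 * bit (χ c r))                  ≡⟨ cong (cross X p q +_) (N.∑-*ˡ X 2 _) ⟩
  cross X p q + 2 * load X r                                   ∎
  where
  open ≤-Reasoning
  point : ∀ a b c → (a ≡ true → b ≡ true → c ≡ true) → bit a + bit b ≤ bit (a xor b) + 2 * bit c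
  point true  true  c h rewrite h refl refl = ≤-refl
  point true  false c h = s≤s z≤n
  point false b     c h = m≤m+n _ _

-- A load h is realised by peeling off a chord under a strict local maximum plateau of h.
data Peel (M : ℕ) : (ℕ → ℕ) → List (ℕ × ℕ) → Set where
  flat : ∀ {h} → (∀ r → r ≤ M → h r ≡ 0) → Peel M h []
  peel : ∀ {h h' X s t} v → s < t → t < M → (∀ r → s < r → r ≤ t → h r ≡ v) → h s < v → h (suc t) < v →
         (∀ r → h r ≡ bit (χ (s , t) r) + h' r) → Peel M h' X → Peel M h ((s , t) ∷ X)

Peel-proper : ∀ {M h X} → Peel M h X → All (λ c → proj₁ c ≤ proj₂ c × proj₂ c ≤ M) X
Peel-proper (flat _) = []
Peel-proper (peel v s<t t<M _ _ _ _ P) = (<⇒≤ s<t , <⇒≤ t<M) ∷ Peel-proper P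

Peel-load : ∀ {M h X} → Peel M h X → ∀ r → r ≤ M → load X r ≡ h r
Peel-load (flat z) r r≤M = sym (z r r≤M)
Peel-load (peel {s = s} {t} v _ _ _ _ _ h≡ P) r r≤M = ≡-trans (cong (bit (χ (s , t) r) +_) (Peel-load P r r≤M)) (sym (h≡ r))

-- With `load-lower` this determines the crossing numbers of a peeled family: the loads at the ends
-- minus twice the least load between. The witness `r` for the smaller load is kept unless the
-- peeled chord covers it without covering both ends.
Peel-upper : ∀ {M h X} → Peel M h X → ∀ p q → p ≤ q → q ≤ M → ∃[ r ] (p ≤ r × r ≤ q × cross X p q + 2 * h r ≤ h p + h q)
Peel-upper (flat z) p q p≤q q≤M = p , ≤-refl , p≤q , ≤-trans (≤-reflexive (cong (2 *_) (z p (≤-trans p≤q q≤M)))) z≤n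
Peel-upper {M} {h} (peel {h' = h'} {X} {s} {t} v s<t t<M plateau hs ht h≡ P) p q p≤q q≤M with Peel-upper P p q p≤q q≤M
... | r , p≤r , r≤q , le with χ (s , t) p in χp | χ (s , t) q in χq | χ (s , t) r in χr
... | true | true | _ = r , p≤r , r≤q , (begin
      cross X p q + 2 * h r             ≡⟨ cong (λ z → cross X p q + 2 * z) hr ⟩
      cross X p q + 2 * (1 + h' r)      ≡⟨ ring (cross X p q) (h' r) ⟩
      2 + (cross X p q + 2 * h' r)      ≤⟨ +-monoʳ-≤ 2 le ⟩
      2 + (h' p + h' q)                 ≡⟨ ring' (h' p) (h' q) ⟩
      (1 + h' p) + (1 + h' q)           ≡⟨ sym (cong₂ _+_ (≡-trans (h≡ p) (cong (λ z → bit z + h' p) χp)) (≡-trans (h≡ q) (cong (λ z → bit z + h' q) χq))) ⟩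
      h p + h q                         ∎)
  where
  open ≤-Reasoning
  ring : ∀ x y → x + 2 * (1 + y) ≡ 2 + (x + 2 * y)
  ring = ℕ-Solver.solve-∀
  ring' : ∀ x y → 2 + (x + y) ≡ (1 + x) + (1 + y)
  ring' = ℕ-Solver.solve-∀
  hr : h r ≡ 1 + h' r
  hr = ≡-trans (h≡ r) (cong (λ z → bit z + h' r) (χ-convex {s , t} {p} {r} {q} (<⇒≤ s<t) p≤r r≤q χp χq))
... | χp' | χq' | false = r , p≤r , r≤q , notboth χp' χq' χp χq (≤-trans (≤-reflexive (cong (λ z → cross X p q + 2 * z) (≡-trans (h≡ r) (cong (λ z → bit z + h' r) χr)))) le)
  where
  notboth : ∀ a b → χ (s , t) p ≡ a → χ (s , t) q ≡ b → ∀ {k} → cross X p q + k ≤ h' p + h' q → bit (a xor b) + cross X p q + k ≤ h p + h q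
  notboth a b pa qb {k} le = ≤-trans (≤-reflexive (+-assoc (bit (a xor b)) _ k)) (≤-trans (+-mono-≤ (bit-xor-≤ a b) le)
    (≤-reflexive (≡-trans (ring (bit a) (bit b) (h' p) (h' q)) (sym (cong₂ _+_ (≡-trans (h≡ p) (cong (λ z → bit z + h' p) pa)) (≡-trans (h≡ q) (cong (λ z → bit z + h' q) qb)))))))
    where
    ring : ∀ a b c d → a + b + (c + d) ≡ (a + c) + (b + d)
    ring = ℕ-Solver.solve-∀
Peel-upper {M} {h} (peel {h' = h'} {X} {s} {t} v s<t t<M plateau hs ht h≡ P) p q p≤q q≤M | r , p≤r , r≤q , le | false | χq' | true =
    -- The peeled chord covers `r` but not `p`. The witness moves to `s`, left of the plateau, where
    -- `h` is below `v` and so at most `h' r`; in the next case it moves to `suc t`.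
    s , ≮⇒≥ (λ s<p → contradiction (≡-trans (sym χp) (χ-in s<p (≤-trans p≤r (proj₂ sr)))) λ ()) , ≤-trans (<⇒≤ (proj₁ sr)) r≤q ,
    ≤-trans (≤-reflexive (+-assoc (bit χq') _ _)) (≤-trans (+-monoʳ-≤ (bit χq') (≤-trans (+-monoʳ-≤ (cross X p q) (*-monoʳ-≤ 2 low)) le))
      (≤-reflexive (≡-trans (ring (bit χq') (h' p) (h' q)) (sym (cong₂ _+_ (≡-trans (h≡ p) (cong (λ z → bit z + h' p) χp)) (≡-trans (h≡ q) (cong (λ z → bit z + h' q) χq)))))))
  where
  sr = χ-true (<⇒≤ s<t) χr
  low : h s ≤ h' r
  low = ≤-pred (≤-trans hs (≤-reflexive (≡-trans (sym (plateau r (proj₁ sr) (proj₂ sr))) (≡-trans (h≡ r) (cong (λ z → bit z + h' r) χr)))))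
  ring : ∀ b c d → b + (c + d) ≡ (0 + c) + (b + d)
  ring = ℕ-Solver.solve-∀
Peel-upper {M} {h} (peel {h' = h'} {X} {s} {t} v s<t t<M plateau hs ht h≡ P) p q p≤q q≤M | r , p≤r , r≤q , le | true | false | true =
    suc t , ≤-trans p≤r (m≤n⇒m≤1+n (proj₂ sr)) , ≰⇒> (λ q≤t → contradiction (≡-trans (sym χq) (χ-in (<-≤-trans (proj₁ sr) r≤q) q≤t)) λ ()) ,
    s≤s (≤-trans (≤-trans (+-monoʳ-≤ (cross X p q) (*-monoʳ-≤ 2 low)) le) (≤-reflexive refl)) ⟫ ≤-reflexive (sym (cong₂ _+_ (≡-trans (h≡ p) (cong (λ z → bit z + h' p) χp)) (≡-trans (h≡ q) (cong (λ z → bit z + h' q) χq))))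
  where
  _⟫_ : ∀ {a b c : ℕ} → a ≤ b → b ≤ c → a ≤ c
  _⟫_ = ≤-trans
  sr = χ-true (<⇒≤ s<t) χr
  low : h (suc t) ≤ h' r
  low = ≤-pred (≤-trans ht (≤-reflexive (≡-trans (sym (plateau r (proj₁ sr) (proj₂ sr))) (≡-trans (h≡ r) (cong (λ z → bit z + h' r) χr)))))

argmax : ∀ (h : ℕ → ℕ) M → ∃[ r ] (r ≤ M × ∀ x → x ≤ M → h x ≤ h r)
argmax h zero = 0 , z≤n , λ { zero z≤n → ≤-refl }
argmax h (suc M) with argmax h M
... | r , r≤M , mx with ≤-total (h r) (h (suc M))
...   | inj₁ up = suc M , ≤-refl , all
  where
  all : ∀ x → x ≤ suc M → h x ≤ h (suc M)
  all x x≤ with x ≤? M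
  ... | yes x≤M = ≤-trans (mx x x≤M) up
  ... | no x≰M rewrite ≤-antisym x≤ (≰⇒> x≰M) = ≤-refl
...   | inj₂ dn = r , m≤n⇒m≤1+n r≤M , all
  where
  all : ∀ x → x ≤ suc M → h x ≤ h r
  all x x≤ with x ≤? M
  ... | yes x≤M = mx x x≤M
  ... | no x≰M rewrite ≤-antisym x≤ (≰⇒> x≰M) = dn

plateau-right : ∀ (h : ℕ → ℕ) v k r → h r ≡ v → h (r + k) ≢ v → ∃[ t ] (r ≤ t × t < r + k × (∀ x → r ≤ x → x ≤ t → h x ≡ v) × h (suc t) ≢ v)
plateau-right h v zero    r hr ne = contradiction (≡-trans (cong h (+-identityʳ r)) hr) ne
plateau-right h v (suc k) r hr ne with h (suc r) ℕ.≟ v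
... | no ¬p = r , ≤-refl , ≤-trans (s≤s (m≤m+n r k)) (≤-reflexive (sym (+-suc r k))) , (λ x a b → ≡-trans (cong h (≤-antisym b a)) hr) , ¬p
... | yes p with plateau-right h v k (suc r) p (λ e → ne (≡-trans (cong h (+-suc r k)) e))
...   | t , r<t , t< , flat' , end = t , <⇒≤ r<t , <-≤-trans t< (≤-reflexive (sym (+-suc r k))) , all , end
  where
  all : ∀ x → r ≤ x → x ≤ t → h x ≡ v
  all x r≤x x≤t with r ℕ.≟ x
  ... | yes refl = hr
  ... | no r≢x   = flat' x (≤∧≢⇒< r≤x r≢x) x≤t

plateau-left : ∀ (h : ℕ → ℕ) v r → h r ≡ v → h 0 ≢ v → ∃[ s ] (s < r × (∀ x → s < x → x ≤ r → h x ≡ v) × h s ≢ v)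
plateau-left h v zero    hr ne = contradiction hr ne
plateau-left h v (suc r) hr ne with h r ℕ.≟ v
... | no ¬p = r , ≤-refl , (λ x a b → ≡-trans (cong h (≤-antisym b a)) hr) , ¬p
... | yes p with plateau-left h v r p ne
...   | s , s<r , flat' , end = s , m≤n⇒m≤1+n s<r , all , end
  where
  all : ∀ x → s < x → x ≤ suc r → h x ≡ v
  all x s<x x≤ with x ≤? r
  ... | yes x≤r = flat' x s<x x≤r
  ... | no x≰r rewrite ≤-antisym x≤ (≰⇒> x≰r) = hr

-- The plateau of a maximum ends on both sides because `h` vanishes at 0 and at `M`; outside it `h`
-- is strictly smaller by maximality.
peelable : ∀ M h → Acc _<_ (N.∑ (downFrom (suc M)) h) → h 0 ≡ 0 → h M ≡ 0 → ∃[ X ] Peel M h X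
peelable M h (acc rs) h0 hM with argmax h M
... | r , r≤M , mx with h r ℕ.≟ 0
...   | yes z  = [] , flat (λ x x≤M → n≤0⇒n≡0 (≤-trans (mx x x≤M) (≤-reflexive z)))
...   | no hr≢0 with plateau-left h (h r) r refl (λ e → hr≢0 (≡-trans (sym e) h0))
                   | plateau-right h (h r) (M ∸ r) r refl (λ e → hr≢0 (≡-trans (sym e) (≡-trans (cong h (m+[n∸m]≡n r≤M)) hM)))
...     | s , s<r , flatˡ , endˡ | t , r≤t , t< , flatʳ , endʳ =
          let (X , P) = peelable M h' (rs smaller) (cong (_∸ bit (χ (s , t) 0)) h0 ⟨≡⟩ 0∸ (bit (χ (s , t) 0))) (cong (_∸ bit (χ (s , t) M)) hM ⟨≡⟩ 0∸ (bit (χ (s , t) M)))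
          in (s , t) ∷ X , peel (h r) s<t t<M plateau (≤∧≢⇒< (mx s (<⇒≤ (<-≤-trans s<r r≤M))) endˡ) (≤∧≢⇒< (mx (suc t) t<M) endʳ) split P
  where
  _⟨≡⟩_ : ∀ {a b c : ℕ} → a ≡ b → b ≡ c → a ≡ c
  _⟨≡⟩_ = ≡-trans
  0∸ : ∀ k → 0 ∸ k ≡ 0
  0∸ zero    = refl
  0∸ (suc k) = refl
  s<t : s < t
  s<t = <-≤-trans s<r r≤t
  t<M : t < M
  t<M = <-≤-trans t< (≤-reflexive (m+[n∸m]≡n r≤M))
  plateau : ∀ x → s < x → x ≤ t → h x ≡ h r
  plateau x s<x x≤t with x ≤? r
  ... | yes x≤r = flatˡ x s<x x≤r
  ... | no x≰r  = flatʳ x (<⇒≤ (≰⇒> x≰r)) x≤t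
  h' : ℕ → ℕ
  h' x = h x ∸ bit (χ (s , t) x)
  split : ∀ x → h x ≡ bit (χ (s , t) x) + h' x
  split x with χ (s , t) x in eq
  ... | false = refl
  ... | true  = sym (m+[n∸m]≡n (≤-trans (positive (h r) hr≢0) (≤-reflexive (sym (plateau x (proj₁ (χ-true (<⇒≤ s<t) eq)) (proj₂ (χ-true (<⇒≤ s<t) eq)))))))
    where
    positive : ∀ k → k ≢ 0 → 1 ≤ k
    positive zero    ne = contradiction refl ne
    positive (suc k) _  = s≤s z≤n
  smaller : N.∑ (downFrom (suc M)) h' < N.∑ (downFrom (suc M)) h
  smaller = ∑-strict (downFrom (suc M)) (λ x → m∸n≤m (h x) (bit (χ (s , t) x))) {r} (mem M r≤M) (≤-reflexive (sym (≡-trans (split r) (cong (λ z → bit z + h' r) (χ-in s<r r≤t)))))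
    where
    mem : ∀ M → r ≤ M → r ∈ downFrom (suc M)
    mem M le with r ℕ.≟ M
    ... | yes refl = here refl
    mem zero    z≤n | no ne = contradiction refl ne
    mem (suc M) le  | no ne = there (mem M (≤-pred (≤∧≢⇒< le ne)))

-- Separable demands on a cycle
minTo : (ℕ → ℕ) → ℕ → ℕ
minTo f zero    = f 0
minTo f (suc k) = f (suc k) ⊓ minTo f k

minTo-≤ : ∀ f k p → p ≤ k → minTo f k ≤ f p
minTo-≤ f zero    zero z≤n = ≤-refl
minTo-≤ f (suc k) p p≤ with p ≤? k
... | yes p≤k = ≤-trans (m⊓n≤n (f (suc k)) _) (minTo-≤ f k p p≤k)
... | no p≰k rewrite ≤-antisym p≤ (≰⇒> p≰k) = m⊓n≤m (f (suc k)) _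

minTo-attained : ∀ f k → ∃[ p ] (p ≤ k × minTo f k ≡ f p)
minTo-attained f zero    = 0 , z≤n , refl
minTo-attained f (suc k) with ⊓-sel (f (suc k)) (minTo f k)
... | inj₁ eq = suc k , ≤-refl , eq
... | inj₂ eq = let (p , p≤k , e) = minTo-attained f k in p , m≤n⇒m≤1+n p≤k , ≡-trans eq e

cross-refl : ∀ X p → cross X p p ≡ 0
cross-refl X p = ≡-trans (N.∑-cong X (λ c → cong bit (xor-same (χ c p)))) (N.∑-0 X)

-- All pairs of X join a position before ℓ to one not before ℓ.  XN carries the loads of X by
-- nested chords; XL carries the loads hL r, the fewest pairs that an interval from a gap before ℓ
-- to the gap r can separate.
module Separable (X : List (ℕ × ℕ)) (ℓ M : ℕ) (ℓ≤M : ℓ ≤ M)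
                 (sep : All (λ c → proj₁ c < ℓ × ℓ ≤ proj₂ c × proj₂ c < M) X) where
  ordered : All (λ c → proj₁ c ≤ proj₂ c) X
  ordered = All.map (λ { (a , b , _) → <⇒≤ (<-≤-trans a b) }) sep

  hL : ℕ → ℕ
  hL r = minTo (λ p → cross X p r) ℓ

  load-0 : load X 0 ≡ 0
  load-0 = ≡-trans (N.∑-cong∈ X (λ c c∈ → cong bit (χ-left (All.lookup ordered c∈) z≤n))) (N.∑-0 X)

  load-M : load X M ≡ 0
  load-M = ≡-trans (N.∑-cong∈ X (λ c c∈ → cong bit (χ-right (All.lookup ordered c∈) (proj₂ (proj₂ (All.lookup sep c∈)))))) (N.∑-0 X)

  -- The empty interval competes in the minimum. Hence all chords of `XL` have both ends at or
  -- beyond `ℓ`.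
  hL-low : ∀ r → r ≤ ℓ → hL r ≡ 0
  hL-low r r≤ℓ = n≤0⇒n≡0 (≤-trans (minTo-≤ (λ p → cross X p r) ℓ r r≤ℓ) (≤-reflexive (cross-refl X r)))

  hL-M : hL M ≡ 0
  hL-M = n≤0⇒n≡0 (≤-trans (minTo-≤ (λ p → cross X p M) ℓ 0 z≤n) (≤-reflexive (≡-trans (N.∑-cong∈ X (λ c c∈ → cong bit (cong₂ _xor_
    (χ-left (All.lookup ordered c∈) z≤n) (χ-right (All.lookup ordered c∈) (proj₂ (proj₂ (All.lookup sep c∈))))))) (N.∑-0 X))))

  nested = peelable M (load X) (<-wellFounded _) load-0 load-M
  local  = peelable M hL (<-wellFounded _) (hL-low 0 z≤n) hL-M

  XN XL : List (ℕ × ℕ)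
  XN = proj₁ nested
  XL = proj₁ local

  lowerN : ∀ p r q → p ≤ r → r ≤ q → q ≤ M → load X p + load X q ≤ cross XN p q + 2 * load X r
  lowerN p r q p≤r r≤q q≤M = subst₂ _≤_ (cong₂ _+_ (eq p (≤-trans p≤r (≤-trans r≤q q≤M))) (eq q q≤M)) (cong (λ z → cross XN p q + 2 * z) (eq r (≤-trans r≤q q≤M)))
    (load-lower XN (All.map proj₁ (Peel-proper (proj₂ nested))) p≤r r≤q)
    where
    eq : ∀ x → x ≤ M → load XN x ≡ load X x
    eq = Peel-load (proj₂ nested)

  lowerL : ∀ p r q → p ≤ r → r ≤ q → q ≤ M → hL p + hL q ≤ cross XL p q + 2 * hL r
  lowerL p r q p≤r r≤q q≤M = subst₂ _≤_ (cong₂ _+_ (eq p (≤-trans p≤r (≤-trans r≤q q≤M))) (eq q q≤M)) (cong (λ z → cross XL p q + 2 * z) (eq r (≤-trans r≤q q≤M)))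
    (load-lower XL (All.map proj₁ (Peel-proper (proj₂ local))) p≤r r≤q)
    where
    eq : ∀ x → x ≤ M → load XL x ≡ hL x
    eq = Peel-load (proj₂ local)

  -- `X` and `XN` have the same loads: `X` obeys the lower bound for every `r`, and `XN` attains it
  -- at some `r`.
  nested-dominated : ∀ p q → p ≤ q → q ≤ M → cross XN p q ≤ cross X p q
  nested-dominated p q p≤q q≤M with Peel-upper (proj₂ nested) p q p≤q q≤M
  ... | r , p≤r , r≤q , le = +-cancelʳ-≤ (2 * load X r) _ _ (≤-trans le (load-lower X ordered p≤r r≤q))

  -- Every pair covers the gap `ℓ`, so moving towards `ℓ` can only add covering pairs.
  rising : ∀ {c p q} → c ∈ X → p ≤ q → q ≤ ℓ → χ c p ≡ true → χ c q ≡ true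
  rising c∈ p≤q q≤ℓ hp = χ-in (<-≤-trans (proj₁ (χ-true (All.lookup ordered c∈) hp)) p≤q) (≤-trans q≤ℓ (proj₁ (proj₂ (All.lookup sep c∈))))

  falling : ∀ {c p q} → c ∈ X → ℓ ≤ p → p ≤ q → χ c q ≡ true → χ c p ≡ true
  falling c∈ ℓ≤p p≤q hq = χ-in (<-≤-trans (proj₁ (All.lookup sep c∈)) ℓ≤p) (≤-trans p≤q (proj₂ (χ-true (All.lookup ordered c∈) hq)))

  -- If `p ≤ ℓ`, then `hL p` is 0 and `p` competes in the minimum for `q`. Otherwise a minimiser `a`
  -- for `r` is used for `p` and `q` too, and pairs covering a later gap beyond `ℓ` also cover the
  -- earlier ones.
  hL-bound : ∀ p r q → p ≤ r → r ≤ q → hL p + hL q ≤ cross X p q + 2 * hL r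
  hL-bound p r q p≤r r≤q with p ≤? ℓ
  ... | yes p≤ℓ = ≤-trans (≤-reflexive (cong (_+ hL q) (hL-low p p≤ℓ))) (≤-trans (minTo-≤ (λ x → cross X x q) ℓ p p≤ℓ) (m≤m+n _ _))
  ... | no p≰ℓ with minTo-attained (λ x → cross X x r) ℓ
  ...   | a , a≤ℓ , eq = begin
    hL p + hL q                                       ≤⟨ +-mono-≤ (minTo-≤ (λ x → cross X x p) ℓ a a≤ℓ) (minTo-≤ (λ x → cross X x q) ℓ a a≤ℓ) ⟩
    cross X a p + cross X a q                         ≡⟨ sym (N.∑-+ X _ _) ⟩
    N.∑ X (λ c → bit (χ c a xor χ c p) + bit (χ c a xor χ c q))  ≤⟨ ∑-mono∈ X (λ c c∈ → point (χ c a) (χ c p) (χ c r) (χ c q)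
                                                              (falling c∈ ℓ≤p p≤r) (falling c∈ (≤-trans ℓ≤p p≤r) r≤q)) ⟩
    N.∑ X (λ c → bit (χ c p xor χ c q) + 2 * bit (χ c a xor χ c r)) ≡⟨ N.∑-+ X _ _ ⟩
    cross X p q + N.∑ X (λ c → 2 * bit (χ c a xor χ c r))  ≡⟨ cong (cross X p q +_) (N.∑-*ˡ X 2 _) ⟩
    cross X p q + 2 * cross X a r                     ≡⟨ cong (λ z → cross X p q + 2 * z) (sym eq) ⟩
    cross X p q + 2 * hL r                            ∎
    where
    open ≤-Reasoning
    ℓ≤p : ℓ ≤ p
    ℓ≤p = <⇒≤ (≰⇒> p≰ℓ)
    point : ∀ x a b c → (b ≡ true → a ≡ true) → (c ≡ true → b ≡ true) → bit (x xor a) + bit (x xor c) ≤ bit (a xor c) + 2 * bit (x xor b)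
    point x     a     false true  h k with k refl
    ... | ()
    point x     false true  c     h k with h refl
    ... | ()
    point true  true  true  true  h k = z≤n
    point true  true  true  false h k = ≤-refl
    point true  true  false false h k = s≤s z≤n
    point true  false false false h k = ≤-refl
    point false true  true  true  h k = ≤-refl
    point false true  true  false h k = s≤s z≤n
    point false true  false false h k = ≤-refl
    point false false false false h k = z≤n

  local-dominated : ∀ p q → p ≤ q → q ≤ M → cross XL p q ≤ cross X p q
  local-dominated p q p≤q q≤M with Peel-upper (proj₂ local) p q p≤q q≤M
  ... | r , p≤r , r≤q , le = +-cancelʳ-≤ (2 * hL r) _ _ (≤-trans le (hL-bound p r q p≤r r≤q))

  only : ℕ → ℕ → ℕ
  only p q = N.∑ X (λ c → bit (χ c p ∧ not (χ c q)))

  only-mono : ∀ {p p' q q'} → (∀ c → c ∈ X → χ c p ∧ not (χ c q) ≡ true → χ c p' ∧ not (χ c q') ≡ true) → only p q ≤ only p' q'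
  only-mono h = ∑-mono∈ X (λ c c∈ → bit-mono (h c c∈))
    where
    bit-mono : ∀ {a b} → (a ≡ true → b ≡ true) → bit a ≤ bit b
    bit-mono {false} h = z≤n
    bit-mono {true}  h rewrite h refl = ≤-refl

  cross-only : ∀ p q → cross X p q ≡ only p q + only q p
  cross-only p q = ≡-trans (N.∑-cong X (λ c → point (χ c p) (χ c q))) (N.∑-+ X _ _)
    where
    point : ∀ a b → bit (a xor b) ≡ bit (a ∧ not b) + bit (b ∧ not a)
    point true  true  = refl
    point true  false = refl
    point false true  = refl
    point false false = refl

  load-only : ∀ p q → load X p + only q p ≡ load X q + only p q
  load-only p q = ≡-trans (sym (N.∑-+ X _ _)) (≡-trans (N.∑-cong X (λ c → point (χ c p) (χ c q))) (N.∑-+ X _ _))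
    where
    point : ∀ a b → bit a + bit (b ∧ not a) ≡ bit b + bit (a ∧ not b)
    point true  true  = refl
    point true  false = refl
    point false true  = refl
    point false false = refl

  -- The two one-sided counts differ by the change of load from `p` to `q`, which `XN` can realise
  -- only with chords covering exactly one of the two gaps.
  right-≤ : ∀ p q → p ≤ q → q ≤ M → only q p ≤ cross XN p q + only p q
  right-≤ p q p≤q q≤M = +-cancelˡ-≤ (load X p) _ _ (begin
    load X p + only q p                    ≡⟨ load-only p q ⟩
    load X q + only p q                    ≤⟨ +-monoˡ-≤ (only p q) (+-cancelˡ-≤ (load X p) _ _ (≤-trans (lowerN p p q ≤-refl p≤q q≤M) (≤-reflexive (ring (cross XN p q) (load X p))))) ⟩
    (load X p + cross XN p q) + only p q   ≡⟨ +-assoc (load X p) _ _ ⟩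
    load X p + (cross XN p q + only p q)   ∎)
    where
    open ≤-Reasoning
    ring : ∀ x y → x + 2 * y ≡ y + (y + x)
    ring = ℕ-Solver.solve-∀

  left-≤ : ∀ p q → p ≤ q → q ≤ M → only p q ≤ cross XN p q + only q p
  left-≤ p q p≤q q≤M = +-cancelˡ-≤ (load X q) _ _ (begin
    load X q + only p q                    ≡⟨ sym (load-only p q) ⟩
    load X p + only q p                    ≤⟨ +-monoˡ-≤ (only q p) (+-cancelʳ-≤ (load X q) _ _ (≤-trans (lowerN p q q p≤q ≤-refl q≤M) (≤-reflexive (ring (cross XN p q) (load X q))))) ⟩
    (load X q + cross XN p q) + only q p   ≡⟨ +-assoc (load X q) _ _ ⟩
    load X q + (cross XN p q + only q p)   ∎)
    where
    open ≤-Reasoning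
    ring : ∀ x y → x + 2 * y ≡ (y + x) + y
    ring = ℕ-Solver.solve-∀

  ∧-not : ∀ {a b} → a ∧ not b ≡ true → a ≡ true × b ≡ false
  ∧-not {true} {false} _ = refl , refl

  ∧-not-intro : ∀ {a b} → a ≡ true → b ≡ false → a ∧ not b ≡ true
  ∧-not-intro refl refl = refl

  hL-≤ : ∀ p q → p ≤ ℓ → ℓ ≤ q → q ≤ M → hL q ≤ cross XL p q
  hL-≤ p q p≤ℓ ℓ≤q q≤M = ≤-trans (≤-reflexive (cong (_+ hL q) (sym (hL-low p p≤ℓ)))) (≤-trans (lowerL p ℓ q p≤ℓ ℓ≤q q≤M)
    (≤-reflexive (≡-trans (cong (λ z → cross XL p q + 2 * z) (hL-low ℓ ≤-refl)) (+-identityʳ _))))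

  -- Let `a` attain the minimum `hL q`. Between `p` and `a` the covering pairs vary monotonically,
  -- so one of the one-sided counts at `p` is at most the same count at `a`, which is part of that
  -- minimum.
  smaller-side : ∀ p q → p ≤ ℓ → ℓ ≤ q → q ≤ M → only p q ≤ cross XL p q ⊎ only q p ≤ cross XL p q
  smaller-side p q p≤ℓ ℓ≤q q≤M with minTo-attained (λ x → cross X x q) ℓ
  ... | a , a≤ℓ , eq with ≤-total p a
  ...   | inj₁ p≤a = inj₁ (≤-trans (only-mono {p} {a} {q} {q} (λ c c∈ h → ∧-not-intro (rising c∈ p≤a a≤ℓ (proj₁ (∧-not h))) (proj₂ (∧-not h)))) (≤-trans (≤-trans (m≤m+n _ _) (≤-reflexive (sym (cross-only a q)))) (≤-trans (≤-reflexive (sym eq)) (hL-≤ p q p≤ℓ ℓ≤q q≤M))))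
  ...   | inj₂ a≤p = inj₂ (≤-trans (only-mono {q} {q} {p} {a} (λ c c∈ h → ∧-not-intro (proj₁ (∧-not h)) (¬-not (λ ha → contradiction (≡-trans (sym (proj₂ (∧-not h))) (rising c∈ a≤p p≤ℓ ha)) λ ())))) (≤-trans (≤-trans (m≤n+m _ _) (≤-reflexive (sym (cross-only a q)))) (≤-trans (≤-reflexive (sym eq)) (hL-≤ p q p≤ℓ ℓ≤q q≤M))))

  only-0 : ∀ p q → (∀ c → c ∈ X → χ c p ≡ true → χ c q ≡ true) → only p q ≡ 0
  only-0 p q h = ≡-trans (N.∑-cong∈ X (λ c c∈ → cong bit (¬-not (λ e → contradiction (≡-trans (sym (proj₂ (∧-not e))) (h c c∈ (proj₁ (∧-not e)))) λ ())))) (N.∑-0 X)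

  -- If `p` and `q` lie on the same side of `ℓ`, one of the one-sided counts vanishes and `XN`
  -- suffices. Otherwise the larger count is at most the smaller plus `cross XN p q`, and the
  -- smaller, thus occurring twice, is at most `cross XL p q`.
  dominates : ∀ p q → p ≤ q → q ≤ M → cross X p q ≤ cross XN p q + 2 * cross XL p q
  dominates p q p≤q q≤M with ℓ ≤? p | q ≤? ℓ
  ... | yes ℓ≤p | _ = ≤-trans (≤-reflexive (≡-trans (cross-only p q) (≡-trans (cong (only p q +_) z) (+-identityʳ _))))
        (≤-trans (left-≤ p q p≤q q≤M) (≤-trans (≤-reflexive (≡-trans (cong (cross XN p q +_) z) (+-identityʳ _))) (m≤m+n _ _)))
    where
    z : only q p ≡ 0
    z = only-0 q p (λ c c∈ → falling c∈ ℓ≤p p≤q)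
  ... | no _ | yes q≤ℓ = ≤-trans (≤-reflexive (≡-trans (cross-only p q) (cong (_+ only q p) z)))
        (≤-trans (right-≤ p q p≤q q≤M) (≤-trans (≤-reflexive (≡-trans (cong (cross XN p q +_) z) (+-identityʳ _))) (m≤m+n _ _)))
    where
    z : only p q ≡ 0
    z = only-0 p q (λ c c∈ → rising c∈ p≤q q≤ℓ)
  ... | no ℓ≰p | no q≰ℓ with smaller-side p q (<⇒≤ (≰⇒> ℓ≰p)) (<⇒≤ (≰⇒> q≰ℓ)) q≤M
  ...   | inj₁ le = begin
    cross X p q                                ≡⟨ cross-only p q ⟩
    only p q + only q p                        ≤⟨ +-monoʳ-≤ (only p q) (right-≤ p q p≤q q≤M) ⟩
    only p q + (cross XN p q + only p q)       ≤⟨ +-mono-≤ le (+-monoʳ-≤ (cross XN p q) le) ⟩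
    cross XL p q + (cross XN p q + cross XL p q) ≡⟨ ring (cross XL p q) (cross XN p q) ⟩
    cross XN p q + 2 * cross XL p q            ∎
    where
    open ≤-Reasoning
    ring : ∀ x y → x + (y + x) ≡ y + 2 * x
    ring = ℕ-Solver.solve-∀
  ...   | inj₂ le = begin
    cross X p q                                ≡⟨ cross-only p q ⟩
    only p q + only q p                        ≤⟨ +-monoˡ-≤ (only q p) (left-≤ p q p≤q q≤M) ⟩
    (cross XN p q + only q p) + only q p       ≤⟨ +-mono-≤ (+-monoʳ-≤ (cross XN p q) le) le ⟩
    (cross XN p q + cross XL p q) + cross XL p q ≡⟨ ring (cross XL p q) (cross XN p q) ⟩
    cross XN p q + 2 * cross XL p q            ∎
    where
    open ≤-Reasoning
    ring : ∀ x y → (y + x) + x ≡ y + 2 * x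
    ring = ℕ-Solver.solve-∀

-- The boundary walk of a face
telescope-xor : ∀ (f : ℕ → Bool) s M → s ≤ M → B.∑ (downFrom M) (λ r → ⌊ suc r ≤? s ⌋ ∧ (f r xor f (suc r))) ≡ f 0 xor f s
telescope-xor f zero zero z≤n = sym (xor-same (f 0))
telescope-xor f s (suc M) s≤ with suc M ≤? s
... | no s≰M = telescope-xor f s M (≤-pred (≰⇒> s≰M))
... | yes M<s rewrite ≤-antisym s≤ M<s = ≡-trans (cong ((f M xor f (suc M)) xor_)
        (≡-trans (B.∑-cong∈ (downFrom M) (λ r r∈ → cong (_∧ (f r xor f (suc r))) (≡-trans (≤?-true (m≤n⇒m≤1+n (downFrom-< r∈))) (sym (≤?-true (downFrom-< r∈))))))
          (telescope-xor f M M ≤-refl)))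
        (≡-trans (xor-comm (f M xor f (suc M)) (f 0 xor f M)) (xor-cross (f 0) (f M) (f (suc M))))

downFrom! : ∀ M → Unique (downFrom M)
downFrom! = Uniqueₚ.downFrom⁺

∈-downFrom : ∀ {r} M → r < M → r ∈ downFrom M
∈-downFrom {r} (suc M) (s≤s r≤M) with r ℕ.≟ M
... | yes refl = here refl
... | no ne    = there (∈-downFrom M (≤∧≢⇒< r≤M ne))

∑-⊆ : ∀ {A : Set} {xs : List A} (ys : List A) (f : A → ℕ) → Unique xs → (∀ {x} → x ∈ xs → x ∈ ys) → N.∑ xs f ≤ N.∑ ys f
∑-⊆ {xs = []}     ys f u sub = z≤n
∑-⊆ {xs = x ∷ xs} ys f (x∉ ∷ u) sub with ∈-split (sub (here refl))
... | zs , perm = ≤-trans (+-monoʳ-≤ (f x) (∑-⊆ zs f u sub')) (≤-reflexive (sym (N.∑-↭ f perm)))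
  where
  sub' : ∀ {y} → y ∈ xs → y ∈ zs
  sub' y∈ with ∈-resp-↭ perm (sub (there y∈))
  ... | here refl = contradiction refl (All.lookup x∉ y∈)
  ... | there p   = p

module FaceWalks {n m : ℕ} (G : PlaneGraph n m) where
  open Chords G public

  tail-φ : ∀ d → tail (φ d) ≡ head d
  tail-φ (e , b) = σ-tail (e , not b)

  module _ (d₀ : Dart m) where
    private
      first-return : ∃[ k ] (iter (suc k) φ d₀ ≡ d₀ × (∀ i → i < k → iter (suc i) φ d₀ ≢ d₀))
      first-return = least (λ k → iter (suc k) φ d₀ ≟D d₀) (proj₁ (returns d₀)) (proj₂ (returns d₀))

    abstract
      period : ℕ
      period = suc (proj₁ first-return)

      period-pos : 0 < period
      period-pos = s≤s z≤n

      period-returns : iter period φ d₀ ≡ d₀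
      period-returns = proj₁ (proj₂ first-return)

      period-least : ∀ i → suc i < period → iter (suc i) φ d₀ ≢ d₀
      period-least i lt = proj₂ (proj₂ first-return) i (≤-pred lt)

    pos : ℕ → Dart m
    pos r = iter r φ d₀

    vtx : ℕ → Fin n
    vtx r = tail (pos r)

    pos-< : ∀ i j → i < j → j < period → pos i ≢ pos j
    pos-< i j i<j j<M eq = period-least (j ∸ suc i) (≤-<-trans (≤-reflexive (suc∸ i<j)) (≤-<-trans (m∸n≤m j i) j<M)) (sym (iter-injective φ-injective i
      (≡-trans eq (≡-trans (cong pos (sym (≡-trans (+-suc i (j ∸ suc i)) (m+[n∸m]≡n i<j)))) (iter-+ φ i (suc (j ∸ suc i)) d₀)))))
      where
      suc∸ : ∀ {i j} → i < j → suc (j ∸ suc i) ≡ j ∸ i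
      suc∸ {zero}  {suc j} _        = refl
      suc∸ {suc i} {suc j} (s≤s lt) = suc∸ lt

    pos-injective : ∀ {i j} → i < period → j < period → pos i ≡ pos j → i ≡ j
    pos-injective {i} {j} i< j< eq with <-cmp i j
    ... | tri< lt _ _ = contradiction eq (pos-< i j lt j<)
    ... | tri≈ _ p _  = p
    ... | tri> _ _ gt = contradiction (sym eq) (pos-< j i gt i<)

    vtx-suc : ∀ r → vtx (suc r) ≡ head (pos r)
    vtx-suc r = tail-φ (pos r)

    vtx-period : vtx period ≡ vtx 0
    vtx-period = cong tail period-returns

    pos-onto : ∀ {d} → SameFace d₀ d → ∃[ r ] (r < period × pos r ≡ d)
    pos-onto (zero  , refl) = 0 , period-pos , refl
    pos-onto (suc k , refl) with pos-onto (k , refl)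
    ... | r , r< , eq with suc r ℕ.≟ period
    ...   | yes p = 0 , period-pos , ≡-trans (sym period-returns) (≡-trans (cong pos (sym p)) (cong φ eq))
    ...   | no ¬p = suc r , ≤∧≢⇒< r< ¬p , cong φ eq

    face-pos : ∀ r → faceOf (pos r) ≡ faceOf d₀
    face-pos r = sym (faceOf-sameFace (r , refl))

    dart-cut : ∀ S r → cut S (proj₁ (pos r)) ≡ S (vtx r) xor S (vtx (suc r))
    dart-cut S r = ≡-trans (cut-ends S (pos r)) (cong (λ z → S (vtx r) xor S z) (sym (vtx-suc r)))

    -- The darts within one period are distinct, so each change along the boundary is a separate
    -- crossing counted by `Central`.
    central-interval : ∀ {S} → Central S → ∃[ p ] ∃[ q ] (p ≤ q × q ≤ period × ∀ r → r ≤ period → S (vtx r) ≡ S (vtx 0) xor inside p q r)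
    central-interval {S} central = Intervals.interval (S ∘ vtx) period few (cong S vtx-period)
      where
      open ≤-Reasoning
      walk! : Unique (map pos (downFrom period))
      walk! = unique-map (downFrom period) (downFrom! period) (λ r∈ → downFrom-< r∈)
        where
        unique-map : ∀ rs → Unique rs → (∀ {r} → r ∈ rs → r < period) → Unique (map pos rs)
        unique-map []       []       h = []
        unique-map (r ∷ rs) (r∉ ∷ u) h = Allₚ.map⁺ (All.tabulate (λ {r'} r'∈ eq → All.lookup r∉ r'∈ (pos-injective (h (here refl)) (h (there r'∈)) eq))) ∷ unique-map rs u (λ p → h (there p))
      F = faceOf d₀
      few : changes (S ∘ vtx) period ≤ 2
      few = begin
        N.∑ (downFrom period) (λ r → bit (S (vtx r) xor S (vtx (suc r))))  ≡⟨ N.∑-cong (downFrom period) (λ r → ≡-trans (cong bit (sym (dart-cut S r))) (sym (onface r))) ⟩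
        N.∑ (downFrom period) (λ r → faceCross F S (pos r))                ≡⟨ sym (N.∑-map pos (downFrom period) _) ⟩
        N.∑ (map pos (downFrom period)) (faceCross F S)                    ≤⟨ ∑-⊆ (dartList m) _ walk! (λ _ → ∈-dartList _) ⟩
        N.∑ (dartList m) (faceCross F S)                                   ≤⟨ central F ⟩
        2 ∎
        where
        onface : ∀ r → faceCross F S (pos r) ≡ bit (cut S (proj₁ (pos r)))
        onface r with faceOf (pos r) ≟ F
        ... | yes _ = refl
        ... | no ¬p = contradiction (face-pos r) ¬p

    central-pairs : ∀ {S} → Central S → ∃[ p ] ∃[ q ] (p ≤ q × q ≤ period ×
      ∀ s t → s ≤ period → t ≤ period → S (vtx s) xor S (vtx t) ≡ χ (s , t) p xor χ (s , t) q)
    central-pairs {S} central with central-interval {S} central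
    ... | p , q , p≤q , q≤M , h = p , q , p≤q , q≤M , λ s t s≤ t≤ → ≡-trans (cong₂ _xor_ (h s s≤) (h t t≤))
          (≡-trans (cancel (S (vtx 0)) (inside p q s) (inside p q t)) (inside-χ p q s t))
      where
      cancel : ∀ a b c → (a xor b) xor (a xor c) ≡ b xor c
      cancel true  true  c = refl
      cancel true  false true = refl
      cancel true  false false = refl
      cancel false b     c = refl

    -- Two paths joining interleaved pairs of a face meet: otherwise a central cut would
    -- separate them, crossing the face boundary four times.
    module _ (l : Fin m → ℕ) where
      open Distance G

      face-kalmanson : ∀ i j k r → i ≤ j → j ≤ k → k ≤ r → r ≤ period →
        dist l (vtx i) (vtx r) + dist l (vtx j) (vtx k) ≤ dist l (vtx i) (vtx k) + dist l (vtx j) (vtx r)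
      face-kalmanson i j k r i≤j j≤k k≤r r≤M = compare (dist-attained l (vtx i) (vtx k)) (dist-attained l (vtx j) (vtx r))
        where
        Goal = dist l (vtx i) (vtx r) + dist l (vtx j) (vtx k) ≤ dist l (vtx i) (vtx k) + dist l (vtx j) (vtx r)
        Shortest : Fin n → Fin n → Set
        Shortest u v = ∃[ ds ] (IsPath u ds v × len l ds ≡ dist l u v)
        compare : Shortest (vtx i) (vtx k) → Shortest (vtx j) (vtx r) → Goal
        compare (ps , (P , _) , lenP) (qs , (Q , _) , lenQ) with Any.any? (λ x → Any.any? (x ≟_) (vtx i ∷ map head ps)) (vtx j ∷ map head qs)
        ... | yes meet = let (x , x∈Q , x∈P) = find meet in meeting x (walk-split P x∈P) (walk-split Q x∈Q)
          where
          Split : List (Dart m) → Fin n → Fin n → Fin n → Set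
          Split ds u v x = ∃[ ds₁ ] ∃[ ds₂ ] (ds ≡ ds₁ ++ ds₂ × Walk u ds₁ x × Walk x ds₂ v)
          meeting : ∀ x → Split ps (vtx i) (vtx k) x → Split qs (vtx j) (vtx r) x → Goal
          meeting x (p₁ , p₂ , refl , P₁ , P₂) (q₁ , q₂ , refl , Q₁ , Q₂) = begin
            dist l (vtx i) (vtx r) + dist l (vtx j) (vtx k)    ≤⟨ +-mono-≤ (dist-≤ l (walk-++ P₁ Q₂)) (dist-≤ l (walk-++ Q₁ P₂)) ⟩
            len l (p₁ ++ q₂) + len l (q₁ ++ p₂)                ≡⟨ cong₂ _+_ (N.∑-++ p₁ q₂ _) (N.∑-++ q₁ p₂ _) ⟩
            (len l p₁ + len l q₂) + (len l q₁ + len l p₂)      ≡⟨ ring (len l p₁) (len l q₂) (len l q₁) (len l p₂) ⟩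
            (len l p₁ + len l p₂) + (len l q₁ + len l q₂)      ≡⟨ sym (cong₂ _+_ (N.∑-++ p₁ p₂ _) (N.∑-++ q₁ q₂ _)) ⟩
            len l (p₁ ++ p₂) + len l (q₁ ++ q₂)                ≡⟨ cong₂ _+_ lenP lenQ ⟩
            dist l (vtx i) (vtx k) + dist l (vtx j) (vtx r)    ∎
            where
            open ≤-Reasoning
            ring : ∀ a b c d → (a + b) + (c + d) ≡ (a + d) + (c + b)
            ring = ℕ-Solver.solve-∀
        ... | no apart = contradiction separated (λ { (T , Ti≢Tj , same) → Ti≢Tj same })
          where
          -- The vertex set of the first path cuts no edge of either path. Its central pieces cut
          -- only edges that it cuts, so each is constant along both paths, yet one of them
          -- separates `vtx i` from `vtx j`.
          S : Fin n → Bool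
          S x = ⌊ Any.any? (x ≟_) (vtx i ∷ map head ps) ⌋
          S-on : ∀ {x} → x ∈ vtx i ∷ map head ps → S x ≡ true
          S-on {x} x∈ with Any.any? (x ≟_) (vtx i ∷ map head ps)
          ... | yes _ = refl
          ... | no ¬p = contradiction x∈ ¬p
          S-off : ∀ {x} → x ∈ vtx j ∷ map head qs → S x ≡ false
          S-off {x} x∈ with Any.any? (x ≟_) (vtx i ∷ map head ps)
          ... | yes p = contradiction (lose x∈ p) apart
          ... | no _  = refl
          uncut : ∀ {u ds v} c → Walk u ds v → (∀ {x} → x ∈ u ∷ map head ds → S x ≡ c) → ∀ d → d ∈ ds → cut S (proj₁ d) ≡ false
          uncut c (cons {d = d} refl w) h .d (here refl) = ≡-trans (cut-ends S d) (≡-trans (cong₂ _xor_ (h (here refl)) (h (there (here refl)))) (xor-same c))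
          uncut c (cons p w) h d (there d∈) = uncut c w (λ x∈ → h (there x∈)) d d∈
          Found : Set
          Found = Σ (Fin n → Bool) λ T → T (vtx i) ≢ T (vtx j) × T (vtx i) ≡ T (vtx j)
          separated : Found
          separated = choose (central-decomposition S)
            where
            choose : (Σ (List (Fin n → Bool)) λ Ss → All Central Ss × (∀ e → bit (cut S e) ≡ N.∑ Ss (λ T → bit (cut T e))) × (∀ u v → bit (S u xor S v) ≤ N.∑ Ss (λ T → bit (T u xor T v)))) → Found
            choose (Ss , central , edges , pairs) = pick Ss central (λ e T T∈ Se → bit-0 (≤-trans (term≤∑ Ss (λ T → bit (cut T e)) T∈) (≤-reflexive (≡-trans (sym (edges e)) (cong bit Se)))))
                (≤-trans (≤-reflexive (sym (cong bit (cong₂ _xor_ (S-on (here refl)) (S-off (here refl)))))) (pairs (vtx i) (vtx j)))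
              where
              bit-0 : ∀ {b} → bit b ≤ 0 → b ≡ false
              bit-0 {false} _ = refl
              pick : ∀ Ts → All Central Ts → (∀ e T → T ∈ Ts → cut S e ≡ false → cut T e ≡ false) → 1 ≤ N.∑ Ts (λ T → bit (T (vtx i) xor T (vtx j))) → Found
              pick []       _         h ()
              pick (T ∷ Ts) (cT ∷ cs) h le with T (vtx i) xor T (vtx j) in eq
              ... | false = pick Ts cs (λ e T' T'∈ → h e T' (there T'∈)) le
              ... | true  = T , (λ same → contradiction (≡-trans (sym eq) (≡-trans (cong (T (vtx i) xor_) (sym same)) (xor-same (T (vtx i))))) λ ()) , same
                where
                along : ∀ {u ds v} c → Walk u ds v → (∀ {x} → x ∈ u ∷ map head ds → S x ≡ c) → T u ≡ T v
                along {ds = ds} c w hc = xor≡false (≡-trans (sym (walk-cut w T)) (≡-trans (B.∑-cong∈ ds (λ d d∈ → h (proj₁ d) T (here refl) (uncut c w hc d d∈))) (B.∑-0 ds)))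
                same : T (vtx i) ≡ T (vtx j)
                same with central-interval {T} cT
                ... | p , q , p≤q , q≤M , hT = ≡-trans (hT i (≤-trans i≤j (≤-trans j≤k (≤-trans k≤r r≤M)))) (≡-trans (cong (T (vtx 0) xor_)
                        (inside-noncrossing p≤q i≤j j≤k k≤r (inside-eq (≤-trans i≤j (≤-trans j≤k (≤-trans k≤r r≤M))) (≤-trans k≤r r≤M) (along true P S-on)) (inside-eq (≤-trans j≤k (≤-trans k≤r r≤M)) r≤M (along false Q S-off))))
                        (sym (hT j (≤-trans j≤k (≤-trans k≤r r≤M)))))
                  where
                  inside-eq : ∀ {x y} → x ≤ period → y ≤ period → T (vtx x) ≡ T (vtx y) → inside p q x ≡ inside p q y
                  inside-eq {x} {y} x≤ y≤ eq = ≡-trans (sym (xor-cancelˡ (T (vtx 0)) (inside p q x))) (≡-trans (cong (T (vtx 0) xor_) (≡-trans (sym (hT x x≤)) (≡-trans eq (hT y y≤)))) (xor-cancelˡ (T (vtx 0)) (inside p q y)))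

-- Drawing the chords of a load inside its face
module Laying {n m : ℕ} (G : PlaneGraph n m) where
  open FaceWalks G public

  chordSum : (K : Chorded) → (Fin n → Fin n → ℕ) → ℕ
  chordSum K g = N.∑ (allFin (Chorded.j K)) (λ c → g (Chorded.cu K c) (Chorded.cv K c))

  module Lay (d₀ : Dart m) (K₀ : Chorded) (uniform : ∀ d → faceOf d ≡ faceOf d₀ → Chorded.lab K₀ d ≡ Chorded.lab K₀ d₀) where
    M = period d₀

    pairSum : List (ℕ × ℕ) → (Fin n → Fin n → ℕ) → ℕ
    pairSum X g = N.∑ X (λ c → g (vtx d₀ (proj₁ c)) (vtx d₀ (proj₂ c)))

    record Laid (h : ℕ → ℕ) (X : List (ℕ × ℕ)) : Set where
      field
        K       : Chorded
        sums    : ∀ g → chordSum K g ≡ pairSum X g + chordSum K₀ g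
        outside : ∀ d → faceOf d ≢ faceOf d₀ → Chorded.lab K d ≡ Chorded.lab K₀ d
        -- Dart `r` spans gap `suc r`. Consecutive darts with equal load stay in one region, which
        -- leaves room for a chord over any plateau.
        level   : ∀ r → suc r < M → h (suc r) ≡ h (suc (suc r)) → Chorded.lab K (pos d₀ r) ≡ Chorded.lab K (pos d₀ (suc r))

    module Step {h h' : ℕ → ℕ} {X : List (ℕ × ℕ)} {s t : ℕ} (v : ℕ) (s<t : s < t) (t<M : t < M) (plateau : ∀ r → s < r → r ≤ t → h r ≡ v)
                (hs : h s < v) (ht : h (suc t) < v) (h≡ : ∀ r → h r ≡ bit (χ (s , t) r) + h' r) (old : Laid h' X) where
      open Laid old
      open Chorded K

      -- The boundary darts beneath the chord, identified by the gaps they span.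
      R : Dart m → Bool
      R d = B.∑ (downFrom M) (λ r → χ (s , t) (suc r) ∧ ⌊ d ≟D pos d₀ r ⌋)

      R-true : ∀ d → R d ≡ true → ∃[ r ] (r < M × χ (s , t) (suc r) ≡ true × d ≡ pos d₀ r)
      R-true d Rd with ∑-odd (downFrom M) (λ r → χ (s , t) (suc r) ∧ ⌊ d ≟D pos d₀ r ⌋) Rd
      ... | r , r∈ , hit = r , downFrom-< r∈ , split hit
        where
        split : χ (s , t) (suc r) ∧ ⌊ d ≟D pos d₀ r ⌋ ≡ true → χ (s , t) (suc r) ≡ true × d ≡ pos d₀ r
        split hit with χ (s , t) (suc r) | d ≟D pos d₀ r
        ... | true | yes p = refl , p

      R-pos : ∀ r → r < M → R (pos d₀ r) ≡ χ (s , t) (suc r)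
      R-pos r r<M = ≡-trans (B.∑-cong∈ (downFrom M) (λ i i∈ → point i (downFrom-< i∈))) (B.∑-pick ℕ._≟_ (downFrom M) r (λ i → χ (s , t) (suc i)) (downFrom! M) (∈-downFrom M r<M))
        where
        point : ∀ i → i < M → χ (s , t) (suc i) ∧ ⌊ pos d₀ r ≟D pos d₀ i ⌋ ≡ (if ⌊ i ℕ.≟ r ⌋ then χ (s , t) (suc i) else false)
        point i i<M with pos d₀ r ≟D pos d₀ i | i ℕ.≟ r
        ... | yes _ | yes _    = ∧-identityʳ (χ (s , t) (suc i))
        ... | no _  | no _     = ∧-zeroʳ (χ (s , t) (suc i))
        ... | yes p | no ¬q    = contradiction (sym (pos-injective d₀ r<M i<M p)) ¬q
        ... | no ¬p | yes refl = contradiction refl ¬p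

      R-hom : ∀ (S : Fin n → Bool) → B.∑ (dartList m) (λ d → R d ∧ cut S (proj₁ d)) ≡ S (vtx d₀ s) xor S (vtx d₀ t)
      R-hom S = begin
        B.∑ (dartList m) (λ d → R d ∧ cut S (proj₁ d))
          ≡⟨ B.∑-cong (dartList m) (λ d → sym (B.∑-*ʳ (downFrom M) (cut S (proj₁ d)) _)) ⟩
        B.∑ (dartList m) (λ d → B.∑ (downFrom M) (λ r → (χ (s , t) (suc r) ∧ ⌊ d ≟D pos d₀ r ⌋) ∧ cut S (proj₁ d)))
          ≡⟨ B.∑-swap (dartList m) (downFrom M) _ ⟩
        B.∑ (downFrom M) (λ r → B.∑ (dartList m) (λ d → (χ (s , t) (suc r) ∧ ⌊ d ≟D pos d₀ r ⌋) ∧ cut S (proj₁ d)))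
          ≡⟨ B.∑-cong (downFrom M) (λ r → ≡-trans (B.∑-cong (dartList m) (λ d → point (χ (s , t) (suc r)) ⌊ d ≟D pos d₀ r ⌋ (cut S (proj₁ d))))
               (B.∑-pick _≟D_ (dartList m) (pos d₀ r) (λ d → χ (s , t) (suc r) ∧ cut S (proj₁ d)) (dartList! m) (∈-dartList _))) ⟩
        B.∑ (downFrom M) (λ r → χ (s , t) (suc r) ∧ cut S (proj₁ (pos d₀ r)))
          ≡⟨ B.∑-cong (downFrom M) (λ r → ≡-trans (cong (χ (s , t) (suc r) ∧_) (dart-cut d₀ S r)) (∧-distribʳ-xor (f r xor f (suc r)) ⌊ suc r ≤? s ⌋ ⌊ suc r ≤? t ⌋)) ⟩
        B.∑ (downFrom M) (λ r → (⌊ suc r ≤? s ⌋ ∧ (f r xor f (suc r))) xor (⌊ suc r ≤? t ⌋ ∧ (f r xor f (suc r))))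
          ≡⟨ B.∑-+ (downFrom M) _ _ ⟩
        B.∑ (downFrom M) (λ r → ⌊ suc r ≤? s ⌋ ∧ (f r xor f (suc r))) xor B.∑ (downFrom M) (λ r → ⌊ suc r ≤? t ⌋ ∧ (f r xor f (suc r)))
          ≡⟨ cong₂ _xor_ (telescope-xor f s M (<⇒≤ (<-≤-trans s<t (<⇒≤ t<M)))) (telescope-xor f t M (<⇒≤ t<M)) ⟩
        (f 0 xor f s) xor (f 0 xor f t)
          ≡⟨ cong (_xor (f 0 xor f t)) (xor-comm (f 0) (f s)) ⟩
        (f s xor f 0) xor (f 0 xor f t)
          ≡⟨ xor-cross (f s) (f 0) (f t) ⟩
        f s xor f t ∎
        where
        open ≡-Reasoning
        f : ℕ → Bool
        f r = S (vtx d₀ r)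
        point : ∀ a b c → (a ∧ b) ∧ c ≡ (if b then a ∧ c else false)
        point true  true  c = refl
        point true  false c = refl
        point false true  c = refl
        point false false c = refl

      -- Under the plateau `h'` is constantly `v - 1`, so the chords already laid keep these darts
      -- together.
      segment-label : ∀ r → s ≤ r → r < t → lab (pos d₀ r) ≡ lab (pos d₀ s)
      segment-label r s≤r r<t with r ℕ.≟ s
      ... | yes refl = refl
      segment-label zero    z≤n r<t | no ne = contradiction refl ne
      segment-label (suc r) s≤r r<t | no ne = ≡-trans (sym (level r (<-trans r<t t<M) same)) (segment-label r s≤r' (<-trans (n<1+n r) r<t))
        where
        s≤r' : s ≤ r
        s≤r' = ≤-pred (≤∧≢⇒< s≤r (λ e → ne (sym e)))
        h'-at : ∀ x → s < x → x ≤ t → suc (h' x) ≡ v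
        h'-at x s<x x≤t = ≡-trans (sym (≡-trans (h≡ x) (cong (λ z → bit z + h' x) (χ-in s<x x≤t)))) (plateau x s<x x≤t)
        same : h' (suc r) ≡ h' (suc (suc r))
        same = suc-injective (≡-trans (h'-at (suc r) (s≤s s≤r') (<⇒≤ r<t)) (sym (h'-at (suc (suc r)) (m≤n⇒m≤1+n (s≤s s≤r')) r<t)))

      R-lab : ∀ d → R d ≡ true → lab d ≡ lab (pos d₀ s)
      R-lab d Rd with R-true d Rd
      ... | r , r<M , hit , refl = let (a , b) = χ-true (<⇒≤ s<t) hit in segment-label r (≤-pred a) b

      open AddChord K R (lab (pos d₀ s)) (vtx d₀ s) (vtx d₀ t) using (addChord; lab')

      laid : Laid h ((s , t) ∷ X)
      laid = record
        { K = K⁺ ; sums = sums⁺ ; outside = outside⁺ ; level = level⁺ }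
        where
        K⁺ : Chorded
        K⁺ = addChord R-lab (lab< (pos d₀ s)) R-hom
        sums⁺ : ∀ g → chordSum K⁺ g ≡ (g (vtx d₀ s) (vtx d₀ t) + pairSum X g) + chordSum K₀ g
        sums⁺ g = ≡-trans (N.∑-suc (λ c → g (Chorded.cu K⁺ c) (Chorded.cv K⁺ c))) (≡-trans (cong (g (vtx d₀ s) (vtx d₀ t) +_) (sums g)) (sym (+-assoc (g (vtx d₀ s) (vtx d₀ t)) _ _)))
        keep : ∀ d → R d ≡ false → lab' d ≡ lab d
        keep d eq rewrite eq = refl
        outside⁺ : ∀ d → faceOf d ≢ faceOf d₀ → lab' d ≡ Chorded.lab K₀ d
        outside⁺ d ne = ≡-trans (keep d (¬-not (λ Rd → let (r , _ , _ , eq) = R-true d Rd in ne (≡-trans (cong faceOf eq) (face-pos d₀ r))))) (outside d ne)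
        level⁺ : ∀ r → suc r < M → h (suc r) ≡ h (suc (suc r)) → lab' (pos d₀ r) ≡ lab' (pos d₀ (suc r))
        level⁺ r r< eq = cong₂ (λ c x → if c then bound else x) (≡-trans (R-pos r (<-trans (n<1+n r) r<)) (≡-trans χ-eq (sym (R-pos (suc r) r<)))) (level r r< h'-eq)
          where
          -- The new chord separates consecutive gaps only at its ends, and there `hs` and `ht` make
          -- `h` change.
          χ-eq : χ (s , t) (suc r) ≡ χ (s , t) (suc (suc r))
          χ-eq with χ (s , t) (suc r) in c₁ | χ (s , t) (suc (suc r)) in c₂
          ... | true  | true  = refl
          ... | false | false = refl
          ... | false | true  = contradiction (≡-trans eq (plateau _ (proj₁ in₂) (proj₂ in₂))) (λ e → <⇒≢ (subst (λ z → h z < v) s≡ hs) e)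
            where
            in₂ = χ-true (<⇒≤ s<t) c₂
            s≡ : s ≡ suc r
            s≡ = ≤-antisym (≤-pred (proj₁ in₂)) (≮⇒≥ (λ s<r → contradiction (≡-trans (sym c₁) (χ-in s<r (≤-trans (n≤1+n _) (proj₂ in₂)))) λ ()))
          ... | true  | false = contradiction (≡-trans (sym eq) (plateau _ (proj₁ in₁) (proj₂ in₁))) (λ e → <⇒≢ (subst (λ z → h (suc z) < v) t≡ ht) e)
            where
            in₁ = χ-true (<⇒≤ s<t) c₁
            t≡ : t ≡ suc r
            t≡ = ≤-antisym (≮⇒≥ (λ r<t → contradiction (≡-trans (sym c₂) (χ-in (m≤n⇒m≤1+n (proj₁ in₁)) r<t)) λ ())) (proj₂ in₁)
          h'-eq : h' (suc r) ≡ h' (suc (suc r))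
          h'-eq = +-cancelˡ-≡ (bit (χ (s , t) (suc r))) _ _ (≡-trans (sym (h≡ (suc r))) (≡-trans eq (≡-trans (h≡ (suc (suc r))) (cong (λ z → bit z + h' (suc (suc r))) (sym χ-eq)))))

    -- Laying reverses peeling: the chord peeled last is drawn first.
    lay : ∀ {h X} → Peel M h X → Laid h X
    lay (flat _) = record { K = K₀ ; sums = λ g → refl ; outside = λ d _ → refl
      ; level = λ r _ _ → ≡-trans (uniform _ (face-pos d₀ r)) (sym (uniform _ (face-pos d₀ (suc r)))) }
    lay (peel v s<t t<M plateau hs ht h≡ P) = Step.laid v s<t t<M plateau hs ht h≡ (lay P)

  module _ (base : Fin numFaces → Dart m) (base-face : ∀ F → faceOf (base F) ≡ F)
           (X : Fin numFaces → List (ℕ × ℕ)) (P : ∀ F → ∃[ h ] Peel (period (base F)) h (X F)) where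

    facePairSum : (Fin n → Fin n → ℕ) → Fin numFaces → ℕ
    facePairSum g F = N.∑ (X F) (λ c → g (vtx (base F) (proj₁ c)) (vtx (base F) (proj₂ c)))

    -- Chords in one face relabel only darts of that face, so a face not yet treated still has a
    -- single label.
    layAll : ∀ Fs → Unique Fs → Σ Chorded λ K → (∀ g → chordSum K g ≡ N.∑ Fs (facePairSum g)) × (∀ d → faceOf d ∉ Fs → Chorded.lab K d ≡ faceℕ d)
    layAll []       _        = noChords , (λ g → refl) , λ d _ → refl
    layAll (F ∷ Fs) (F∉ ∷ u) = add (layAll Fs u)
      where
      add : (Σ Chorded λ K → (∀ g → chordSum K g ≡ N.∑ Fs (facePairSum g)) × (∀ d → faceOf d ∉ Fs → Chorded.lab K d ≡ faceℕ d)) →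
            Σ Chorded λ K → (∀ g → chordSum K g ≡ N.∑ (F ∷ Fs) (facePairSum g)) × (∀ d → faceOf d ∉ F ∷ Fs → Chorded.lab K d ≡ faceℕ d)
      add (K₀ , sums₀ , labs₀) = L.Laid.K laid , (λ g → ≡-trans (L.Laid.sums laid g) (cong (facePairSum g F +_) (sums₀ g))) ,
          λ d d∉ → ≡-trans (L.Laid.outside laid d (λ e → d∉ (here (≡-trans e (base-face F))))) (labs₀ d (λ p → d∉ (there p)))
        where
        fresh : ∀ d → faceOf d ≡ faceOf (base F) → Chorded.lab K₀ d ≡ faceℕ d
        fresh d e = labs₀ d (λ p → All.lookup F∉ p (sym (≡-trans e (base-face F))))
        module L = Lay (base F) K₀ (λ d e → ≡-trans (fresh d e) (≡-trans (cong toℕ e) (sym (fresh (base F) refl))))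
        laid = L.lay (proj₂ (P F))

-- The metric inequality for separable face instances
∑-fibres : ∀ {A : Set} {f : ℕ} (key : A → Fin f) (xs : List A) (g : A → ℕ) →
  N.∑ xs g ≡ N.∑ (allFin f) (λ F → N.∑ (filter (λ i → key i ≟ F) xs) g)
∑-fibres {f = f} key []       g = sym (N.∑-0 (allFin f))
∑-fibres {f = f} key (x ∷ xs) g = begin
  g x + N.∑ xs g
    ≡⟨ cong₂ _+_ (sym (N.∑-pick _≟_ (allFin f) (key x) (λ _ → g x) (Uniqueₚ.allFin⁺ f) (∈-allFin (key x)))) (∑-fibres key xs g) ⟩
  N.∑ (allFin f) (λ F → if ⌊ F ≟ key x ⌋ then g x else 0) + N.∑ (allFin f) (λ F → N.∑ (filter (λ i → key i ≟ F) xs) g)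
    ≡⟨ sym (N.∑-+ (allFin f) _ _) ⟩
  N.∑ (allFin f) (λ F → (if ⌊ F ≟ key x ⌋ then g x else 0) + N.∑ (filter (λ i → key i ≟ F) xs) g)
    ≡⟨ N.∑-cong (allFin f) point ⟩
  N.∑ (allFin f) (λ F → N.∑ (filter (λ i → key i ≟ F) (x ∷ xs)) g) ∎
  where
  open ≡-Reasoning
  point : ∀ F → (if ⌊ F ≟ key x ⌋ then g x else 0) + N.∑ (filter (λ i → key i ≟ F) xs) g ≡ N.∑ (filter (λ i → key i ≟ F) (x ∷ xs)) g
  point F rewrite ≟-sym F (key x) with key x ≟ F
  ... | yes _ = refl
  ... | no _  = refl

module MetricInequality {n m k : ℕ} (G : PlaneGraph n m) (H : Demands n k) (instance′ : SeparableFaceInstance G H) (cc : CutCondition G H) where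
  open Laying G

  face : Fin k → Dart m
  face = proj₁ instance′

  key : Fin k → Fin numFaces
  key i = faceOf (face i)

  segment : ∀ F → _
  segment F = proj₂ (proj₂ instance′) (faceRep F)

  -- Positions are counted from the start of the separating segment, which thus occupies 0 to
  -- `ℓ F - 1`.
  base : Fin numFaces → Dart m
  base F = proj₁ (segment F)

  ℓ : Fin numFaces → ℕ
  ℓ F = proj₁ (proj₂ (segment F))

  M : Fin numFaces → ℕ
  M F = period (base F)

  rep-base : ∀ F → SameFace (faceRep F) (base F)
  rep-base F = proj₁ (proj₂ (proj₂ (segment F)))

  base-face : ∀ F → faceOf (base F) ≡ F
  base-face F = ≡-trans (sym (faceOf-sameFace (rep-base F))) (faceOf-rep F)

  -- A longer segment would repeat its first dart.
  ℓ≤M : ∀ F → ℓ F ≤ M F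
  ℓ≤M F = ≮⇒≥ (λ M<ℓ → contradiction (proj₁ (proj₂ (proj₂ (proj₂ (segment F)))) 0 (M F) (≤-<-trans z≤n M<ℓ) M<ℓ (sym (period-returns (base F)))) (<⇒≢ (period-pos (base F))))

  Endpoints : Fin k → ℕ × ℕ → Set
  Endpoints i (s , t) = let b = base (key i) in
    (vtx b s ≡ proj₁ (H i) × vtx b t ≡ proj₂ (H i)) ⊎ (vtx b s ≡ proj₂ (H i) × vtx b t ≡ proj₁ (H i))

  Separated : Fin numFaces → ℕ × ℕ → Set
  Separated F c = proj₁ c < ℓ F × ℓ F ≤ proj₂ c × proj₂ c < M F

  -- A vertex may occur several times on the boundary. An endpoint outside the segment has no
  -- occurrence before `ℓ`, so any of its positions will do.
  positions : ∀ i → Σ (ℕ × ℕ) λ c → Separated (key i) c × Endpoints i c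
  positions i = place (proj₂ (proj₂ (proj₂ (proj₂ (segment (key i))))) i (proj₂ (rep-surj (face i))))
    where
    F = key i
    b = base F
    position : ∀ {v} → OnFace v (face i) → ∃[ r ] (r < M F × vtx b r ≡ v)
    position (q , refl) = let (r , r< , eq) = pos-onto b (sameFace-trans (sameFace-faceOf (base-face F)) (q , refl)) in r , r< , cong tail eq
    beyond : ∀ {v r} → ¬ InSegment G b (ℓ F) v → vtx b r ≡ v → ℓ F ≤ r
    beyond {r = r} out eq = ≮⇒≥ (λ r<ℓ → out (r , r<ℓ , eq))
    place : ExactlyOneIn G (InSegment G b (ℓ F)) (H i) → Σ (ℕ × ℕ) λ c → Separated F c × Endpoints i c
    place (inj₁ ((s , s<ℓ , eqs) , out)) = let (t , t< , eqt) = position (proj₂ (proj₁ (proj₂ instance′) i)) in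
      (s , t) , (s<ℓ , beyond out eqt , t<) , inj₁ (eqs , eqt)
    place (inj₂ (out , (s , s<ℓ , eqs))) = let (t , t< , eqt) = position (proj₁ (proj₁ (proj₂ instance′) i)) in
      (s , t) , (s<ℓ , beyond out eqt , t<) , inj₂ (eqs , eqt)

  pair : Fin k → ℕ × ℕ
  pair i = proj₁ (positions i)

  members : Fin numFaces → List (Fin k)
  members F = filter (λ i → key i ≟ F) (allFin k)

  demands : Fin numFaces → List (ℕ × ℕ)
  demands F = map pair (members F)

  demands-separated : ∀ F → All (Separated F) (demands F)
  demands-separated F = Allₚ.map⁺ (All.map (λ {i} e → subst (λ F → Separated F (pair i)) e (proj₁ (proj₂ (positions i)))) (Allₚ.all-filter (λ i → key i ≟ F) (allFin k)))

  module Sep (F : Fin numFaces) = Separable (demands F) (ℓ F) (M F) (ℓ≤M F) (demands-separated F)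

  pairs : (Fin n → Fin n → ℕ) → Fin numFaces → List (ℕ × ℕ) → ℕ
  pairs g F X = N.∑ X (λ c → g (vtx (base F) (proj₁ c)) (vtx (base F) (proj₂ c)))

  demand-sum : ∀ (g : Fin n → Fin n → ℕ) → (∀ u v → g u v ≡ g v u) → N.∑ (allFin k) (λ i → g (proj₁ (H i)) (proj₂ (H i))) ≡ N.∑ (allFin numFaces) (λ F → pairs g F (demands F))
  demand-sum g g-sym = ≡-trans (∑-fibres key (allFin k) _) (N.∑-cong (allFin numFaces) (λ F → sym (≡-trans (N.∑-map pair (members F) _)
      (N.∑-cong∈ (members F) (λ i i∈ → at F i (proj₂ (∈-filter⁻ (λ i → key i ≟ F) {xs = allFin k} i∈)))))))
    where
    ends-eq : ∀ i → Endpoints i (pair i) → g (vtx (base (key i)) (proj₁ (pair i))) (vtx (base (key i)) (proj₂ (pair i))) ≡ g (proj₁ (H i)) (proj₂ (H i))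
    ends-eq i (inj₁ (p , q)) = cong₂ g p q
    ends-eq i (inj₂ (p , q)) = ≡-trans (cong₂ g p q) (g-sym _ _)
    at : ∀ F i → key i ≡ F → g (vtx (base F) (proj₁ (pair i))) (vtx (base F) (proj₂ (pair i))) ≡ g (proj₁ (H i)) (proj₂ (H i))
    at .(key i) i refl = ends-eq i (proj₂ (proj₂ (positions i)))

  cutSize : (Fin n → Bool) → Fin n → Fin n → ℕ
  cutSize S u v = bit (S u xor S v)

  capacity′ : (Fin n → Bool) → ℕ
  capacity′ S = N.∑ (allFin m) (λ e → cap e * bit (cut S e))

  demand-cut : ∀ S → N.∑ (allFin numFaces) (λ F → pairs (cutSize S) F (demands F)) ≤ capacity′ S
  demand-cut S = subst₂ _≤_ left right (cc S)
    where
    left : δH G H S ≡ N.∑ (allFin numFaces) (λ F → pairs (cutSize S) F (demands F))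
    left = ≡-trans (sum-map (allFin k) _) (≡-trans (N.∑-cong (allFin k) (λ i → if-bit (crosses S (H i)))) (demand-sum (cutSize S) (λ u v → cong bit (xor-comm (S u) (S v)))))
      where
      if-bit : ∀ b → (if b then 1 else 0) ≡ bit b
      if-bit true  = refl
      if-bit false = refl
    right : δG G S ≡ capacity′ S
    right = ≡-trans (sum-map (allFin m) _) (N.∑-cong (allFin m) (λ e → if-cap (cap e) (cut S e)))
      where
      if-cap : ∀ c b → (if b then c else 0) ≡ c * bit b
      if-cap c true  = sym (*-identityʳ c)
      if-cap c false = sym (*-zeroʳ c)

  module Dominated (X : Fin numFaces → List (ℕ × ℕ)) (P : ∀ F → ∃[ h ] Peel (M F) h (X F))
                   (dominated : ∀ F p q → p ≤ q → q ≤ M F → cross (X F) p q ≤ cross (demands F) p q) where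

    face-cut : ∀ S → Central S → ∀ F → pairs (cutSize S) F (X F) ≤ pairs (cutSize S) F (demands F)
    face-cut S central F = compare (central-pairs (base F) {S} central)
      where
      compare : ∃[ p ] ∃[ q ] (p ≤ q × q ≤ M F × ∀ s t → s ≤ M F → t ≤ M F → S (vtx (base F) s) xor S (vtx (base F) t) ≡ χ (s , t) p xor χ (s , t) q) →
        pairs (cutSize S) F (X F) ≤ pairs (cutSize S) F (demands F)
      compare (p , q , p≤q , q≤M , h) = subst₂ _≤_ (sym (eq (X F) (All.map (λ { (a , b) → ≤-trans a b , b }) (Peel-proper (proj₂ (P F))))))
            (sym (eq (demands F) (All.map (λ { (a , b , c) → <⇒≤ (<-trans (<-≤-trans a b) c) , <⇒≤ c }) (demands-separated F)))) (dominated F p q p≤q q≤M)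
        where
        eq : ∀ Y → All (λ c → proj₁ c ≤ M F × proj₂ c ≤ M F) Y → pairs (cutSize S) F Y ≡ cross Y p q
        eq Y ok = N.∑-cong∈ Y (λ c c∈ → cong bit (h (proj₁ c) (proj₂ c) (proj₁ (All.lookup ok c∈)) (proj₂ (All.lookup ok c∈))))

    abstract
      laid : Σ Chorded λ K → ∀ g → chordSum K g ≡ N.∑ (allFin numFaces) (λ F → pairs g F (X F))
      laid = let (K , sums , _) = layAll base base-face X P (allFin numFaces) (Uniqueₚ.allFin⁺ numFaces) in K , sums

    K : Chorded
    K = proj₁ laid

    central-cut : ∀ S → Central S → chordSum K (cutSize S) ≤ capacity′ S
    central-cut S central = ≤-trans (≤-reflexive (proj₂ laid (cutSize S))) (≤-trans (∑-mono (allFin numFaces) (face-cut S central)) (demand-cut S))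

    -- Over the central pieces the capacity is additive, and the number of separated chords is at
    -- most additive, which is the direction needed.
    any-cut : ∀ S → chordSum K (cutSize S) ≤ capacity′ S
    any-cut S = by (central-decomposition S)
      where
      js = allFin (Chorded.j K)
      by : (Σ (List (Fin n → Bool)) λ Ss → All Central Ss × (∀ e → bit (cut S e) ≡ N.∑ Ss (λ T → bit (cut T e))) × (∀ u v → bit (S u xor S v) ≤ N.∑ Ss (λ T → bit (T u xor T v)))) → chordSum K (cutSize S) ≤ capacity′ S
      by (Ss , central , edges , pairs≤) = begin
        chordSum K (cutSize S)                              ≤⟨ ∑-mono js (λ c → pairs≤ (Chorded.cu K c) (Chorded.cv K c)) ⟩
        N.∑ js (λ c → N.∑ Ss (λ T → cutSize T (Chorded.cu K c) (Chorded.cv K c)))  ≡⟨ N.∑-swap js Ss _ ⟩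
        N.∑ Ss (λ T → chordSum K (cutSize T))               ≤⟨ ∑-mono∈ Ss (λ T T∈ → central-cut T (All.lookup central T∈)) ⟩
        N.∑ Ss capacity′                                    ≡⟨ N.∑-swap Ss (allFin m) _ ⟩
        N.∑ (allFin m) (λ e → N.∑ Ss (λ T → cap e * bit (cut T e)))  ≡⟨ N.∑-cong (allFin m) (λ e → ≡-trans (N.∑-*ˡ Ss (cap e) _) (cong (cap e *_) (sym (edges e)))) ⟩
        capacity′ S                                         ∎
        where open ≤-Reasoning

    bound : ∀ l → N.∑ (allFin numFaces) (λ F → pairs (Distance.dist G l) F (X F)) ≤ N.∑ (allFin m) (λ e → cap e * l e)
    bound l = ≤-trans (≤-reflexive (sym (proj₂ laid (Distance.dist G l)))) (ChordsBound.chords-bound G l K any-cut)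

  face-inequality : ∀ l F → pairs (Distance.dist G l) F (demands F) ≤ pairs (Distance.dist G l) F (Sep.XN F) + 2 * pairs (Distance.dist G l) F (Sep.XL F)
  face-inequality l F = ≤-trans (Kal.total-mono X (N′ ++ (L ++ L)) okX (Allₚ.++⁺ okN (Allₚ.++⁺ okL okL)) (λ p q p≤q q≤M → ≤-trans (Sep.dominates F p q p≤q q≤M) (≤-reflexive (sym (three (λ c → bit (χ c p xor χ c q)))))))
      (≤-reflexive (three (λ c → δ (proj₁ c) (proj₂ c))))
    where
    open Distance G
    X = demands F
    N′ = Sep.XN F
    L = Sep.XL F
    δ : ℕ → ℕ → ℕ
    δ s t = dist l (vtx (base F) s) (vtx (base F) t)
    module Kal = Kalmanson δ (M F) (λ i → dist-refl l _) (λ i k → dist-sym l _ _) (λ k → cong (λ z → dist l z (vtx (base F) k)) (vtx-period (base F))) (face-kalmanson (base F) l)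
    okX : All Kal.Proper X
    okX = All.map (λ { (a , b , c) → <⇒≤ (<-≤-trans a b) , <⇒≤ c }) (demands-separated F)
    okN : All Kal.Proper N′
    okN = Peel-proper (proj₂ (Sep.nested F))
    okL : All Kal.Proper L
    okL = Peel-proper (proj₂ (Sep.local F))
    three : ∀ (g : ℕ × ℕ → ℕ) → N.∑ (N′ ++ (L ++ L)) g ≡ N.∑ N′ g + 2 * N.∑ L g
    three g = ≡-trans (N.∑-++ N′ (L ++ L) g) (cong (N.∑ N′ g +_) (≡-trans (N.∑-++ L L g) (cong (N.∑ L g +_) (sym (+-identityʳ (N.∑ L g))))))

  metric-inequality : ∀ l → N.∑ (allFin k) (λ i → Distance.dist G l (proj₁ (H i)) (proj₂ (H i))) ≤ 3 * N.∑ (allFin m) (λ e → cap e * l e)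
  metric-inequality l = begin
    N.∑ (allFin k) (λ i → d (proj₁ (H i)) (proj₂ (H i)))               ≡⟨ demand-sum d (Distance.dist-sym G l) ⟩
    N.∑ Fs (λ F → pairs d F (demands F))                               ≤⟨ ∑-mono Fs (face-inequality l) ⟩
    N.∑ Fs (λ F → pairs d F (Sep.XN F) + 2 * pairs d F (Sep.XL F))     ≡⟨ ≡-trans (N.∑-+ Fs _ _) (cong (N.∑ Fs (λ F → pairs d F (Sep.XN F)) +_) (N.∑-*ˡ Fs 2 _)) ⟩
    N.∑ Fs (λ F → pairs d F (Sep.XN F)) + 2 * N.∑ Fs (λ F → pairs d F (Sep.XL F)) ≤⟨ +-mono-≤ (DN.bound l) (*-monoʳ-≤ 2 (DL.bound l)) ⟩
    3 * N.∑ (allFin m) (λ e → cap e * l e)                             ∎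
    where
    open ≤-Reasoning
    d = Distance.dist G l
    Fs = allFin numFaces
    module DN = Dominated (λ F → Sep.XN F) (λ F → _ , proj₂ (Sep.nested F)) (λ F → Sep.nested-dominated F)
    module DL = Dominated (λ F → Sep.XL F) (λ F → _ , proj₂ (Sep.local F)) (λ F → Sep.local-dominated F)

-- Fourier–Motzkin elimination
Sat : Bool → ℤ → Set
Sat true  x = ℤ.0ℤ ℤ.< x
Sat false x = ℤ.0ℤ ℤ.≤ x

sat-∨ˡ : ∀ f g {x} → Sat (f ∨ g) x → Sat f x
sat-∨ˡ true  g     h = h
sat-∨ˡ false true  h = ℤₚ.<⇒≤ h
sat-∨ˡ false false h = h

sat-∨ʳ : ∀ f g {x} → Sat (f ∨ g) x → Sat g x
sat-∨ʳ true  true  h = h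
sat-∨ʳ true  false h = ℤₚ.<⇒≤ h
sat-∨ʳ false g     h = h

sat-< : ∀ f {x} → ℤ.0ℤ ℤ.< x → Sat f x
sat-< true  h = h
sat-< false h = ℤₚ.<⇒≤ h

sat-+ : ∀ f {x y} → Sat f x → ℤ.0ℤ ℤ.≤ y → Sat f (x ℤ.+ y)
sat-+ true  h k = ℤₚ.+-mono-<-≤ h k
sat-+ false h k = ℤₚ.+-mono-≤ h k

sat-* : ∀ f k {x} → Sat f x → Sat f (ℤ.+ suc k ℤ.* x)
sat-* true  k {x} h = subst (ℤ._< ℤ.+ suc k ℤ.* x) (ℤₚ.*-zeroʳ (ℤ.+ suc k)) (ℤₚ.*-monoˡ-<-pos (ℤ.+ suc k) h)
sat-* false k {x} h = subst (ℤ._≤ ℤ.+ suc k ℤ.* x) (ℤₚ.*-zeroʳ (ℤ.+ suc k)) (ℤₚ.*-monoˡ-≤-nonNeg (ℤ.+ suc k) h)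

dot : ∀ {d} → (Fin d → ℤ) → (Fin d → ℤ) → ℤ
dot {d} v y = Z.∑ (allFin d) (λ i → v i ℤ.* y i)

Constraint : ℕ → Set
Constraint d = Bool × (Fin d → ℤ)

Holds : ∀ {d} → (Fin d → ℤ) → Constraint d → Set
Holds y (f , v) = Sat f (dot v y)

-- `Q` plays the role of Farkas multipliers: it holds for the given constraints and passes to their
-- sums, so elimination hands it on to every derived inequality.
record Inherited {d : ℕ} (Q : Bool → (Fin d → ℤ) → Set) : Set where
  field
    resp : ∀ {f v v'} → (∀ i → v i ≡ v' i) → Q f v → Q f v'
    plus : ∀ {f f' v v'} → Q f v → Q f' v' → Q (f ∨ f') (λ i → v i ℤ.+ v' i)

  scale : ∀ {f v} k → Q f v → Q f (λ i → ℤ.+ suc k ℤ.* v i)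
  scale {v = v} zero    q = resp (λ i → sym (ℤₚ.*-identityˡ (v i))) q
  scale {f} {v} (suc k) q = resp (λ i → sym (step (v i))) (subst (λ g → Q g _) (∨-idem f) (plus q (scale k q)))
    where
    step : ∀ x → ℤ.+ suc (suc k) ℤ.* x ≡ x ℤ.+ ℤ.+ suc k ℤ.* x
    step x = ℤₚ.suc-* (ℤ.+ suc k) x

module Eliminate {d : ℕ} (y' : Fin d → ℤ) where
  -- a constraint (suc α) x₀ + a ≥ 0 or - (suc β) x₀ + b ≥ 0, with its strictness
  Bound : Set
  Bound = Bool × ℕ × ℤ

  -- The least of the ratios of constant to coefficient, compared by cross-multiplication.
  tightest : ∀ (p : Bound) ps → ∃[ q ] (q ∈ p ∷ ps × All (λ r → proj₂ (proj₂ q) ℤ.* ℤ.+ suc (proj₁ (proj₂ r)) ℤ.≤ proj₂ (proj₂ r) ℤ.* ℤ.+ suc (proj₁ (proj₂ q))) (p ∷ ps))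
  tightest p [] = p , here refl , ℤₚ.≤-refl ∷ []
  tightest p (r ∷ ps) with tightest r ps
  ... | q , q∈ , best with ℤₚ.≤-total (proj₂ (proj₂ q) ℤ.* ℤ.+ suc (proj₁ (proj₂ p))) (proj₂ (proj₂ p) ℤ.* ℤ.+ suc (proj₁ (proj₂ q)))
  ...   | inj₁ le = q , there q∈ , le ∷ best
  ...   | inj₂ ge = p , here refl , ℤₚ.≤-refl ∷ All.map (λ {r} → ratio {r} ge) best
    where
    ratio : ∀ {r} → proj₂ (proj₂ p) ℤ.* ℤ.+ suc (proj₁ (proj₂ q)) ℤ.≤ proj₂ (proj₂ q) ℤ.* ℤ.+ suc (proj₁ (proj₂ p)) →
      proj₂ (proj₂ q) ℤ.* ℤ.+ suc (proj₁ (proj₂ r)) ℤ.≤ proj₂ (proj₂ r) ℤ.* ℤ.+ suc (proj₁ (proj₂ q)) →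
      proj₂ (proj₂ p) ℤ.* ℤ.+ suc (proj₁ (proj₂ r)) ℤ.≤ proj₂ (proj₂ r) ℤ.* ℤ.+ suc (proj₁ (proj₂ p))
    ratio {r} h₁ h₂ = ℤₚ.*-cancelʳ-≤-pos (P ℤ.* R) (R' ℤ.* P') Q
      (subst₂ ℤ._≤_ (swap₁ P R Q) refl (ℤₚ.≤-trans (ℤₚ.*-monoʳ-≤-nonNeg R h₁) (subst₂ ℤ._≤_ (swap₃ (proj₂ (proj₂ q)) R P') (swap₃ R' Q P') (ℤₚ.*-monoʳ-≤-nonNeg P' h₂))))
      where
      P = proj₂ (proj₂ p)
      R = ℤ.+ suc (proj₁ (proj₂ r))
      Q = ℤ.+ suc (proj₁ (proj₂ q))
      P' = ℤ.+ suc (proj₁ (proj₂ p))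
      R' = proj₂ (proj₂ r)
      swap₁ : ∀ p r q → p ℤ.* q ℤ.* r ≡ p ℤ.* r ℤ.* q
      swap₁ = ℤ-Solver.solve-∀
      swap₃ : ∀ x r p → x ℤ.* r ℤ.* p ≡ x ℤ.* p ℤ.* r
      swap₃ = ℤ-Solver.solve-∀

  -- By homogeneity the solution found so far may be multiplied by `suc c`, which keeps the new
  -- coordinate `x` an integer.
  Good : List Bound → List Bound → Set
  Good ps ns = ∃[ c ] ∃[ x ] (
    All (λ { (f , α , a) → Sat f (ℤ.+ suc α ℤ.* x ℤ.+ ℤ.+ suc c ℤ.* a) }) ps ×
    All (λ { (f , β , b) → Sat f (ℤ.+ suc c ℤ.* b ℤ.- ℤ.+ suc β ℤ.* x) }) ns)

  bigger : List Bound → ℕ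
  bigger ps = suc (N.∑ ps (λ { (_ , _ , a) → ℤ.∣ a ∣ }))

  big-enough : ∀ ps {f α a} → (f , α , a) ∈ ps → ℤ.0ℤ ℤ.< ℤ.+ suc α ℤ.* ℤ.+ bigger ps ℤ.+ a
  big-enough ps {f} {α} {a} p∈ = ℤₚ.<-≤-trans (positive a) (ℤₚ.+-monoˡ-≤ a (ℤₚ.≤-trans (ℤ.+≤+ (≤-trans (s≤s (term≤∑ ps (λ { (_ , _ , a) → ℤ.∣ a ∣ }) p∈)) (m≤m+n (bigger ps) (α * bigger ps)))) (ℤₚ.≤-reflexive (ℤₚ.pos-* (suc α) (bigger ps)))))
    where
    positive : ∀ a → ℤ.0ℤ ℤ.< ℤ.+ suc ℤ.∣ a ∣ ℤ.+ a
    positive (ℤ.+ n)    = ℤ.+<+ (s≤s z≤n)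
    positive -[1+ n ] = subst (ℤ.0ℤ ℤ.<_) (sym (one n)) (ℤ.+<+ (s≤s z≤n))
      where
      one : ∀ n → ℤ.+ suc (suc n) ℤ.+ -[1+ n ] ≡ ℤ.1ℤ
      one n = ≡-trans (ℤₚ.⊖-≥ (n≤1+n (suc n))) (cong ℤ.+_ (m+n∸n≡m 1 n))

  -- between the tightest lower and the tightest upper bound take the midpoint
  choose : ∀ ps ns → (∀ {f α a g β b} → (f , α , a) ∈ ps → (g , β , b) ∈ ns → Sat (f ∨ g) (ℤ.+ suc β ℤ.* a ℤ.+ ℤ.+ suc α ℤ.* b)) → Good ps ns
  choose ps [] h = 0 , ℤ.+ bigger ps , All.tabulate (λ { {f , α , a} p∈ → sat-< f (subst (ℤ.0ℤ ℤ.<_) (cong (ℤ._+_ (ℤ.+ suc α ℤ.* ℤ.+ bigger ps)) (sym (ℤₚ.*-identityˡ a))) (big-enough ps p∈)) }) , []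
  choose [] ns h = 0 , ℤ.- (ℤ.+ bigger ns) , [] , All.tabulate (λ { {f , β , b} n∈ → sat-< f (subst (ℤ.0ℤ ℤ.<_) (ring (ℤ.+ suc β) (ℤ.+ bigger ns) b) (big-enough ns n∈)) })
    where
    ring : ∀ β x b → β ℤ.* x ℤ.+ b ≡ ℤ.1ℤ ℤ.* b ℤ.- β ℤ.* (ℤ.- x)
    ring = ℤ-Solver.solve-∀
  choose (p ∷ ps) (n ∷ ns) h with tightest p ps | tightest n ns
  ... | (f , α , a) , p∈ , lows | (g , β , b) , n∈ , ups =
        c , A ℤ.* b ℤ.- B' ℤ.* a , All.tabulate low , All.tabulate up
    where
    A B' C : ℤ
    A = ℤ.+ suc α
    B' = ℤ.+ suc β
    c : ℕ
    -- Written so that `suc c` computes to `2 * (suc α * suc β)`, the denominator of the midpoint of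
    -- `- a / A` and `b / B'`.
    c = (β + α * suc β) + (suc α * suc β + 0)
    C = ℤ.+ suc c
    C≡ : C ≡ ℤ.+ 2 ℤ.* (A ℤ.* B')
    C≡ = ≡-trans (ℤₚ.pos-* 2 (suc α * suc β)) (cong (ℤ.+ 2 ℤ.*_) (ℤₚ.pos-* (suc α) (suc β)))
    low : ∀ {r} → r ∈ p ∷ ps → Sat (proj₁ r) (ℤ.+ suc (proj₁ (proj₂ r)) ℤ.* (A ℤ.* b ℤ.- B' ℤ.* a) ℤ.+ C ℤ.* proj₂ (proj₂ r))
    low {f' , α' , a'} r∈ = subst (Sat f') (≡-trans (ring A B' (ℤ.+ suc α') a b a') (cong (λ z → ℤ.+ suc α' ℤ.* (A ℤ.* b ℤ.- B' ℤ.* a) ℤ.+ z ℤ.* a') (sym C≡)))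
        (sat-+ f' (sat-* f' α (sat-∨ˡ f' g (h r∈ n∈))) (sat-* false β (ℤₚ.i≤j⇒0≤j-i (All.lookup lows r∈))))
      where
      ring : ∀ A B α' a b a' → A ℤ.* (B ℤ.* a' ℤ.+ α' ℤ.* b) ℤ.+ B ℤ.* (a' ℤ.* A ℤ.- a ℤ.* α') ≡ α' ℤ.* (A ℤ.* b ℤ.- B ℤ.* a) ℤ.+ (ℤ.+ 2 ℤ.* (A ℤ.* B)) ℤ.* a'
      ring = ℤ-Solver.solve-∀
    up : ∀ {r} → r ∈ n ∷ ns → Sat (proj₁ r) (C ℤ.* proj₂ (proj₂ r) ℤ.- ℤ.+ suc (proj₁ (proj₂ r)) ℤ.* (A ℤ.* b ℤ.- B' ℤ.* a))
    up {g' , β' , b'} r∈ = subst (Sat g') (≡-trans (ring A B' (ℤ.+ suc β') a b b') (cong (λ z → z ℤ.* b' ℤ.- ℤ.+ suc β' ℤ.* (A ℤ.* b ℤ.- B' ℤ.* a)) (sym C≡)))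
        (sat-+ g' (sat-* g' β (sat-∨ʳ f g' (h p∈ r∈))) (sat-* false α (ℤₚ.i≤j⇒0≤j-i (All.lookup ups r∈))))
      where
      ring : ∀ A B β' a b b' → B ℤ.* (β' ℤ.* a ℤ.+ A ℤ.* b') ℤ.+ A ℤ.* (b' ℤ.* B ℤ.- b ℤ.* β') ≡ (ℤ.+ 2 ℤ.* (A ℤ.* B)) ℤ.* b' ℤ.- β' ℤ.* (A ℤ.* b ℤ.- B ℤ.* a)
      ring = ℤ-Solver.solve-∀

dot-suc : ∀ {d} (v y : Fin (suc d) → ℤ) → dot v y ≡ v zero ℤ.* y zero ℤ.+ dot (v ∘ suc) (y ∘ suc)
dot-suc v y = Z.∑-suc (λ i → v i ℤ.* y i)

dot-comb : ∀ {d} (c c' : ℤ) (v v' y : Fin d → ℤ) → dot (λ i → c ℤ.* v i ℤ.+ c' ℤ.* v' i) y ≡ c ℤ.* dot v y ℤ.+ c' ℤ.* dot v' y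
dot-comb {d} c c' v v' y = ≡-trans (Z.∑-cong (allFin d) (λ i → ring c c' (v i) (v' i) (y i))) (≡-trans (Z.∑-+ (allFin d) _ _) (cong₂ ℤ._+_ (Z.∑-*ˡ (allFin d) c _) (Z.∑-*ˡ (allFin d) c' _)))
  where
  ring : ∀ c c' x x' y → (c ℤ.* x ℤ.+ c' ℤ.* x') ℤ.* y ≡ c ℤ.* (x ℤ.* y) ℤ.+ c' ℤ.* (x' ℤ.* y)
  ring = ℤ-Solver.solve-∀

dot-scaleʳ : ∀ {d} (c : ℤ) (v y : Fin d → ℤ) → dot v (λ i → c ℤ.* y i) ≡ c ℤ.* dot v y
dot-scaleʳ {d} c v y = ≡-trans (Z.∑-cong (allFin d) (λ i → ring c (v i) (y i))) (Z.∑-*ˡ (allFin d) c _)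
  where
  ring : ∀ c x y → x ℤ.* (c ℤ.* y) ≡ c ℤ.* (x ℤ.* y)
  ring = ℤ-Solver.solve-∀

record Sorted (d : ℕ) : Set where
  constructor sorted
  field
    zeros     : List (Constraint d)
    poss negs : List (Bool × ℕ × (Fin d → ℤ))

headed : ∀ {d} → ℤ → (Fin d → ℤ) → Fin (suc d) → ℤ
headed x v zero    = x
headed x v (suc i) = v i

sort : ∀ {d} → List (Constraint (suc d)) → Sorted d
sort [] = sorted [] [] []
sort ((f , v) ∷ cs) with v zero | sort cs
... | ℤ.+ zero    | sorted z p n = sorted ((f , v ∘ suc) ∷ z) p n
... | ℤ.+ suc α   | sorted z p n = sorted z ((f , α , v ∘ suc) ∷ p) n
... | -[1+ β ]  | sorted z p n = sorted z p ((f , β , v ∘ suc) ∷ n)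

module _ {d : ℕ} {Q : Bool → (Fin (suc d) → ℤ) → Set} (inh : Inherited Q) where
  open Inherited inh
  open Sorted

  SortedIn : Sorted d → Set
  SortedIn s = All (λ { (f , v) → Q f (headed ℤ.0ℤ v) }) (zeros s) × All (λ { (f , α , v) → Q f (headed (ℤ.+ suc α) v) }) (poss s) ×
               All (λ { (f , β , v) → Q f (headed -[1+ β ] v) }) (negs s)

  sort-in : ∀ cs → All (λ { (f , v) → Q f v }) cs → SortedIn (sort cs)
  sort-in [] [] = [] , [] , []
  sort-in ((f , v) ∷ cs) (q ∷ qs) with v zero in eq | sort cs | sort-in cs qs
  ... | ℤ.+ zero  | sorted _ _ _ | z , p , n = resp (λ { zero → eq ; (suc i) → refl }) q ∷ z , p , n
  ... | ℤ.+ suc α | sorted _ _ _ | z , p , n = z , resp (λ { zero → eq ; (suc i) → refl }) q ∷ p , n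
  ... | -[1+ β ]  | sorted _ _ _ | z , p , n = z , p , resp (λ { zero → eq ; (suc i) → refl }) q ∷ n

sort-holds : ∀ {d} cs (y : Fin (suc d) → ℤ) → let open Sorted (sort cs) in
  All (λ { (f , v) → Sat f (dot v (y ∘ suc)) }) zeros → All (λ { (f , α , v) → Sat f (ℤ.+ suc α ℤ.* y zero ℤ.+ dot v (y ∘ suc)) }) poss →
  All (λ { (f , β , v) → Sat f (dot v (y ∘ suc) ℤ.- ℤ.+ suc β ℤ.* y zero) }) negs → All (Holds y) cs
sort-holds [] y z p n = []
sort-holds ((f , v) ∷ cs) y z p n with v zero in eq | sort cs | sort-holds cs y
sort-holds ((f , v) ∷ cs) y (h ∷ z) p n | ℤ.+ zero | sorted _ _ _ | rec =
  subst (Sat f) (sym (≡-trans (dot-suc v y) (≡-trans (cong (λ x → x ℤ.* y zero ℤ.+ dot (v ∘ suc) (y ∘ suc)) eq) (≡-trans (cong (ℤ._+ dot (v ∘ suc) (y ∘ suc)) (ℤₚ.*-zeroˡ (y zero))) (ℤₚ.+-identityˡ _))))) h ∷ rec z p n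
sort-holds ((f , v) ∷ cs) y z (h ∷ p) n | ℤ.+ suc α | sorted _ _ _ | rec =
  subst (Sat f) (sym (≡-trans (dot-suc v y) (cong (λ x → x ℤ.* y zero ℤ.+ dot (v ∘ suc) (y ∘ suc)) eq))) h ∷ rec z p n
sort-holds ((f , v) ∷ cs) y z p (h ∷ n) | -[1+ β ] | sorted _ _ _ | rec =
  subst (Sat f) (sym (≡-trans (dot-suc v y) (≡-trans (cong (λ x → x ℤ.* y zero ℤ.+ dot (v ∘ suc) (y ∘ suc)) eq)
    (≡-trans (cong (ℤ._+ dot (v ∘ suc) (y ∘ suc)) (sym (ℤₚ.neg-distribˡ-* (ℤ.+ suc β) (y zero)))) (ℤₚ.+-comm (ℤ.- (ℤ.+ suc β ℤ.* y zero)) (dot (v ∘ suc) (y ∘ suc))))))) h ∷ rec z p n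

combine′ : ∀ {d} → Bool × ℕ × (Fin d → ℤ) → Bool × ℕ × (Fin d → ℤ) → Constraint d
combine′ (f , α , v) (g , β , u) = f ∨ g , λ i → ℤ.+ suc β ℤ.* v i ℤ.+ ℤ.+ suc α ℤ.* u i

abstract
  -- Farkas' lemma for homogeneous systems: without a solution, the contradiction 0 > 0 is derived
  -- and carries `Q`.
  fourier-motzkin : ∀ d (Q : Bool → (Fin d → ℤ) → Set) → Inherited Q → (cs : List (Constraint d)) → All (λ { (f , v) → Q f v }) cs →
    (Σ (Fin d → ℤ) λ y → All (Holds y) cs) ⊎ Q true (λ _ → ℤ.0ℤ)
  fourier-motzkin zero Q inh [] [] = inj₁ ((λ ()) , [])
  fourier-motzkin zero Q inh ((true  , v) ∷ cs) (q ∷ qs) = inj₂ (Inherited.resp inh (λ ()) q)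
  fourier-motzkin zero Q inh ((false , v) ∷ cs) (q ∷ qs) with fourier-motzkin zero Q inh cs qs
  ... | inj₁ (y , hs) = inj₁ (y , ℤₚ.≤-refl ∷ hs)
  ... | inj₂ r        = inj₂ r
  fourier-motzkin (suc d) Q inh cs qs = finish (fourier-motzkin d Q' inh' cs' qs')
    where
    open Inherited inh
    open Sorted (sort cs)
    Q' : Bool → (Fin d → ℤ) → Set
    Q' f v = Q f (headed ℤ.0ℤ v)
    inh' : Inherited Q'
    inh' = record { resp = λ h → resp (λ { zero → refl ; (suc i) → h i }) ; plus = λ q q' → resp (λ { zero → refl ; (suc i) → refl }) (plus q q') }
    cs' : List (Constraint d)
    cs' = zeros ++ cartesianProductWith combine′ poss negs
    sin : SortedIn inh (sort cs)
    sin = sort-in inh cs qs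
    qs' : All (λ { (f , v) → Q' f v }) cs'
    qs' = Allₚ.++⁺ (proj₁ sin) (All.tabulate pairQ)
      where
      pairQ : ∀ {c} → c ∈ cartesianProductWith combine′ poss negs → Q' (proj₁ c) (proj₂ c)
      pairQ c∈ with ∈-cartesianProductWith⁻ combine′ poss negs c∈
      ... | (f , α , v) , (g , β , u) , p∈ , n∈ , refl = resp (λ { zero → cancel ; (suc i) → refl })
            (plus (scale β (All.lookup (proj₁ (proj₂ sin)) p∈)) (scale α (All.lookup (proj₂ (proj₂ sin)) n∈)))
        where
        cancel : ℤ.+ suc β ℤ.* ℤ.+ suc α ℤ.+ ℤ.+ suc α ℤ.* -[1+ β ] ≡ ℤ.0ℤ
        cancel = ring (ℤ.+ suc β) (ℤ.+ suc α)
          where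
          ring : ∀ x y → x ℤ.* y ℤ.+ y ℤ.* (ℤ.- x) ≡ ℤ.0ℤ
          ring = ℤ-Solver.solve-∀
    finish : (Σ (Fin d → ℤ) λ y → All (Holds y) cs') ⊎ Q' true (λ _ → ℤ.0ℤ) → (Σ (Fin (suc d) → ℤ) λ y → All (Holds y) cs) ⊎ Q true (λ _ → ℤ.0ℤ)
    finish (inj₂ q) = inj₂ (resp (λ { zero → refl ; (suc i) → refl }) q)
    finish (inj₁ (y' , hs)) = inj₁ (assemble (E.choose (map eval poss) (map eval negs) pairHolds))
      where
      module E = Eliminate y'
      eval : Bool × ℕ × (Fin d → ℤ) → E.Bound
      eval (f , α , v) = f , α , dot v y'
      pairHolds : ∀ {f α a g β b} → (f , α , a) ∈ map eval poss → (g , β , b) ∈ map eval negs → Sat (f ∨ g) (ℤ.+ suc β ℤ.* a ℤ.+ ℤ.+ suc α ℤ.* b)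
      pairHolds p∈ n∈ with ∈-map⁻ eval p∈ | ∈-map⁻ eval n∈
      ... | (f , α , v) , pv∈ , refl | (g , β , u) , nu∈ , refl = subst (Sat (f ∨ g)) (dot-comb (ℤ.+ suc β) (ℤ.+ suc α) v u y')
            (All.lookup hs (∈-++⁺ʳ zeros (∈-cartesianProductWith⁺ combine′ pv∈ nu∈)))
      assemble : E.Good (map eval poss) (map eval negs) → Σ (Fin (suc d) → ℤ) λ y → All (Holds y) cs
      assemble (c , x , ps , ns) = y , sort-holds cs y
          (All.map (λ { {f , v} h → subst (Sat f) (sym (dot-scaleʳ (ℤ.+ suc c) v y')) (sat-* f c h) }) (Allₚ.++⁻ˡ zeros hs))
          (All.map (λ { {f , α , v} h → subst (Sat f) (cong (ℤ._+_ (ℤ.+ suc α ℤ.* x)) (sym (dot-scaleʳ (ℤ.+ suc c) v y'))) h }) (Allₚ.map⁻ ps))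
          (All.map (λ { {f , β , v} h → subst (Sat f) (cong (ℤ._- ℤ.+ suc β ℤ.* x) (sym (dot-scaleʳ (ℤ.+ suc c) v y'))) h }) (Allₚ.map⁻ ns))
        where
        y : Fin (suc d) → ℤ
        y = headed x (λ i → ℤ.+ suc c ℤ.* y' i)

-- Fractional flows from the metric inequality
ι : ℕ → ℚ
ι a = ℤ.+ a ℚ./ 1

ι-+ : ∀ a b → ι (a + b) ≡ ι a ℚ.+ ι b
ι-+ a b = ℚₚ.toℚᵘ-injective (ℚᵘₚ.≃-trans (ℚₚ.toℚᵘ-fromℚᵘ (ℚᵘ.mkℚᵘ (ℤ.+ (a + b)) 0)) (ℚᵘₚ.≃-trans (ℚᵘ.*≡* (ring (ℤ.+ a) (ℤ.+ b)))
  (ℚᵘₚ.≃-trans (ℚᵘₚ.≃-sym (ℚᵘₚ.+-cong (ℚₚ.toℚᵘ-fromℚᵘ (ℚᵘ.mkℚᵘ (ℤ.+ a) 0)) (ℚₚ.toℚᵘ-fromℚᵘ (ℚᵘ.mkℚᵘ (ℤ.+ b) 0)))) (ℚᵘₚ.≃-sym (ℚₚ.toℚᵘ-homo-+ (ι a) (ι b))))))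
  where
  ring : ∀ x y → (x ℤ.+ y) ℤ.* (ℤ.1ℤ ℤ.* ℤ.1ℤ) ≡ (x ℤ.* ℤ.1ℤ ℤ.+ y ℤ.* ℤ.1ℤ) ℤ.* ℤ.1ℤ
  ring = ℤ-Solver.solve-∀

ι-mono : ∀ {a b} → a ≤ b → ι a ℚ.≤ ι b
ι-mono {a} {b} a≤b = ℚₚ.toℚᵘ-cancel-≤ (ℚᵘₚ.≤-trans (ℚᵘₚ.≤-reflexive (ℚₚ.toℚᵘ-fromℚᵘ (ℚᵘ.mkℚᵘ (ℤ.+ a) 0)))
  (ℚᵘₚ.≤-trans (ℚᵘ.*≤* (ℤₚ.*-monoʳ-≤-nonNeg ℤ.1ℤ (ℤ.+≤+ a≤b))) (ℚᵘₚ.≤-reflexive (ℚᵘₚ.≃-sym (ℚₚ.toℚᵘ-fromℚᵘ (ℚᵘ.mkℚᵘ (ℤ.+ b) 0))))))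

unit : ℕ → ℚ
unit N = ℤ.+ 1 ℚ./ suc N

unit-nonneg : ∀ N → ℚ.NonNegative (unit N)
unit-nonneg N = ℚₚ.normalize-nonNeg 1 (suc N)

unit-cancel : ∀ N t → unit N ℚ.* ι (suc N * t) ≡ ι t
unit-cancel N t = ℚₚ.toℚᵘ-injective (ℚᵘₚ.≃-trans (ℚₚ.toℚᵘ-homo-* (unit N) (ι (suc N * t)))
  (ℚᵘₚ.≃-trans (ℚᵘₚ.*-cong (ℚₚ.toℚᵘ-fromℚᵘ (ℚᵘ.mkℚᵘ (ℤ.+ 1) N)) (ℚₚ.toℚᵘ-fromℚᵘ (ℚᵘ.mkℚᵘ (ℤ.+ (suc N * t)) 0)))
    (ℚᵘₚ.≃-trans (ℚᵘ.*≡* cross-mul) (ℚᵘₚ.≃-sym (ℚₚ.toℚᵘ-fromℚᵘ (ℚᵘ.mkℚᵘ (ℤ.+ t) 0))))))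
  where
  ring : ∀ x t → (ℤ.1ℤ ℤ.* (x ℤ.* t)) ℤ.* ℤ.1ℤ ≡ t ℤ.* (x ℤ.* ℤ.1ℤ)
  ring = ℤ-Solver.solve-∀
  cross-mul : (ℤ.1ℤ ℤ.* ℤ.+ (suc N * t)) ℤ.* ℤ.1ℤ ≡ ℤ.+ t ℤ.* ℤ.+ (suc N * 1)
  cross-mul = ≡-trans (cong (λ z → (ℤ.1ℤ ℤ.* z) ℤ.* ℤ.1ℤ) (ℤₚ.pos-* (suc N) t)) (≡-trans (ring (ℤ.+ suc N) (ℤ.+ t)) (cong (ℤ.+ t ℤ.*_) (sym (ℤₚ.pos-* (suc N) 1))))

Z∑-↑ : ∀ n f (g : Fin (n + f) → ℤ) →
  Z.∑ (allFin (n + f)) g ≡ Z.∑ (allFin n) (λ i → g (i ↑ˡ f)) ℤ.+ Z.∑ (allFin f) (λ i → g (n ↑ʳ i))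
Z∑-↑ zero    f g = sym (ℤₚ.+-identityˡ _)
Z∑-↑ (suc n) f g = ≡-trans (Z.∑-suc g) (≡-trans (cong (ℤ._+_ (g zero)) (Z∑-↑ n f (λ i → g (suc i))))
  (≡-trans (sym (ℤₚ.+-assoc (g zero) (Z.∑ (allFin n) (λ i → g (suc i ↑ˡ f))) (Z.∑ (allFin f) (λ i → g (suc n ↑ʳ i)))))
    (cong (ℤ._+ Z.∑ (allFin f) (λ i → g (suc n ↑ʳ i))) (sym (Z.∑-suc (λ i → g (i ↑ˡ f)))))))

Z∑-pick : ∀ {n} (i : Fin n) (f : Fin n → ℤ) → Z.∑ (allFin n) (λ j → ℤ.+ bit ⌊ j ≟ i ⌋ ℤ.* f j) ≡ f i
Z∑-pick {n} i f = ≡-trans (Z.∑-cong (allFin n) (λ j → pick (f j) ⌊ j ≟ i ⌋)) (Z.∑-pick _≟_ (allFin n) i f (Uniqueₚ.allFin⁺ n) (∈-allFin i))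
  where
  pick : ∀ x b → ℤ.+ bit b ℤ.* x ≡ (if b then x else ℤ.0ℤ)
  pick x true  = ℤₚ.*-identityˡ x
  pick x false = ℤₚ.*-zeroˡ x

module Flow {n m k : ℕ} (G : PlaneGraph n m) (H : Demands n k) (t : ℕ) where
  open PlaneGraph G
  open Distance G using (dist; dist-attained; paths; ∈-paths; isPath?; len)

  Routed : Set
  Routed = Fin k × List (Dart m)

  IsRoute : Routed → Set
  IsRoute (i , ds) = IsPath (proj₁ (H i)) ds (proj₂ (H i))

  usage : Fin m → Routed → ℕ
  usage e P = uses G e (proj₂ P)

  serves : Fin k → Routed → ℕ
  serves i P = bit ⌊ proj₁ P ≟ i ⌋

  -- The inequality obtained by adding N copies of Σ z i - t Σ cap e l e > 0, the inequalities
  -- l(P) - z i ≥ 0 of the paths in Ps, and s e copies of l e ≥ 0.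
  demandPart : ℕ → List Routed → Fin k → ℤ
  demandPart N Ps i = ℤ.+ N ℤ.- ℤ.+ N.∑ Ps (serves i)

  edgePart : ℕ → List Routed → (Fin m → ℕ) → Fin m → ℤ
  edgePart N Ps s e = ℤ.+ (N.∑ Ps (usage e) + s e) ℤ.- ℤ.+ (N * (t * cap e))

  record Combination (f : Bool) (v : Fin (k + m) → ℤ) : Set where
    constructor combination
    field
      N      : ℕ
      strict : f ≡ true → 0 < N
      Ps     : List Routed
      routes : All IsRoute Ps
      s      : Fin m → ℕ
      v-demand : ∀ i → v (i ↑ˡ m) ≡ demandPart N Ps i
      v-edge   : ∀ e → v (k ↑ʳ e) ≡ edgePart N Ps s e

  inherited : Inherited Combination
  inherited = record { resp = resp′ ; plus = plus′ }
    where
    resp′ : ∀ {f v v'} → (∀ i → v i ≡ v' i) → Combination f v → Combination f v'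
    resp′ h (combination N st Ps ok s vd ve) = combination N st Ps ok s (λ i → ≡-trans (sym (h _)) (vd i)) (λ e → ≡-trans (sym (h _)) (ve e))
    plus′ : ∀ {f f' v v'} → Combination f v → Combination f' v' → Combination (f ∨ f') (λ i → v i ℤ.+ v' i)
    plus′ {f} {f'} (combination N st Ps ok s vd ve) (combination N' st' Ps' ok' s' vd' ve') =
      combination (N + N') (pos f f' st st') (Ps ++ Ps') (Allₚ.++⁺ ok ok') (λ e → s e + s' e)
        (λ i → ≡-trans (cong₂ ℤ._+_ (vd i) (vd' i)) (≡-trans (ring (ℤ.+ N) (ℤ.+ N.∑ Ps (serves i)) (ℤ.+ N') (ℤ.+ N.∑ Ps' (serves i)))
          (cong (λ z → ℤ.+ (N + N') ℤ.- ℤ.+ z) (sym (N.∑-++ Ps Ps' (serves i))))))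
        (λ e → ≡-trans (cong₂ ℤ._+_ (ve e) (ve' e)) (≡-trans (ring (ℤ.+ (N.∑ Ps (usage e) + s e)) (ℤ.+ (N * (t * cap e))) (ℤ.+ (N.∑ Ps' (usage e) + s' e)) (ℤ.+ (N' * (t * cap e))))
          (cong₂ (λ x y → ℤ.+ x ℤ.- ℤ.+ y) (≡-trans (regroup (N.∑ Ps (usage e)) (s e) (N.∑ Ps' (usage e)) (s' e)) (cong (_+ (s e + s' e)) (sym (N.∑-++ Ps Ps' (usage e))))) (sym (*-distribʳ-+ (t * cap e) N N')))))
      where
      ring : ∀ a b c d → (a ℤ.- b) ℤ.+ (c ℤ.- d) ≡ (a ℤ.+ c) ℤ.- (b ℤ.+ d)
      ring = ℤ-Solver.solve-∀
      regroup : ∀ a b c d → (a + b) + (c + d) ≡ (a + c) + (b + d)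
      regroup = ℕ-Solver.solve-∀
      pos : ∀ f f' → (f ≡ true → 0 < N) → (f' ≡ true → 0 < N') → f ∨ f' ≡ true → 0 < N + N'
      pos true  f' st st' h = ≤-trans (st refl) (m≤m+n N N')
      pos false f' st st' h = ≤-trans (st' h) (m≤n+m N' N)

  vec : (Fin k → ℤ) → (Fin m → ℤ) → Fin (k + m) → ℤ
  vec a b j = [ a , b ]′ (splitAt k j)

  vec-l : ∀ a b i → vec a b (i ↑ˡ m) ≡ a i
  vec-l a b i = cong [ a , b ]′ (Data.Fin.Properties.splitAt-↑ˡ k i m)
    where import Data.Fin.Properties

  vec-r : ∀ a b e → vec a b (k ↑ʳ e) ≡ b e
  vec-r a b e = cong [ a , b ]′ (Data.Fin.Properties.splitAt-↑ʳ k m e)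
    where import Data.Fin.Properties

  gen : ℕ → List Routed → (Fin m → ℕ) → Fin (k + m) → ℤ
  gen N Ps s = vec (demandPart N Ps) (edgePart N Ps s)

  gen-combination : ∀ {f} N Ps s → (f ≡ true → 0 < N) → All IsRoute Ps → Combination f (gen N Ps s)
  gen-combination N Ps s st ok = combination N st Ps ok s (vec-l (demandPart N Ps) (edgePart N Ps s)) (vec-r (demandPart N Ps) (edgePart N Ps s))

  slack : Fin m → Fin m → ℕ
  slack e₀ e = bit ⌊ e ≟ e₀ ⌋

  none : Fin m → ℕ
  none _ = 0

  routesOf : Fin k → List Routed
  routesOf i = map (i ,_) (paths (proj₁ (H i)) (proj₂ (H i)))

  routeList : List Routed
  routeList = concat (map routesOf (allFin k))

  routesOf-ok : ∀ i → All IsRoute (routesOf i)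
  routesOf-ok i = Allₚ.map⁺ (Allₚ.all-filter (isPath? (proj₁ (H i)) (proj₂ (H i))) (listsUpTo (dartList m) n))

  routeList-ok : All IsRoute routeList
  routeList-ok = Allₚ.concat⁺ {xss = map routesOf (allFin k)} (Allₚ.map⁺ {f = routesOf} (All.tabulate {xs = allFin k} (λ {i} _ → routesOf-ok i)))

  ∈-routeList : ∀ i {ds} → IsPath (proj₁ (H i)) ds (proj₂ (H i)) → (i , ds) ∈ routeList
  ∈-routeList i p = ∈-concat⁺′ (∈-map⁺ (i ,_) (∈-paths p)) (∈-map⁺ routesOf (∈-allFin i))

  constraints : List (Constraint (k + m))
  constraints = (true , gen 1 [] none) ∷ map (λ e → false , gen 0 [] (slack e)) (allFin m) ++ map (λ P → false , gen 0 (P ∷ []) none) routeList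

  constraints-ok : All (λ { (f , v) → Combination f v }) constraints
  constraints-ok = gen-combination 1 [] none (λ _ → s≤s z≤n) [] ∷ Allₚ.++⁺ (Allₚ.map⁺ (All.tabulate (λ {e} _ → gen-combination 0 [] (slack e) (λ ()) [])))
    (Allₚ.map⁺ (All.map (λ {P} ok → gen-combination 0 (P ∷ []) none (λ ()) (ok ∷ [])) routeList-ok))

  uses-count : ∀ e ds → uses G e ds ≡ count (map proj₁ ds) e
  uses-count e []       = refl
  uses-count e (d ∷ ds) with e ≟ proj₁ d
  ... | yes _ = cong suc (uses-count e ds)
  ... | no _  = uses-count e ds

  module Infeasible (y : Fin (k + m) → ℤ) (holds : All (Holds y) constraints) where
    z : Fin k → ℤ
    z i = y (i ↑ˡ m)
    w : Fin m → ℤ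
    w e = y (k ↑ʳ e)

    dot-gen : ∀ N Ps s → dot (gen N Ps s) y ≡ Z.∑ (allFin k) (λ i → demandPart N Ps i ℤ.* z i) ℤ.+ Z.∑ (allFin m) (λ e → edgePart N Ps s e ℤ.* w e)
    dot-gen N Ps s = ≡-trans (Z∑-↑ k m (λ j → gen N Ps s j ℤ.* y j)) (cong₂ ℤ._+_
      (Z.∑-cong (allFin k) (λ i → cong (ℤ._* z i) (vec-l (demandPart N Ps) (edgePart N Ps s) i)))
      (Z.∑-cong (allFin m) (λ e → cong (ℤ._* w e) (vec-r (demandPart N Ps) (edgePart N Ps s) e))))

    w-nonneg : ∀ e → ℤ.0ℤ ℤ.≤ w e
    w-nonneg e₀ = subst (ℤ.0ℤ ℤ.≤_) eq (All.lookup holds (there (∈-++⁺ˡ (∈-map⁺ (λ e → false , gen 0 [] (slack e)) (∈-allFin e₀)))))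
      where
      eq : dot (gen 0 [] (slack e₀)) y ≡ w e₀
      eq = ≡-trans (dot-gen 0 [] (slack e₀)) (≡-trans (cong₂ ℤ._+_ (≡-trans (Z.∑-cong (allFin k) (λ i → ℤₚ.*-zeroˡ (z i))) (Z.∑-0 (allFin k)))
        (≡-trans (Z.∑-cong (allFin m) (λ e → cong (ℤ._* w e) (ℤₚ.+-identityʳ (ℤ.+ bit ⌊ e ≟ e₀ ⌋)))) (Z∑-pick e₀ w))) (ℤₚ.+-identityˡ (w e₀)))

    l : Fin m → ℕ
    l e = ℤ.∣ w e ∣

    l-eq : ∀ e → w e ≡ ℤ.+ l e
    l-eq e = sym (ℤₚ.0≤i⇒+∣i∣≡i (w-nonneg e))

    z-bound : ∀ i {ds} → IsPath (proj₁ (H i)) ds (proj₂ (H i)) → z i ℤ.≤ ℤ.+ len l ds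
    z-bound i {ds} isP = ℤₚ.0≤i-j⇒j≤i (subst (ℤ.0ℤ ℤ.≤_) eq (All.lookup holds (there (∈-++⁺ʳ (map (λ e → false , gen 0 [] (slack e)) (allFin m)) (∈-map⁺ (λ P → false , gen 0 (P ∷ []) none) (∈-routeList i isP))))))
      where
      left : Z.∑ (allFin k) (λ j → demandPart 0 ((i , ds) ∷ []) j ℤ.* z j) ≡ ℤ.- z i
      left = ≡-trans (Z.∑-cong (allFin k) point) (Z∑-pick i (λ j → ℤ.- z j))
        where
        ring : ∀ x y → (ℤ.0ℤ ℤ.- x) ℤ.* y ≡ x ℤ.* (ℤ.- y)
        ring = ℤ-Solver.solve-∀
        point : ∀ j → demandPart 0 ((i , ds) ∷ []) j ℤ.* z j ≡ ℤ.+ bit ⌊ j ≟ i ⌋ ℤ.* (ℤ.- z j)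
        point j = ≡-trans (cong (λ x → (ℤ.0ℤ ℤ.- ℤ.+ x) ℤ.* z j) (≡-trans (+-identityʳ (bit ⌊ i ≟ j ⌋)) (cong bit (≟-sym i j)))) (ring (ℤ.+ bit ⌊ j ≟ i ⌋) (z j))
      right : Z.∑ (allFin m) (λ e → edgePart 0 ((i , ds) ∷ []) none e ℤ.* w e) ≡ ℤ.+ len l ds
      right = ≡-trans (Z.∑-cong (allFin m) (λ e → ≡-trans (cong₂ ℤ._*_ (≡-trans (ℤₚ.+-identityʳ (ℤ.+ (uses G e ds + 0 + 0))) (cong ℤ.+_ (≡-trans (+-identityʳ (uses G e ds + 0)) (≡-trans (+-identityʳ (uses G e ds)) (uses-count e ds))))) (l-eq e))
          (≡-trans (sym (ℤₚ.pos-* (count (map proj₁ ds) e) (l e))) (cong ℤ.+_ (*-comm (count (map proj₁ ds) e) (l e))))))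
        (≡-trans (∑-pos (allFin m) (λ e → l e * count (map proj₁ ds) e)) (cong ℤ.+_ (≡-trans (∑-count (map proj₁ ds) l) (N.∑-map proj₁ ds l))))
      eq : dot (gen 0 ((i , ds) ∷ []) none) y ≡ ℤ.+ len l ds ℤ.- z i
      eq = ≡-trans (dot-gen 0 ((i , ds) ∷ []) none) (≡-trans (cong₂ ℤ._+_ left right) (ℤₚ.+-comm (ℤ.- z i) (ℤ.+ len l ds)))

    0<i-j⇒j<i : ∀ {i j} → ℤ.0ℤ ℤ.< i ℤ.- j → j ℤ.< i
    0<i-j⇒j<i {i} {j} h = subst₂ ℤ._<_ (ℤₚ.+-identityˡ j) (cancel i j) (ℤₚ.+-monoˡ-< j h)
      where
      cancel : ∀ i j → i ℤ.- j ℤ.+ j ≡ i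
      cancel = ℤ-Solver.solve-∀

    objective : ℤ.+ (t * N.∑ (allFin m) (λ e → cap e * l e)) ℤ.< Z.∑ (allFin k) z
    objective = 0<i-j⇒j<i (subst (ℤ.0ℤ ℤ.<_) eq (All.lookup holds (here refl)))
      where
      left : Z.∑ (allFin k) (λ i → demandPart 1 [] i ℤ.* z i) ≡ Z.∑ (allFin k) z
      left = Z.∑-cong (allFin k) (λ i → ℤₚ.*-identityˡ (z i))
      T = N.∑ (allFin m) (λ e → cap e * l e)
      right : Z.∑ (allFin m) (λ e → edgePart 1 [] none e ℤ.* w e) ≡ ℤ.- (ℤ.+ (t * T))
      right = ≡-trans (Z.∑-cong (allFin m) point) (≡-trans (Z.∑-*ˡ (allFin m) ℤ.-1ℤ _) (≡-trans (ℤₚ.-1*i≡-i _) (cong ℤ.-_ (≡-trans (∑-pos (allFin m) (λ e → t * (cap e * l e))) (cong ℤ.+_ (N.∑-*ˡ (allFin m) t _))))))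
        where
        point : ∀ e → edgePart 1 [] none e ℤ.* w e ≡ ℤ.-1ℤ ℤ.* ℤ.+ (t * (cap e * l e))
        point e = ≡-trans (cong₂ ℤ._*_ (≡-trans (ℤₚ.+-identityˡ _) (cong (λ x → ℤ.- (ℤ.+ x)) (*-identityˡ (t * cap e)))) (l-eq e))
          (≡-trans (sym (ℤₚ.neg-distribˡ-* (ℤ.+ (t * cap e)) (ℤ.+ l e))) (≡-trans (cong ℤ.-_ (≡-trans (sym (ℤₚ.pos-* (t * cap e) (l e))) (cong ℤ.+_ (*-assoc t (cap e) (l e))))) (sym (ℤₚ.-1*i≡-i _))))
      eq : dot (gen 1 [] none) y ≡ Z.∑ (allFin k) z ℤ.- ℤ.+ (t * T)
      eq = ≡-trans (dot-gen 1 [] none) (cong₂ ℤ._+_ left right)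

    violated : t * N.∑ (allFin m) (λ e → cap e * l e) < N.∑ (allFin k) (λ i → dist l (proj₁ (H i)) (proj₂ (H i)))
    violated = ℤₚ.drop‿+<+ (ℤₚ.<-≤-trans objective (ℤₚ.≤-trans (∑-monoℤ (allFin k) (λ i _ → z≤dist i)) (ℤₚ.≤-reflexive (∑-pos (allFin k) _))))
      where
      z≤dist : ∀ i → z i ℤ.≤ ℤ.+ dist l (proj₁ (H i)) (proj₂ (H i))
      z≤dist i = let (ds , isP , eq) = dist-attained l (proj₁ (H i)) (proj₂ (H i)) in subst (λ x → z i ℤ.≤ ℤ.+ x) eq (z-bound i isP)

  module Feasibility (N : ℕ) (s : Fin m → ℕ) where
    q : ℚ
    q = unit N

    flows : ∀ Ps → All IsRoute Ps → List (FlowPath G H)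
    flows []              []        = []
    flows ((i , ds) ∷ Ps) (ok ∷ oks) = record { demand = i ; darts = ds ; isPath = ok ; value = q ; value≥0 = ℚₚ.nonNegative⁻¹ q {{unit-nonneg N}} } ∷ flows Ps oks

    q-step : ∀ a b → q ℚ.* ι a ℚ.+ q ℚ.* ι b ≡ q ℚ.* ι (a + b)
    q-step a b = ≡-trans (sym (ℚₚ.*-distribˡ-+ q (ι a) (ι b))) (cong (q ℚ.*_) (sym (ι-+ a b)))

    demand-total : ∀ i Ps oks → sumℚ G (map FlowPath.value (filter (λ p → FlowPath.demand p ≟ i) (flows Ps oks))) ≡ q ℚ.* ι (N.∑ Ps (serves i))
    demand-total i []              []         = sym (ℚₚ.*-zeroʳ q)
    demand-total i ((j , ds) ∷ Ps) (ok ∷ oks) with j ≟ i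
    ... | yes _ = ≡-trans (cong₂ ℚ._+_ (sym (ℚₚ.*-identityʳ q)) (demand-total i Ps oks)) (q-step 1 (N.∑ Ps (serves i)))
    ... | no _  = demand-total i Ps oks

    usage-total : ∀ e Ps oks → sumℚ G (map (λ p → FlowPath.value p ℚ.* ℕtoℚ G (uses G e (FlowPath.darts p))) (flows Ps oks)) ≡ q ℚ.* ι (N.∑ Ps (usage e))
    usage-total e []              []         = sym (ℚₚ.*-zeroʳ q)
    usage-total e ((j , ds) ∷ Ps) (ok ∷ oks) = ≡-trans (cong (q ℚ.* ι (uses G e ds) ℚ.+_) (usage-total e Ps oks)) (q-step (uses G e ds) (N.∑ Ps (usage e)))

  -- If the combination is 0, its demand coordinates say that each demand has exactly `N` paths in
  -- `Ps`, and its edge coordinates that `e` is used at most `N * (t * cap e)` times. Giving each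
  -- listed path the value 1 / `N` yields the flow.
  feasible : Combination true (λ _ → ℤ.0ℤ) → Feasible G t H
  feasible (combination zero    st Ps ok s vd ve) = contradiction (st refl) λ ()
  feasible (combination (suc N) st Ps ok s vd ve) = F.flows Ps ok , demand-met , within
    where
    module F = Feasibility N s
    demand-met : ∀ i → sumℚ G (map FlowPath.value (filter (λ p → FlowPath.demand p ≟ i) (F.flows Ps ok))) ≡ ℚ.1ℚ
    demand-met i = ≡-trans (F.demand-total i Ps ok) (≡-trans (cong (λ x → unit N ℚ.* ι x) total) (unit-cancel N 1))
      where
      total : N.∑ Ps (serves i) ≡ suc N * 1
      total = ≡-trans (sym (ℤₚ.+-injective (ℤₚ.i-j≡0⇒i≡j (ℤ.+ suc N) (ℤ.+ N.∑ Ps (serves i)) (sym (vd i))))) (sym (*-identityʳ (suc N)))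
    within : ∀ e → sumℚ G (map (λ p → FlowPath.value p ℚ.* ℕtoℚ G (uses G e (FlowPath.darts p))) (F.flows Ps ok)) ℚ.≤ ℕtoℚ G (t * cap e)
    within e = ℚₚ.≤-trans (ℚₚ.≤-reflexive (F.usage-total e Ps ok)) (ℚₚ.≤-trans (ℚₚ.*-monoˡ-≤-nonNeg (unit N) {{unit-nonneg N}} (ι-mono bound)) (ℚₚ.≤-reflexive (unit-cancel N (t * cap e))))
      where
      bound : N.∑ Ps (usage e) ≤ suc N * (t * cap e)
      bound = ≤-trans (m≤m+n _ (s e)) (≤-reflexive (ℤₚ.+-injective (ℤₚ.i-j≡0⇒i≡j _ _ (sym (ve e)))))

  -- LP duality: the flow problem is feasible unless some edge lengths violate the metric inequality.
  metric-inequality⇒feasible : (∀ l → N.∑ (allFin k) (λ i → dist l (proj₁ (H i)) (proj₂ (H i))) ≤ t * N.∑ (allFin m) (λ e → cap e * l e)) → Feasible G t H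
  metric-inequality⇒feasible metric = decide (fourier-motzkin (k + m) Combination inherited constraints constraints-ok)
    where
    decide : (Σ (Fin (k + m) → ℤ) λ y → All (Holds y) constraints) ⊎ Combination true (λ _ → ℤ.0ℤ) → Feasible G t H
    decide (inj₁ (y , holds)) = contradiction (<-≤-trans (Infeasible.violated y holds) (metric (Infeasible.l y holds))) (<-irrefl refl)
    decide (inj₂ comb)        = feasible comb

theorem4 : ∀ {n m k : ℕ} (G : PlaneGraph n m) (H : Demands n k) →
    SeparableFaceInstance G H → CutCondition G H → Feasible G 3 H
theorem4 G H sep cc = Flow.metric-inequality⇒feasible G H 3 (MetricInequality.metric-inequality G H sep cc)
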